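{- For all $m\ge 2$ there is a properly $m$-tardy c.e. set $A$ satisfying $Q_m(A)$.
   Context: Sets are subsets of $\omega$; $\{W_{e}\}_{e\in\omega}$ is the standard listing of the c.e. sets with standard stagewise enumeration $\{W_{e,s}\}_{s\in\omega}$ (only numbers less than $s$ belong to $W_{e,s}$). $\overline{A}=\omega\setminus A$; $X\subseteq^* Y$ means $X\setminus Y$ is finite. $n$-c.e. sets: for $n\ge 1$, a set $X$ is $n$-c.e. iff there are c.e. sets $X_1,\dots,X_n$ such that $X=(X_1-X_2)\cup\dots\cup(X_{n-2}-X_{n-1})\cup X_n$ if $n$ is odd, and $X=(X_1-X_2)\cup\dots\cup(X_{n-1}-X_n)$ if $n$ is even. Fix an effective listing of all such presentations (sequences $W_{e_1},\dots,W_{e_n}$ of c.e. sets given by indices); $X^n_e$ denotes the $e$-th $n$-c.e. set in this listing, and $X^n_{e,s}$ its stage-$s$ approximation, obtained by replacing each $W_{e_i}$ by $W_{e_i,s}$. $n$-tardy: let $A$ be c.e. with a computable enumeration $\{A_s\}_{s\in\omega}$. $A$ is $n$-tardy iff for every nondecreasing total computable function $p$ there is an $e$ such that $X^n_e=\overline{A}$ and, for all $x$ and all $s$, $x\in X^n_{e,s}$ implies $x\notin A_{p(s)}$. (This does not depend on the choice of enumeration of $A$.) $A$ is properly $n$-tardy if $A$ is $n$-tardy but not $(n-1)$-tardy. $A\subset_m C$ (equivalently $C\supset_m A$; $A$ is a major subset of $C$): $A\subseteq C$, $C-A$ is infinite, and for all $e$, $\overline{C}\subseteq W_e$ implies $\overline{A}\subseteq^*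 W_e$. $S\sqsubset C$: there is a c.e. set $B$ with $S\cup B=C$ and $S\cap B=\emptyset$. The properties $Q_m$, $m\ge 2$ (all set quantifiers range over c.e. sets). For $k\ge 1$, $Q_{2k}(A)$ is the statement $$(\exists C\supset_m A)(\forall B_1\subseteq C)(\forall B_2\subseteq B_1)\cdots(\forall B_k\subseteq B_{k-1})(\exists D_1\subseteq C)(\exists D_2\subseteq D_1)\cdots(\exists D_k\subseteq D_{k-1})$$ $$(\forall S\sqsubset C)(\exists T_1\supseteq\overline{C})(\exists T_2\subseteq T_1)\cdots(\exists T_k\subseteq T_{k-1})\,[\Phi\implies\Psi],$$ where $\Phi$ is: $B_i\cap(S-A)=D_i\cap(S-A)$ for all $1\le i\le k$; and $\Psi$ is: $(A\cup T_{i+1})\cap(S\cap T_i)=B_i\cap(S\cap T_i)$ for all $1\le i<k$, and $A\cap(S\cap T_k)=B_k\cap(S\cap T_k)$. For $k\ge 1$, $Q_{2k+1}(A)$ is the statement $(\exists Y\subseteq\overline{A})\,Q_{2k}(A\cup Y)$. -}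

module Defs where

open import Data.Fin.Base using (Fin; zero; suc; fromℕ; inject₁)
import Data.List.Membership.Propositional as List
open import Data.Maybe using (Maybe; just; nothing; _>>=_; Is-just)
open import Data.Nat.Base using (ℕ; zero; suc; _+_; _*_; _∸_; _≤_; _<_)
open import Data.Product.Base using (_×_; _,_; proj₁; proj₂; ∃-syntax)
open import Data.Sum.Base using (_⊎_)
open import Data.Vec.Base using (Vec; []; _∷_; lookup; map)
open import Level using (0ℓ)
open import Relation.Binary.Definitions using (Monotonic₁)
open import Relation.Binary.PropositionalEquality using (_≡_)
open import Relation.Nullary.Negation using (¬_)
open import Relation.Unary
  using (Pred; ∅; ∁; _∪_; _∩_; _∖_; _⊆_; _≐_; _∈_; _∉_)

------------------------------------------------------------------------
-- Partial computable functions

-- Cantor pairing, ⟨ x , y ⟩ = (x + y)(x + y + 1)/2 + y; unpair is its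
-- inverse, walking along the diagonals (0,0), (1,0), (0,1), (2,0), …

triangle : ℕ → ℕ
triangle zero    = zero
triangle (suc n) = suc n + triangle n

⟨_,_⟩ : ℕ → ℕ → ℕ
⟨ x , y ⟩ = triangle (x + y) + y

next : ℕ × ℕ → ℕ × ℕ
next (zero  , y) = suc y , zero
next (suc x , y) = x , suc y

unpair : ℕ → ℕ × ℕ
unpair zero    = zero , zero
unpair (suc n) = next (unpair n)

-- Unary μ-recursive functions over the pairing.

data Code : Set where
  zeroᶜ succᶜ leftᶜ rightᶜ : Code
  pairᶜ compᶜ precᶜ        : Code → Code → Code
  minᶜ                     : Code → Code

-- `run s c x` is the output of c on x if it is reached within resource
-- bound s; every unfolding of a recursion or of a search costs one unit.
--   precᶜ f g ⟨ a , 0 ⟩      =  f a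
--   precᶜ f g ⟨ a , n + 1 ⟩  =  g ⟨ a , ⟨ n , precᶜ f g ⟨ a , n ⟩ ⟩ ⟩
--   minᶜ f ⟨ a , n ⟩         =  the least i ≥ n with f ⟨ a , i ⟩ = 0,
--                               f ⟨ a , n ⟩, …, f ⟨ a , i ⟩ all converging

precStep : (base step previous : ℕ → Maybe ℕ) → ℕ × ℕ → Maybe ℕ
precStep base step previous (a , zero)  = base a
precStep base step previous (a , suc n) =
  previous ⟨ a , n ⟩ >>= λ y → step ⟨ a , ⟨ n , y ⟩ ⟩

minStep : Maybe ℕ → (continue : ℕ → Maybe ℕ) → ℕ × ℕ → Maybe ℕ
minStep nothing        continue _       = nothing
minStep (just zero)    continue (_ , n) = just n
minStep (just (suc _)) continue (a , n) = continue ⟨ a , suc n ⟩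

run : ℕ → Code → ℕ → Maybe ℕ
run zero    _           _ = nothing
run (suc s) zeroᶜ       _ = just zero
run (suc s) succᶜ       x = just (suc x)
run (suc s) leftᶜ       x = just (proj₁ (unpair x))
run (suc s) rightᶜ      x = just (proj₂ (unpair x))
run (suc s) (pairᶜ f g) x =
  run (suc s) f x >>= λ y → run (suc s) g x >>= λ z → just ⟨ y , z ⟩
run (suc s) (compᶜ f g) x = run (suc s) g x >>= run (suc s) f
run (suc s) (precᶜ f g) x =
  precStep (run (suc s) f) (run (suc s) g) (run s (precᶜ f g)) (unpair x)
run (suc s) (minᶜ f)    x =
  minStep (run (suc s) f x) (run s (minᶜ f)) (unpair x)

-- Index e = ⟨ t , ⟨ a , b ⟩ ⟩ is read as constructor number t applied to
-- the codes with indices a and b. The first argument of decodeWithin is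
-- recursion fuel; suc e always suffices, since a, b < e when t ≥ 4.

node : ℕ → Code → Code → Code
node 0 _ _ = zeroᶜ
node 1 _ _ = succᶜ
node 2 _ _ = leftᶜ
node 3 _ _ = rightᶜ
node 4 c d = pairᶜ c d
node 5 c d = compᶜ c d
node 6 c d = precᶜ c d
node _ c _ = minᶜ c

decodeWithin : ℕ → ℕ → Code
decodeWithin zero    _ = zeroᶜ
decodeWithin (suc k) e =
  let t , r = unpair e
      a , b = unpair r
  in node t (decodeWithin k a) (decodeWithin k b)

decode : ℕ → Code
decode e = decodeWithin (suc e) e

Computable : (ℕ → ℕ) → Set
Computable p = ∃[ e ] ∀ x → ∃[ s ] run s (decode e) x ≡ just (p x)

------------------------------------------------------------------------
-- C.e. sets

W[_]at_ : ℕ → ℕ → Pred ℕ 0ℓ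
(W[ e ]at s) x = x < s × Is-just (run s (decode e) x)

-- Quantification over c.e. sets is expressed below as quantification over
-- indices e of sets W e.

W : ℕ → Pred ℕ 0ℓ
W e x = ∃[ s ] x ∈ W[ e ]at s

Finite : Pred ℕ 0ℓ → Set
Finite X = ∃[ xs ] X ⊆ (List._∈ xs)

Infinite : Pred ℕ 0ℓ → Set
Infinite X = ¬ Finite X

infix 4 _⊆*_ _⊂ₘ_ _⊏_

_⊆*_ : Pred ℕ 0ℓ → Pred ℕ 0ℓ → Set
X ⊆* Y = Finite (X ∖ Y)

_⊂ₘ_ : Pred ℕ 0ℓ → Pred ℕ 0ℓ → Set
A ⊂ₘ C = A ⊆ C × Infinite (C ∖ A) × (∀ e → ∁ C ⊆ W e → ∁ A ⊆* W e)

_⊏_ : Pred ℕ 0ℓ → Pred ℕ 0ℓ → Set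
S ⊏ C = ∃[ b ] (S ∪ W b ≐ C × S ∩ W b ≐ ∅)

------------------------------------------------------------------------
-- n-c.e. sets and tardiness

-- (X₁ − X₂) ∪ (X₃ − X₄) ∪ …, ending in an unpaired Xₙ when n is odd.

differences : ∀ {n} → Vec (Pred ℕ 0ℓ) n → Pred ℕ 0ℓ
differences []           = ∅
differences (X ∷ [])     = X
differences (X ∷ Y ∷ Zs) = (X ∖ Y) ∪ differences Zs

tuple : ∀ n → ℕ → Vec ℕ n
tuple zero    _ = []
tuple (suc n) e = let a , b = unpair e in a ∷ tuple n b

X[_] : ℕ → ℕ → Pred ℕ 0ℓ
X[ n ] e = differences (map W (tuple n e))

X[_,_]at_ : ℕ → ℕ → ℕ → Pred ℕ 0ℓ
X[ n , e ]at s = differences (map (W[_]at s) (tuple n e))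

-- Tardiness of the set W a. As the notion does not depend on the
-- computable enumeration of the set, the standard one is used.

Tardy : ℕ → ℕ → Set
Tardy n a = ∀ (p : ℕ → ℕ) → Computable p → Monotonic₁ _≤_ _≤_ p →
  ∃[ e ] ( X[ n ] e ≐ ∁ (W a)
         × (∀ x s → x ∈ X[ n , e ]at s → x ∉ W[ a ]at (p s)))

ProperlyTardy : ℕ → ℕ → Set
ProperlyTardy n a = Tardy n a × ¬ Tardy (n ∸ 1) a

------------------------------------------------------------------------
-- The properties Q_m

-- In this section k = suc j, so that the sequences B₁, …, Bₖ are nonempty.
-- A sequence of c.e. sets is a vector of indices, and Bᵢ₊₁ is
-- `W (lookup B i)` for i counted from 0.

first last : ∀ {j} → Vec ℕ (suc j) → Pred ℕ 0ℓ
first     B = W (lookup B zero)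
last {j} B = W (lookup B (fromℕ j))

Descending : ∀ {j} → Vec ℕ (suc j) → Set
Descending {j} B = ∀ (i : Fin j) → W (lookup B (suc i)) ⊆ W (lookup B (inject₁ i))

Φ : ∀ {j} (A S : Pred ℕ 0ℓ) (B D : Vec ℕ (suc j)) → Set
Φ {j} A S B D = ∀ (i : Fin (suc j)) →
  W (lookup B i) ∩ (S ∖ A) ≐ W (lookup D i) ∩ (S ∖ A)

Ψ : ∀ {j} (A S : Pred ℕ 0ℓ) (B T : Vec ℕ (suc j)) → Set
Ψ {j} A S B T =
  (∀ (i : Fin j) →
     (A ∪ W (lookup T (suc i))) ∩ (S ∩ W (lookup T (inject₁ i)))
       ≐ W (lookup B (inject₁ i)) ∩ (S ∩ W (lookup T (inject₁ i))))
  × A ∩ (S ∩ last T) ≐ last B ∩ (S ∩ last T)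

-- Q-even j is Q_{2k}, and Q-odd j is Q_{2k+1}.

Q-even : ℕ → Pred ℕ 0ℓ → Set
Q-even j A =
  ∃[ c ] (A ⊂ₘ W c ×
    (∀ (B : Vec ℕ (suc j)) → first B ⊆ W c → Descending B →
      ∃[ D ] (first D ⊆ W c × Descending {j} D ×
        (∀ s → W s ⊏ W c →
          ∃[ T ] (∁ (W c) ⊆ first T × Descending {j} T ×
            (Φ A (W s) B D → Ψ A (W s) B T))))))

Q-odd : ℕ → Pred ℕ 0ℓ → Set
Q-odd j A = ∃[ y ] (W y ⊆ ∁ A × Q-even j (A ∪ W y))

Q : ℕ → Pred ℕ 0ℓ → Set
Q m A = (∃[ j ] (m ≡ 2 * suc j × Q-even j A))
      ⊎ (∃[ j ] (m ≡ 2 * suc j + 1 × Q-odd j A))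

{-# OPTIONS --safe #-}
module Submission where

-- A tree construction, with k = ⌊m/2⌋. Every stage x gets a node, a string that
-- guesses for each gate of smaller index whether it lets every element pass, and
-- x becomes a follower of that node. It enters C when the c.e. sets believed to
-- cover the complement of C contain it, and then rests until it belongs to
-- X[ m ∸ 1 ] i, where i is the length of the node. Now it makes a round through
-- the gates it believes in, from lowest to highest priority: in round r a gate
-- for B puts it into Dᵣ and waits for Bᵣ, a gate for a function p waits from the
-- current stage u until p(u). If x is in X[ m ∸ 1 ] i at the end of the round, it
-- enters A at once, so that X[ m ∸ 1 ] i does not witness tardiness; otherwise it
-- rests again. Every round costs X[ m ∸ 1 ] i two of its m − 1 changes of mind on
-- x, so k rounds suffice, except that for odd m the element may then be kept out
-- of A for good by putting it into Y.
--
-- An element whose node turns out to be to the right of the true path drops the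
-- gates below the splitting point and proceeds into A. Hence, for every gate on
-- the true path, almost all elements of C outside A ∪ Y guess it correctly, which
-- makes A ∪ Y a major subset of C. An element that has arrived at a true gate
-- completes the round, because the remaining gates are true as well. So Tᵣ₊₁ can
-- be the set of elements resting after r rounds, and the complement of A is
-- (T₁ − D₁) ∪ (T₂ − D₂) ∪ … ∪ Y with Dᵣ the elements that arrive in round r.

open import Defs
open import Axiom.ExcludedMiddle using (ExcludedMiddle)
open import Data.Empty using (⊥; ⊥-elim)
open import Data.Fin.Base using (Fin; zero; suc; toℕ; fromℕ; fromℕ<; inject₁)
open import Data.Fin.Properties using (toℕ-inject₁; toℕ-fromℕ; toℕ-fromℕ<; toℕ<n)
open import Data.List.Base using ([]; _∷_; upTo)
import Data.List.Membership.Propositional as List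
open import Data.List.Membership.Propositional.Properties using (∈-upTo⁺)
open import Data.List.Relation.Unary.Any using (here; there)
open import Data.Maybe.Base using (Maybe; just; nothing; _>>=_)
open import Data.Maybe using (Is-just)
open import Data.Maybe.Properties using (just-injective)
import Data.Maybe.Relation.Unary.Any as Maybe
open import Data.Nat.Base
open import Data.Nat.Induction using (<-rec)
open import Data.Nat.Properties
open import Data.Product.Base using (_×_; _,_; proj₁; proj₂; ∃-syntax)
open import Data.Sum.Base using (_⊎_; inj₁; inj₂; [_,_]′; map₂) renaming (map to map-⊎)
open import Data.Unit.Base using (⊤; tt)
open import Data.Vec.Base as Vec using (Vec; []; _∷_; lookup; tabulate)
open import Data.Vec.Properties using (lookup∘tabulate)
open import Function.Base using (_∘_; id; case_of_)
open import Level using (0ℓ)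
open import Relation.Binary.Definitions using (Monotonic₁)
open import Relation.Binary.PropositionalEquality
open import Relation.Nullary.Decidable using (decidable-stable)
open import Relation.Nullary using (¬_; Dec; yes; no; contradiction)
open import Relation.Unary using (Pred; ∅; ∁; _∪_; _∩_; _⊆_; _≐_; _∈_; _∉_)

-- Pairing

-- The order of quantifiers in `Q` shapes the gates. D is chosen from B alone, before the splitting.
-- Suppose a gate of lower priority than a true gate for the same B put an element of both sets S
-- into Dᵣ: then Bᵣ could answer, and a gate between the two could hold the element forever,
-- violating the equations for the true gate. Hence only one gate per sequence asks, and the sides
-- of the splittings must be known before an ascent. They are awaited at the rests and not on entry
-- into C, because a splitting covers nothing outside C.
--
-- Tardiness is measured by the standard enumerations of the sets constructed. A delay must
-- therefore outlast the time that the enumeration of Dᵣ takes to list an arrival. The index of Dᵣ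
-- contains the number of the gate, and this number contains the index of the delay function; a
-- delay that covers all gates below the current stage breaks the circle.
--
-- Only the verification is classical.

fst snd : ℕ → ℕ
fst x = proj₁ (unpair x)
snd x = proj₂ (unpair x)

-- On a diagonal that starts at (x , 0), each step of `next` moves one unit from the first
-- coordinate to the second, until the first is 0.
unpair-walk : ∀ x n → unpair n ≡ (x , 0) → ∀ y z → y + z ≡ x → unpair (n + y) ≡ (z , y)
unpair-walk x n eq zero    z refl = trans (cong unpair (+-identityʳ n)) eq
unpair-walk x n eq (suc y) z p =
  trans (cong unpair (+-suc n y))
        (cong next (unpair-walk x n eq y (suc z) (trans (+-suc y z) p)))

unpair-triangle : ∀ n → unpair (triangle n) ≡ (n , 0)
unpair-triangle zero    = refl
unpair-triangle (suc n) =
  trans (cong (next ∘ unpair) (+-comm n (triangle n)))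
        (cong next (unpair-walk n (triangle n) (unpair-triangle n) n 0 (+-identityʳ n)))

unpair-⟨⟩ : ∀ x y → unpair ⟨ x , y ⟩ ≡ (x , y)
unpair-⟨⟩ x y = unpair-walk (x + y) (triangle (x + y)) (unpair-triangle (x + y)) y x (+-comm y x)

fst-⟨⟩ : ∀ x y → fst ⟨ x , y ⟩ ≡ x
fst-⟨⟩ x y = cong proj₁ (unpair-⟨⟩ x y)

snd-⟨⟩ : ∀ x y → snd ⟨ x , y ⟩ ≡ y
snd-⟨⟩ x y = cong proj₂ (unpair-⟨⟩ x y)

⟨next⟩ : ∀ p → ⟨ proj₁ (next p) , proj₂ (next p) ⟩ ≡ suc ⟨ proj₁ p , proj₂ p ⟩
⟨next⟩ (zero , y) = begin
  suc (y + 0 + triangle (y + 0)) + 0 ≡⟨ +-identityʳ _ ⟩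
  suc (y + 0 + triangle (y + 0))     ≡⟨ cong (λ z → suc (z + triangle z)) (+-identityʳ y) ⟩
  suc (y + triangle y)               ≡⟨ cong suc (+-comm y _) ⟩
  suc (triangle y + y)               ∎
  where open ≡-Reasoning
⟨next⟩ (suc x , y) =
  trans (cong (λ z → triangle z + suc y) (+-suc x y)) (+-suc _ y)

⟨⟩-unpair : ∀ n → ⟨ fst n , snd n ⟩ ≡ n
⟨⟩-unpair zero    = refl
⟨⟩-unpair (suc n) = trans (⟨next⟩ (unpair n)) (cong suc (⟨⟩-unpair n))

n≤triangle : ∀ n → n ≤ triangle n
n≤triangle zero    = z≤n
n≤triangle (suc n) = m≤m+n (suc n) (triangle n)

right≤⟨⟩ : ∀ x y → y ≤ ⟨ x , y ⟩
right≤⟨⟩ x y = m≤n+m y _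

sum≤⟨⟩ : ∀ x y → x + y ≤ ⟨ x , y ⟩
sum≤⟨⟩ x y = ≤-trans (n≤triangle (x + y)) (m≤m+n _ y)

-- Convergence

>>=-mono : (m m′ : Maybe ℕ) (f f′ : ℕ → Maybe ℕ) {y : ℕ} →
  (∀ {z} → m ≡ just z → m′ ≡ just z) →
  (∀ {z w} → f z ≡ just w → f′ z ≡ just w) →
  (m >>= f) ≡ just y → (m′ >>= f′) ≡ just y
>>=-mono (just z) m′ f f′ p q eq rewrite p refl = q eq

precStep-mono : (b b′ st st′ pr pr′ : ℕ → Maybe ℕ) (p : ℕ × ℕ) {y : ℕ} →
  (∀ {z w} → b z ≡ just w → b′ z ≡ just w) →
  (∀ {z w} → st z ≡ just w → st′ z ≡ just w) →
  (∀ {z w} → pr z ≡ just w → pr′ z ≡ just w) →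
  precStep b st pr p ≡ just y → precStep b′ st′ pr′ p ≡ just y
precStep-mono b b′ st st′ pr pr′ (a , zero)  h₁ h₂ h₃ eq = h₁ eq
precStep-mono b b′ st st′ pr pr′ (a , suc n) h₁ h₂ h₃ eq =
  >>=-mono (pr ⟨ a , n ⟩) (pr′ ⟨ a , n ⟩) _ _ h₃ h₂ eq

minStep-mono : (m m′ : Maybe ℕ) (c c′ : ℕ → Maybe ℕ) (p : ℕ × ℕ) {y : ℕ} →
  (∀ {z} → m ≡ just z → m′ ≡ just z) →
  (∀ {z w} → c z ≡ just w → c′ z ≡ just w) →
  minStep m c p ≡ just y → minStep m′ c′ p ≡ just y
minStep-mono (just zero)    m′ c c′ p h₁ h₂ eq rewrite h₁ refl = eq
minStep-mono (just (suc _)) m′ c c′ p h₁ h₂ eq rewrite h₁ refl = h₂ eq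

run-suc : ∀ s c {x y} → run s c x ≡ just y → run (suc s) c x ≡ just y
run-suc (suc s) zeroᶜ  eq = eq
run-suc (suc s) succᶜ  eq = eq
run-suc (suc s) leftᶜ  eq = eq
run-suc (suc s) rightᶜ eq = eq
run-suc (suc s) (pairᶜ f g) {x} eq =
  >>=-mono (run (suc s) f x) (run (suc (suc s)) f x) _ _ (run-suc (suc s) f)
    (λ {z} → >>=-mono (run (suc s) g x) (run (suc (suc s)) g x) _ _ (run-suc (suc s) g) id) eq
run-suc (suc s) (compᶜ f g) {x} eq =
  >>=-mono (run (suc s) g x) (run (suc (suc s)) g x) _ _ (run-suc (suc s) g) (run-suc (suc s) f) eq
run-suc (suc s) (precᶜ f g) {x} eq =
  precStep-mono (run (suc s) f) (run (suc (suc s)) f) (run (suc s) g) (run (suc (suc s)) g)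
    (run s (precᶜ f g)) (run (suc s) (precᶜ f g)) (unpair x)
    (run-suc (suc s) f) (run-suc (suc s) g) (run-suc s (precᶜ f g)) eq
run-suc (suc s) (minᶜ f) {x} eq =
  minStep-mono (run (suc s) f x) (run (suc (suc s)) f x) (run s (minᶜ f)) (run (suc s) (minᶜ f))
    (unpair x) (run-suc (suc s) f) (run-suc s (minᶜ f)) eq

run-mono : ∀ {s s′} c {x y} → s ≤ s′ → run s c x ≡ just y → run s′ c x ≡ just y
run-mono c s≤s′ = go (≤⇒≤′ s≤s′)
  where
  go : ∀ {s s′ x y} → s ≤′ s′ → run s c x ≡ just y → run s′ c x ≡ just y
  go ≤′-refl       eq = eq
  go (≤′-step s≤n) eq = run-suc _ c (go s≤n eq)

record _·_⇓_ (c : Code) (x y : ℕ) : Set where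
  constructor conv
  field
    fuel : ℕ
    runs : run (suc fuel) c x ≡ just y

open _·_⇓_ public

⇓-run : ∀ {c x y s} → run s c x ≡ just y → c · x ⇓ y
⇓-run {c} {s = s} eq = conv s (run-suc s c eq)

pair-⇓ : ∀ {f g x y z} → f · x ⇓ y → g · x ⇓ z → pairᶜ f g · x ⇓ ⟨ y , z ⟩
pair-⇓ {f} {g} {x} {y} {z} (conv s p) (conv t q) = conv (s ⊔ t) eq
  where
  eq : run (suc (s ⊔ t)) (pairᶜ f g) x ≡ just ⟨ y , z ⟩
  eq rewrite run-mono f (s≤s (m≤m⊔n s t)) p | run-mono g (s≤s (m≤n⊔m s t)) q = refl

comp-⇓ : ∀ {f g x y z} → g · x ⇓ y → f · y ⇓ z → compᶜ f g · x ⇓ z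
comp-⇓ {f} {g} {x} {y} {z} (conv s p) (conv t q) = conv (s ⊔ t) eq
  where
  eq : run (suc (s ⊔ t)) (compᶜ f g) x ≡ just z
  eq rewrite run-mono g (s≤s (m≤m⊔n s t)) p = run-mono f (s≤s (m≤n⊔m s t)) q

bind-just : ∀ {m : Maybe ℕ} {f : ℕ → Maybe ℕ} {y z} → m ≡ just y → f y ≡ just z → (m >>= f) ≡ just z
bind-just refl q = q

prec-zero-⇓ : ∀ {f g} a {y} → f · a ⇓ y → precᶜ f g · ⟨ a , 0 ⟩ ⇓ y
prec-zero-⇓ {f} {g} a {y} (conv s p) =
  conv s (trans (cong (precStep (run (suc s) f) (run (suc s) g) (run s (precᶜ f g))) (unpair-⟨⟩ a 0)) p)

prec-suc-⇓ : ∀ {f g} a n y {z} → precᶜ f g · ⟨ a , n ⟩ ⇓ y → g · ⟨ a , ⟨ n , y ⟩ ⟩ ⇓ z →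
  precᶜ f g · ⟨ a , suc n ⟩ ⇓ z
prec-suc-⇓ {f} {g} a n y {z} (conv s p) (conv t q) = conv (suc (s ⊔ t)) (
  trans (cong (precStep (run (suc (suc (s ⊔ t))) f) (run (suc (suc (s ⊔ t))) g) (run (suc (s ⊔ t)) (precᶜ f g))) (unpair-⟨⟩ a (suc n)))
        (bind-just {f = λ y → run (suc (suc (s ⊔ t))) g ⟨ a , ⟨ n , y ⟩ ⟩}
          (run-mono (precᶜ f g) {⟨ a , n ⟩} (s≤s (m≤m⊔n s t)) p)
          (run-mono g (s≤s (m≤n⇒m≤1+n (m≤n⊔m s t))) q)))

minStep-there : ∀ {m : Maybe ℕ} {c a n y z} → m ≡ just (suc y) → c ⟨ a , suc n ⟩ ≡ just z →
  minStep m c (a , n) ≡ just z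
minStep-there refl q = q

min-here-⇓ : ∀ {f} a n → f · ⟨ a , n ⟩ ⇓ 0 → minᶜ f · ⟨ a , n ⟩ ⇓ n
min-here-⇓ {f} a n (conv s p) =
  conv s (trans (cong (minStep (run (suc s) f ⟨ a , n ⟩) (run s (minᶜ f))) (unpair-⟨⟩ a n))
            (cong (λ m → minStep m (run s (minᶜ f)) (a , n)) p))

min-there-⇓ : ∀ {f} a n {y z} → f · ⟨ a , n ⟩ ⇓ suc y → minᶜ f · ⟨ a , suc n ⟩ ⇓ z →
  minᶜ f · ⟨ a , n ⟩ ⇓ z
min-there-⇓ {f} a n {y} {z} (conv s p) (conv t q) = conv (suc (s ⊔ t)) (
  trans (cong (minStep (run (suc (suc (s ⊔ t))) f ⟨ a , n ⟩) (run (suc (s ⊔ t)) (minᶜ f))) (unpair-⟨⟩ a n))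
        (minStep-there {c = run (suc (s ⊔ t)) (minᶜ f)} {a} {n}
          (run-mono f (s≤s (m≤n⇒m≤1+n (m≤m⊔n s t))) p)
          (run-mono (minᶜ f) (s≤s (m≤n⊔m s t)) q)))

-- Indices of codes

encode : Code → ℕ
encode zeroᶜ       = ⟨ 0 , 0 ⟩
encode succᶜ       = ⟨ 1 , 0 ⟩
encode leftᶜ       = ⟨ 2 , 0 ⟩
encode rightᶜ      = ⟨ 3 , 0 ⟩
encode (pairᶜ f g) = ⟨ 4 , ⟨ encode f , encode g ⟩ ⟩
encode (compᶜ f g) = ⟨ 5 , ⟨ encode f , encode g ⟩ ⟩
encode (precᶜ f g) = ⟨ 6 , ⟨ encode f , encode g ⟩ ⟩
encode (minᶜ f)    = ⟨ 7 , ⟨ encode f , 0 ⟩ ⟩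

args-< : ∀ t a b → suc (a + b) ≤ ⟨ suc t , ⟨ a , b ⟩ ⟩
args-< t a b = begin
  suc (a + b)               ≤⟨ s≤s (sum≤⟨⟩ a b) ⟩
  suc ⟨ a , b ⟩             ≤⟨ s≤s (m≤n+m _ t) ⟩
  suc t + ⟨ a , b ⟩         ≤⟨ sum≤⟨⟩ (suc t) ⟨ a , b ⟩ ⟩
  ⟨ suc t , ⟨ a , b ⟩ ⟩     ∎
  where open ≤-Reasoning

decodeWithin-⟨⟩ : ∀ k t a b →
  decodeWithin (suc k) ⟨ t , ⟨ a , b ⟩ ⟩ ≡ node t (decodeWithin k a) (decodeWithin k b)
decodeWithin-⟨⟩ k t a b rewrite unpair-⟨⟩ t ⟨ a , b ⟩ | unpair-⟨⟩ a b = refl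

-- Fuel above e is never exhausted: by `args-<` both components of an index with positive tag are
-- smaller than the index, and tag 0 is a leaf.
decodeWithin-≡ : ∀ k k′ e → e < k → e < k′ → decodeWithin k e ≡ decodeWithin k′ e
decodeWithin-≡ (suc k) (suc k′) e e<k e<k′ =
  subst (λ z → z < suc k → z < suc k′ → decodeWithin (suc k) z ≡ decodeWithin (suc k′) z)
    (trans (cong ⟨ fst e ,_⟩ (⟨⟩-unpair (snd e))) (⟨⟩-unpair e))
    (λ p q → trans (decodeWithin-⟨⟩ k (fst e) _ _)
               (trans (go (fst e) (fst (snd e)) (snd (snd e)) (s≤s⁻¹ p) (s≤s⁻¹ q))
                      (sym (decodeWithin-⟨⟩ k′ (fst e) _ _))))
    e<k e<k′
  where
  go : ∀ t a b → ⟨ t , ⟨ a , b ⟩ ⟩ ≤ k → ⟨ t , ⟨ a , b ⟩ ⟩ ≤ k′ →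
    node t (decodeWithin k a) (decodeWithin k b) ≡ node t (decodeWithin k′ a) (decodeWithin k′ b)
  go 0 a b p q = refl
  go (suc t) a b p q =
    cong₂ (node (suc t))
      (decodeWithin-≡ k k′ a (≤-trans (≤-trans (s≤s (m≤m+n a b)) (args-< t a b)) p)
                             (≤-trans (≤-trans (s≤s (m≤m+n a b)) (args-< t a b)) q))
      (decodeWithin-≡ k k′ b (≤-trans (≤-trans (s≤s (m≤n+m b a)) (args-< t a b)) p)
                             (≤-trans (≤-trans (s≤s (m≤n+m b a)) (args-< t a b)) q))

decode-⟨⟩ : ∀ t a b → decode ⟨ t , ⟨ a , b ⟩ ⟩ ≡ node t (decode a) (decode b)
decode-⟨⟩ zero a b = decodeWithin-⟨⟩ ⟨ 0 , ⟨ a , b ⟩ ⟩ 0 a b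
decode-⟨⟩ (suc t) a b =
  trans (decodeWithin-⟨⟩ ⟨ suc t , ⟨ a , b ⟩ ⟩ (suc t) a b)
        (cong₂ (node (suc t))
          (decodeWithin-≡ _ _ a (≤-trans (s≤s (m≤m+n a b)) (args-< t a b)) ≤-refl)
          (decodeWithin-≡ _ _ b (≤-trans (s≤s (m≤n+m b a)) (args-< t a b)) ≤-refl))

decode-unpair : ∀ e → decode e ≡ node (fst e) (decode (fst (snd e))) (decode (snd (snd e)))
decode-unpair e =
  trans (cong decode (sym (trans (cong ⟨ fst e ,_⟩ (⟨⟩-unpair (snd e))) (⟨⟩-unpair e))))
        (decode-⟨⟩ (fst e) (fst (snd e)) (snd (snd e)))

decode-encode : ∀ c → decode (encode c) ≡ c
decode-encode zeroᶜ  = refl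
decode-encode succᶜ  = refl
decode-encode leftᶜ  = refl
decode-encode rightᶜ = refl
decode-encode (pairᶜ f g) =
  trans (decode-⟨⟩ 4 (encode f) (encode g)) (cong₂ pairᶜ (decode-encode f) (decode-encode g))
decode-encode (compᶜ f g) =
  trans (decode-⟨⟩ 5 (encode f) (encode g)) (cong₂ compᶜ (decode-encode f) (decode-encode g))
decode-encode (precᶜ f g) =
  trans (decode-⟨⟩ 6 (encode f) (encode g)) (cong₂ precᶜ (decode-encode f) (decode-encode g))
decode-encode (minᶜ f) = trans (decode-⟨⟩ 7 (encode f) 0) (cong minᶜ (decode-encode f))

-- Total computable functions of several variables

enc : ∀ {n} → Vec ℕ n → ℕ
enc []      = 0
enc (x ∷ ρ) = ⟨ x , enc ρ ⟩

-- A function travels together with a code for it, so whatever is assembled from these combinators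
-- is computable by construction. Proofs look at `fn` only, and `withFn` replaces it by an equal
-- function of a more convenient form.
record Exp (n : ℕ) : Set where
  no-eta-equality
  constructor mkExp
  field
    fn       : Vec ℕ n → ℕ
    code     : Code
    computes : ∀ ρ → code · enc ρ ⇓ fn ρ

open Exp public

withFn : ∀ {n} (e : Exp n) (f : Vec ℕ n → ℕ) → (∀ ρ → fn e ρ ≡ f ρ) → Exp n
withFn e f eq = mkExp f (code e) (λ ρ → subst (code e · enc ρ ⇓_) (eq ρ) (computes e ρ))

fst-⇓ : ∀ x y → leftᶜ · ⟨ x , y ⟩ ⇓ x
fst-⇓ x y = conv 0 (cong just (fst-⟨⟩ x y))

snd-⇓ : ∀ x y → rightᶜ · ⟨ x , y ⟩ ⇓ y
snd-⇓ x y = conv 0 (cong just (snd-⟨⟩ x y))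

idᶜ : Code
idᶜ = pairᶜ leftᶜ rightᶜ

id-run : ∀ s x → run (suc s) idᶜ x ≡ just x
id-run s x = cong just (⟨⟩-unpair x)

id-⇓ : ∀ {x} → idᶜ · x ⇓ x
id-⇓ {x} = conv 0 (id-run 0 x)

varᶜ : ∀ {n} → Fin n → Code
varᶜ zero    = leftᶜ
varᶜ (suc i) = compᶜ (varᶜ i) rightᶜ

var : ∀ {n} → Fin n → Exp n
var i = mkExp (λ ρ → lookup ρ i) (varᶜ i) (go i)
  where
  go : ∀ {n} (i : Fin n) ρ → varᶜ i · enc ρ ⇓ lookup ρ i
  go zero    (x ∷ ρ) = fst-⇓ x (enc ρ)
  go (suc i) (x ∷ ρ) = comp-⇓ (snd-⇓ x (enc ρ)) (go i ρ)

v0 : ∀ {n} → Exp (1 + n)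
v0 = var zero
v1 : ∀ {n} → Exp (2 + n)
v1 = var (suc zero)
v2 : ∀ {n} → Exp (3 + n)
v2 = var (suc (suc zero))
v3 : ∀ {n} → Exp (4 + n)
v3 = var (suc (suc (suc zero)))
v4 : ∀ {n} → Exp (5 + n)
v4 = var (suc (suc (suc (suc zero))))
v5 : ∀ {n} → Exp (6 + n)
v5 = var (suc (suc (suc (suc (suc zero)))))
v6 : ∀ {n} → Exp (7 + n)
v6 = var (suc (suc (suc (suc (suc (suc zero))))))

constᶜ : ℕ → Code
constᶜ zero    = zeroᶜ
constᶜ (suc k) = compᶜ succᶜ (constᶜ k)

const-run : ∀ k s x → run (suc s) (constᶜ k) x ≡ just k
const-run zero    s x = refl
const-run (suc k) s x rewrite const-run k s x = refl

lit : ∀ {n} → ℕ → Exp n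
lit k = mkExp (λ _ → k) (constᶜ k) (λ ρ → conv 0 (const-run k 0 (enc ρ)))

sucE : ∀ {n} → Exp n → Exp n
sucE e = mkExp (suc ∘ fn e) (compᶜ succᶜ (code e)) (λ ρ → comp-⇓ (computes e ρ) (conv 0 refl))

pairE : ∀ {n} → Exp n → Exp n → Exp n
pairE e e′ = mkExp (λ ρ → ⟨ fn e ρ , fn e′ ρ ⟩) (pairᶜ (code e) (code e′))
  (λ ρ → pair-⇓ (computes e ρ) (computes e′ ρ))

fstE sndE : ∀ {n} → Exp n → Exp n
fstE e = mkExp (fst ∘ fn e) (compᶜ leftᶜ (code e)) (λ ρ → comp-⇓ (computes e ρ) (conv 0 refl))
sndE e = mkExp (snd ∘ fn e) (compᶜ rightᶜ (code e)) (λ ρ → comp-⇓ (computes e ρ) (conv 0 refl))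

fns : ∀ {m n} → Vec (Exp n) m → Vec ℕ n → Vec ℕ m
fns []       ρ = []
fns (e ∷ es) ρ = fn e ρ ∷ fns es ρ

tupleᶜ : ∀ {m n} → Vec (Exp n) m → Code
tupleᶜ []       = zeroᶜ
tupleᶜ (e ∷ es) = pairᶜ (code e) (tupleᶜ es)

tuple-⇓ : ∀ {m n} (es : Vec (Exp n) m) ρ → tupleᶜ es · enc ρ ⇓ enc (fns es ρ)
tuple-⇓ []       ρ = conv 0 refl
tuple-⇓ (e ∷ es) ρ = pair-⇓ (computes e ρ) (tuple-⇓ es ρ)

app : ∀ {m n} → Exp m → Vec (Exp n) m → Exp n
app f es = mkExp (fn f ∘ fns es) (compᶜ (code f) (tupleᶜ es))
  (λ ρ → comp-⇓ (tuple-⇓ es ρ) (computes f (fns es ρ)))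

skip₁ : ∀ {n} → Exp (suc n) → Exp (2 + n)
skip₁ {n} e = mkExp f (compᶜ (code e) (pairᶜ leftᶜ (compᶜ rightᶜ rightᶜ))) c
  where
  f : Vec ℕ (2 + n) → ℕ
  f (i ∷ _ ∷ ρ) = fn e (i ∷ ρ)
  c : ∀ ρ → compᶜ (code e) (pairᶜ leftᶜ (compᶜ rightᶜ rightᶜ)) · enc ρ ⇓ f ρ
  c (i ∷ y ∷ ρ) = comp-⇓ (pair-⇓ (fst-⇓ i _) (comp-⇓ (snd-⇓ i ⟨ y , enc ρ ⟩) (snd-⇓ y (enc ρ)))) (computes e (i ∷ ρ))

weaken : ∀ {n} → Exp n → Exp (1 + n)
weaken {n} e = mkExp f (compᶜ (code e) rightᶜ) c
  where
  f : Vec ℕ (1 + n) → ℕ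
  f (_ ∷ ρ) = fn e ρ
  c : ∀ ρ → compᶜ (code e) rightᶜ · enc ρ ⇓ f ρ
  c (x ∷ ρ) = comp-⇓ (snd-⇓ x (enc ρ)) (computes e ρ)

natrec : ℕ → (ℕ → ℕ → ℕ) → ℕ → ℕ
natrec z s zero    = z
natrec z s (suc n) = s n (natrec z s n)

-- In the step, variable 0 is the index and variable 1 the previous value.
recE : ∀ {n} → Exp n → Exp (2 + n) → Exp n → Exp n
recE {n} b st t = mkExp f (compᶜ (precᶜ (code b) st′) (pairᶜ idᶜ (code t)))
    (λ ρ → comp-⇓ (pair-⇓ id-⇓ (computes t ρ)) (go ρ (fn t ρ)))
  where
  f : Vec ℕ n → ℕ
  f ρ = natrec (fn b ρ) (λ i y → fn st (i ∷ y ∷ ρ)) (fn t ρ)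
  st′ : Code
  -- `precᶜ` supplies the environment, then the index and the previous value; the step expects the
  -- environment last.
  st′ = compᶜ (code st)
          (pairᶜ (compᶜ leftᶜ rightᶜ) (pairᶜ (compᶜ rightᶜ rightᶜ) leftᶜ))
  go : ∀ ρ k → precᶜ (code b) st′ · ⟨ enc ρ , k ⟩ ⇓ natrec (fn b ρ) (λ i y → fn st (i ∷ y ∷ ρ)) k
  go ρ zero    = prec-zero-⇓ (enc ρ) (computes b ρ)
  go ρ (suc k) = prec-suc-⇓ (enc ρ) k y (go ρ k)
    (comp-⇓ (pair-⇓ (comp-⇓ (snd-⇓ (enc ρ) ⟨ k , y ⟩) (fst-⇓ k y))
                    (pair-⇓ (comp-⇓ (snd-⇓ (enc ρ) ⟨ k , y ⟩) (snd-⇓ k y)) (fst-⇓ (enc ρ) ⟨ k , y ⟩)))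
            (computes st (k ∷ y ∷ ρ)))
    where
    y : ℕ
    y = natrec (fn b ρ) (λ i y → fn st (i ∷ y ∷ ρ)) k

predE : ∀ {n} → Exp n → Exp n
predE e = withFn (recE (lit 0) v0 e) (pred ∘ fn e) (λ ρ → go (fn e ρ))
  where
  go : ∀ n → natrec 0 (λ i _ → i) n ≡ pred n
  go zero    = refl
  go (suc n) = refl

infixl 6 _⊕_ _⊖_
infixl 7 _⊛_

_⊕_ _⊖_ _⊛_ : ∀ {n} → Exp n → Exp n → Exp n
a ⊕ b = withFn (recE b (sucE v1) a) (λ ρ → fn a ρ + fn b ρ) (λ ρ → go (fn b ρ) (fn a ρ))
  where
  go : ∀ x y → natrec x (λ _ → suc) y ≡ y + x
  go x zero    = refl
  go x (suc y) = cong suc (go x y)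
a ⊖ b = withFn (recE a (predE v1) b) (λ ρ → fn a ρ ∸ fn b ρ) (λ ρ → go (fn a ρ) (fn b ρ))
  where
  go : ∀ x y → natrec x (λ _ → pred) y ≡ x ∸ y
  go x zero    = refl
  go x (suc y) = trans (cong pred (go x y)) (pred[m∸n]≡m∸[1+n] x y)
_⊛_ {n} a b = withFn (recE (lit 0) (weaken (weaken b) ⊕ v1) a) (λ ρ → fn a ρ * fn b ρ)
    (λ ρ → go (fn b ρ) (fn a ρ))
  where
  go : ∀ x y → natrec 0 (λ _ → x +_) y ≡ y * x
  go x zero    = refl
  go x (suc y) = cong (x +_) (go x y)

sw : ℕ → ℕ → ℕ → ℕ
sw zero    a b = a
sw (suc _) a b = b

switch : ∀ {n} → Exp n → Exp n → Exp n → Exp n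
switch t a b = withFn (recE a (weaken (weaken b)) t) (λ ρ → sw (fn t ρ) (fn a ρ) (fn b ρ))
    (λ ρ → go (fn t ρ))
  where
  go : ∀ {x y} t → natrec x (λ _ _ → y) t ≡ sw t x y
  go zero    = refl
  go (suc t) = refl

-- Decidable relations; zero stands for truth.

record Form (n : ℕ) : Set₁ where
  no-eta-equality
  constructor mkForm
  field
    Holds    : Vec ℕ n → Set
    χ        : Exp n
    sound    : ∀ ρ → fn χ ρ ≡ 0 → Holds ρ
    complete : ∀ ρ → Holds ρ → fn χ ρ ≡ 0

open Form public

holds? : ∀ {n} (φ : Form n) ρ → Dec (Holds φ ρ)
holds? φ ρ with fn (χ φ) ρ ≟ 0
... | yes eq = yes (sound φ ρ eq)
... | no neq = no (neq ∘ complete φ ρ)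

withHolds : ∀ {n} (φ : Form n) (P : Vec ℕ n → Set) →
  (∀ ρ → Holds φ ρ → P ρ) → (∀ ρ → P ρ → Holds φ ρ) → Form n
withHolds φ P to from = mkForm P (χ φ) (λ ρ → to ρ ∘ sound φ ρ) (λ ρ → complete φ ρ ∘ from ρ)

appF : ∀ {m n} → Form m → Vec (Exp n) m → Form n
appF φ es = mkForm (Holds φ ∘ fns es) (app (χ φ) es) (sound φ ∘ fns es) (complete φ ∘ fns es)

infix  4 _≡ᶠ_ _<ᶠ_ _≤ᶠ_
infixr 3 _∧ᶠ_
infixr 2 _∨ᶠ_
infixr 1 _⇒ᶠ_

-- With zero as truth, a sum is a conjunction and a product a disjunction; the bounded quantifiers
-- below iterate these.
_∧ᶠ_ _∨ᶠ_ _⇒ᶠ_ : ∀ {n} → Form n → Form n → Form n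
φ ∧ᶠ ψ = mkForm (λ ρ → Holds φ ρ × Holds ψ ρ) (χ φ ⊕ χ ψ)
  (λ ρ eq → sound φ ρ (m+n≡0⇒m≡0 (fn (χ φ) ρ) eq) , sound ψ ρ (m+n≡0⇒n≡0 (fn (χ φ) ρ) eq))
  (λ ρ (p , q) → cong₂ _+_ (complete φ ρ p) (complete ψ ρ q))
φ ∨ᶠ ψ = mkForm (λ ρ → Holds φ ρ ⊎ Holds ψ ρ) (χ φ ⊛ χ ψ)
  (λ ρ eq → [ inj₁ ∘ sound φ ρ , inj₂ ∘ sound ψ ρ ]′ (m*n≡0⇒m≡0∨n≡0 (fn (χ φ) ρ) eq))
  (λ ρ → [ (λ p → cong (_* fn (χ ψ) ρ) (complete φ ρ p)) ,
           (λ q → trans (cong (fn (χ φ) ρ *_) (complete ψ ρ q)) (*-zeroʳ (fn (χ φ) ρ))) ]′)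

¬ᶠ_ : ∀ {n} → Form n → Form n
¬ᶠ φ = mkForm (λ ρ → ¬ Holds φ ρ) (switch (χ φ) (lit 1) (lit 0)) s c
  where
  s : ∀ ρ → sw (fn (χ φ) ρ) 1 0 ≡ 0 → ¬ Holds φ ρ
  s ρ eq p rewrite complete φ ρ p = contradiction eq λ ()
  c : ∀ ρ → ¬ Holds φ ρ → sw (fn (χ φ) ρ) 1 0 ≡ 0
  c ρ np with fn (χ φ) ρ in eq
  ... | zero  = contradiction (sound φ ρ eq) np
  ... | suc _ = refl

φ ⇒ᶠ ψ = withHolds (¬ᶠ φ ∨ᶠ ψ) (λ ρ → Holds φ ρ → Holds ψ ρ)
  (λ ρ → [ (λ np p → contradiction p np) , (λ q _ → q) ]′)
  from
  where
  from : ∀ ρ → (Holds φ ρ → Holds ψ ρ) → ¬ Holds φ ρ ⊎ Holds ψ ρ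
  from ρ f with holds? φ ρ
  ... | yes p = inj₂ (f p)
  ... | no np = inj₁ np

_≤ᶠ_ _<ᶠ_ _≡ᶠ_ : ∀ {n} → Exp n → Exp n → Form n
a ≤ᶠ b = mkForm (λ ρ → fn a ρ ≤ fn b ρ) (a ⊖ b) (λ ρ → m∸n≡0⇒m≤n) (λ ρ → m≤n⇒m∸n≡0)
a <ᶠ b = mkForm (λ ρ → fn a ρ < fn b ρ) (sucE a ⊖ b) (λ ρ → m∸n≡0⇒m≤n) (λ ρ → m≤n⇒m∸n≡0)
a ≡ᶠ b = withHolds (a ≤ᶠ b ∧ᶠ b ≤ᶠ a) (λ ρ → fn a ρ ≡ fn b ρ)
  (λ ρ (p , q) → ≤-antisym p q) (λ ρ eq → ≤-reflexive eq , ≤-reflexive (sym eq))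

all< : ∀ {n} → Exp n → Form (suc n) → Form n
all< t φ = mkForm (λ ρ → ∀ i → i < fn t ρ → Holds φ (i ∷ ρ)) (recE (lit 0) (skip₁ (χ φ) ⊕ v1) t)
    (λ ρ → s ρ (fn t ρ)) (λ ρ → c ρ (fn t ρ))
  where
  s : ∀ ρ k → natrec 0 (λ i y → fn (χ φ) (i ∷ ρ) + y) k ≡ 0 → ∀ i → i < k → Holds φ (i ∷ ρ)
  s ρ (suc k) eq i i<k with m≤n⇒m<n∨m≡n (s≤s⁻¹ i<k)
  ... | inj₁ i<k′ = s ρ k (m+n≡0⇒n≡0 (fn (χ φ) (k ∷ ρ)) eq) i i<k′
  ... | inj₂ refl = sound φ (k ∷ ρ) (m+n≡0⇒m≡0 (fn (χ φ) (k ∷ ρ)) eq)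
  c : ∀ ρ k → (∀ i → i < k → Holds φ (i ∷ ρ)) → natrec 0 (λ i y → fn (χ φ) (i ∷ ρ) + y) k ≡ 0
  c ρ zero    h = refl
  c ρ (suc k) h = cong₂ _+_ (complete φ (k ∷ ρ) (h k ≤-refl)) (c ρ k (λ i p → h i (m≤n⇒m≤1+n p)))

ex< : ∀ {n} → Exp n → Form (suc n) → Form n
ex< t φ = mkForm (λ ρ → ∃[ i ] (i < fn t ρ × Holds φ (i ∷ ρ)))
    (recE (lit 1) (skip₁ (χ φ) ⊛ v1) t) (λ ρ → s ρ (fn t ρ)) (λ ρ → c ρ (fn t ρ))
  where
  s : ∀ ρ k → natrec 1 (λ i y → fn (χ φ) (i ∷ ρ) * y) k ≡ 0 → ∃[ i ] (i < k × Holds φ (i ∷ ρ))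
  s ρ (suc k) eq with m*n≡0⇒m≡0∨n≡0 (fn (χ φ) (k ∷ ρ)) eq
  ... | inj₁ p = k , ≤-refl , sound φ (k ∷ ρ) p
  ... | inj₂ p with s ρ k p
  ...   | i , i<k , h = i , m≤n⇒m≤1+n i<k , h
  c : ∀ ρ k → ∃[ i ] (i < k × Holds φ (i ∷ ρ)) → natrec 1 (λ i y → fn (χ φ) (i ∷ ρ) * y) k ≡ 0
  c ρ (suc k) (i , i<k , h) with m≤n⇒m<n∨m≡n (s≤s⁻¹ i<k)
  ... | inj₁ i<k′ = trans (cong (fn (χ φ) (k ∷ ρ) *_) (c ρ k (i , i<k′ , h))) (*-zeroʳ (fn (χ φ) (k ∷ ρ)))
  ... | inj₂ refl = cong (_* natrec 1 (λ i y → fn (χ φ) (i ∷ ρ) * y) k) (complete φ (k ∷ ρ) h)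

ifE : ∀ {n} → Form n → Exp n → Exp n → Exp n
ifE φ a b = switch (χ φ) a b

if-elim : ∀ {n} (φ : Form n) a b ρ (P : ℕ → Set) → (Holds φ ρ → P (fn a ρ)) →
  (¬ Holds φ ρ → P (fn b ρ)) → P (fn (ifE φ a b) ρ)
if-elim φ a b ρ P yes-case no-case = go (fn (χ φ) ρ) refl
  where
  go : ∀ c → fn (χ φ) ρ ≡ c → P (sw c (fn a ρ) (fn b ρ))
  go zero    eq = yes-case (sound φ ρ eq)
  go (suc c) eq = no-case λ h → case trans (sym eq) (complete φ ρ h) of λ ()

-- Unbounded search

-- `minᶜ` keeps the variable of the search in the second component, an environment in the first;
-- hence the swap.
searchᶜ : ∀ {n} → Form (suc n) → Code
searchᶜ φ = minᶜ (compᶜ (code (χ φ)) (pairᶜ rightᶜ leftᶜ))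

search-⇓ : ∀ {n} (φ : Form (suc n)) ρ i k → (∀ j → i ≤ j → j < i + k → ¬ Holds φ (j ∷ ρ)) →
  Holds φ (i + k ∷ ρ) → searchᶜ φ · ⟨ enc ρ , i ⟩ ⇓ (i + k)
search-⇓ φ ρ i zero h p =
  subst (searchᶜ φ · ⟨ enc ρ , i ⟩ ⇓_) (sym (+-identityʳ i))
    (min-here-⇓ (enc ρ) i (comp-⇓ (pair-⇓ (snd-⇓ (enc ρ) i) (fst-⇓ (enc ρ) i))
      (subst (code (χ φ) · enc (i ∷ ρ) ⇓_) (complete φ (i ∷ ρ) (subst (λ z → Holds φ (z ∷ ρ)) (+-identityʳ i) p))
        (computes (χ φ) (i ∷ ρ)))))
search-⇓ φ ρ i (suc k) h p =
  subst (searchᶜ φ · ⟨ enc ρ , i ⟩ ⇓_) (sym (+-suc i k))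
    (min-there-⇓ (enc ρ) i {pred (fn (χ φ) (i ∷ ρ))} (comp-⇓ (pair-⇓ (snd-⇓ (enc ρ) i) (fst-⇓ (enc ρ) i))
        (subst (code (χ φ) · enc (i ∷ ρ) ⇓_) (nonzero (h i ≤-refl (m<m+n i z<s))) (computes (χ φ) (i ∷ ρ))))
      (search-⇓ φ ρ (suc i) k (λ j i<j j<k → h j (<⇒≤ i<j) (subst (j <_) (sym (+-suc i k)) j<k))
        (subst (λ z → Holds φ (z ∷ ρ)) (+-suc i k) p)))
  where
  nonzero : ¬ Holds φ (i ∷ ρ) → fn (χ φ) (i ∷ ρ) ≡ suc (pred (fn (χ φ) (i ∷ ρ)))
  nonzero nh with fn (χ φ) (i ∷ ρ) in eq
  ... | zero  = contradiction (sound φ (i ∷ ρ) eq) nh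
  ... | suc _ = refl

least : {P : ℕ → Set} → (∀ i → Dec (P i)) → ∀ k → P k → ∃[ i ] (P i × (∀ j → j < i → ¬ P j))
least {P} P? k p = go k 0 (λ _ ()) (subst P (sym (+-identityʳ k)) p)
  where
  go : ∀ k i → (∀ j → j < i → ¬ P j) → P (k + i) → ∃[ i ] (P i × (∀ j → j < i → ¬ P j))
  go k i h p with P? i
  go k       i h p | yes q = i , q , h
  go zero    i h p | no nq = contradiction p nq
  go (suc k) i h p | no nq = go k (suc i) h′ (subst P (sym (+-suc k i)) p)
    where
    h′ : ∀ j → j < suc i → ¬ P j
    h′ j j<i with m≤n⇒m<n∨m≡n (s≤s⁻¹ j<i)
    ... | inj₁ j<i′ = h j j<i′
    ... | inj₂ refl = nq

opaque
  minE : ∀ {n} (φ : Form (suc n)) → (∀ ρ → ∃[ i ] Holds φ (i ∷ ρ)) → Exp n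
  minE {n} φ total = mkExp (λ ρ → proj₁ (m ρ)) (compᶜ (searchᶜ φ) (pairᶜ idᶜ zeroᶜ))
      (λ ρ → comp-⇓ (pair-⇓ id-⇓ (conv 0 refl))
        (search-⇓ φ ρ 0 (proj₁ (m ρ)) (λ j _ → proj₂ (proj₂ (m ρ)) j) (proj₁ (proj₂ (m ρ)))))
    where
    m : ∀ ρ → ∃[ i ] (Holds φ (i ∷ ρ) × (∀ j → j < i → ¬ Holds φ (j ∷ ρ)))
    m ρ = least (λ i → holds? φ (i ∷ ρ)) (proj₁ (total ρ)) (proj₂ (total ρ))

  min-holds : ∀ {n} (φ : Form (suc n)) total ρ → Holds φ (fn (minE φ total) ρ ∷ ρ)
  min-holds φ total ρ =
    proj₁ (proj₂ (least (λ i → holds? φ (i ∷ ρ)) (proj₁ (total ρ)) (proj₂ (total ρ))))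

  min-least : ∀ {n} (φ : Form (suc n)) total ρ j → Holds φ (j ∷ ρ) → fn (minE φ total) ρ ≤ j
  min-least φ total ρ j h = ≮⇒≥ λ j<m →
    proj₂ (proj₂ (least (λ i → holds? φ (i ∷ ρ)) (proj₁ (total ρ)) (proj₂ (total ρ)))) j j<m h

-- A stack machine computing run

opaque
  -- `run` recurses on the bound and on the code at once, which `recE` does not offer; the machine
  -- turns this into the iteration of a single step. A configuration evaluates, returns a value to
  -- the stack, or has failed. Failure discards the stack, because `nothing` passes through every
  -- pending frame. The successor in `push` leaves 0 for the empty stack.
  evalC : ℕ → ℕ → ℕ → ℕ → ℕ
  evalC K s e x = ⟨ 0 , ⟨ K , ⟨ s , ⟨ e , x ⟩ ⟩ ⟩ ⟩

  retC : ℕ → ℕ → ℕ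
  retC K v = ⟨ 1 , ⟨ K , v ⟩ ⟩

  failC : ℕ
  failC = ⟨ 2 , 0 ⟩

  push : ℕ → ℕ → ℕ → ℕ → ℕ → ℕ → ℕ
  push t a b c d K = suc ⟨ ⟨ t , ⟨ a , ⟨ b , ⟨ c , d ⟩ ⟩ ⟩ ⟩ , K ⟩

evalX : ∀ {n} → Exp n → Exp n → Exp n → Exp n → Exp n
evalX K s e x = pairE (lit 0) (pairE K (pairE s (pairE e x)))

retX : ∀ {n} → Exp n → Exp n → Exp n
retX K v = pairE (lit 1) (pairE K v)

pushX : ∀ {n} → ℕ → Exp n → Exp n → Exp n → Exp n → Exp n → Exp n
pushX t a b c d K = sucE (pairE (pairE (lit t) (pairE a (pairE b (pairE c d)))) K)

-- Tags beyond the end fall to the last entry, just as `node` reads every tag from 7 on as `minᶜ`.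
pick : ∀ {n} → ℕ → Vec ℕ (suc n) → ℕ
pick zero    (a ∷ _)     = a
pick (suc t) (a ∷ [])    = a
pick (suc t) (a ∷ b ∷ v) = pick t (b ∷ v)

pick-last : ∀ t a → pick t (a ∷ []) ≡ a
pick-last zero    a = refl
pick-last (suc t) a = refl

cases : ∀ {m n} → Exp n → Vec (Exp n) (suc m) → Exp n
cases t es = withFn (go t es) (λ ρ → pick (fn t ρ) (fns es ρ)) (λ ρ → go-pick t es ρ (fn t ρ) refl)
  where
  go : ∀ {m n} → Exp n → Vec (Exp n) (suc m) → Exp n
  go t (a ∷ [])    = a
  go t (a ∷ b ∷ v) = switch t a (go (predE t) (b ∷ v))
  go-pick : ∀ {m n} (t : Exp n) (es : Vec (Exp n) (suc m)) ρ k → fn t ρ ≡ k →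
    fn (go t es) ρ ≡ pick k (fns es ρ)
  go-pick t (a ∷ [])    ρ zero    eq = refl
  go-pick t (a ∷ [])    ρ (suc k) eq = refl
  go-pick t (a ∷ b ∷ v) ρ zero    eq = cong (λ z → sw z (fn a ρ) (fn (go (predE t) (b ∷ v)) ρ)) eq
  go-pick t (a ∷ b ∷ v) ρ (suc k) eq =
    trans (cong (λ z → sw z (fn a ρ) (fn (go (predE t) (b ∷ v)) ρ)) eq)
          (go-pick (predE t) (b ∷ v) ρ k (cong pred eq))

opaque
  unfolding failC

  -- variables: stack, resource bound, index, input
  evalBranches : Vec (Exp 4) 8
  evalBranches =
    ( retX v0 (lit 0)
    ∷ retX v0 (sucE v3)
    ∷ retX v0 (fstE v3)
    ∷ retX v0 (sndE v3)
    ∷ evalX (pushX 0 v1 r v3 (lit 0) v0) v1 l v3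
    ∷ evalX (pushX 2 v1 l (lit 0) (lit 0) v0) v1 r v3
    ∷ switch (sndE v3) (evalX v0 v1 l (fstE v3))
        (evalX (pushX 3 v1 r (fstE v3) (predE (sndE v3)) v0) (predE v1) v2
               (pairE (fstE v3) (predE (sndE v3))))
    ∷ evalX (pushX 4 (predE v1) v2 v3 (lit 0) v0) v1 l v3
    ∷ [])
    where
    l r : Exp 4
    l = fstE (sndE v2)
    r = sndE (sndE v2)

  evalStep : Exp 4
  evalStep = switch v1 (lit failC) (cases (fstE v2) evalBranches)

  -- variables: value, rest of the stack, tag of the top frame and its data
  retStep : Exp 7
  retStep = cases v2
    ( evalX (pushX 1 v0 (lit 0) (lit 0) (lit 0) v1) v3 v4 v5
    ∷ retX v1 (pairE v3 v0)
    ∷ evalX v1 v3 v4 v0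
    ∷ evalX v1 v3 v4 (pairE v5 (pairE v6 v0))
    ∷ switch v0 (retX v1 (sndE v5)) (evalX v1 v3 v4 (pairE (fstE v5) (sucE (sndE v5))))
    ∷ [])

machineStep : Exp 1
machineStep = switch (fstE v0)
  (app evalStep (K ∷ fstE r ∷ fstE (sndE r) ∷ sndE (sndE r) ∷ []))
  (switch (predE (fstE v0))
    (switch K v0
      (app retStep (r ∷ sndE (predE K) ∷ fstE f ∷ fstE (sndE f) ∷ fstE (sndE (sndE f))
        ∷ fstE (sndE (sndE (sndE f))) ∷ sndE (sndE (sndE (sndE f))) ∷ [])))
    v0)
  where
  K r f : Exp 1
  K = fstE (sndE v0)
  r = sndE (sndE v0)
  f = fstE (predE K)

mstep : ℕ → ℕ
mstep z = fn machineStep (z ∷ [])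

opaque
  unfolding evalC retC push

  mstep-eval : ∀ K s e x → mstep (evalC K s e x) ≡ fn evalStep (K ∷ s ∷ e ∷ x ∷ [])
  mstep-eval K s e x
    rewrite unpair-⟨⟩ 0 ⟨ K , ⟨ s , ⟨ e , x ⟩ ⟩ ⟩
          | unpair-⟨⟩ K ⟨ s , ⟨ e , x ⟩ ⟩
          | unpair-⟨⟩ s ⟨ e , x ⟩
          | unpair-⟨⟩ e x = refl

  mstep-ret : ∀ t a b c d K v →
    mstep (retC (push t a b c d K) v) ≡ fn retStep (v ∷ K ∷ t ∷ a ∷ b ∷ c ∷ d ∷ [])
  mstep-ret t a b c d K v
    rewrite unpair-⟨⟩ 1 ⟨ push t a b c d K , v ⟩
          | unpair-⟨⟩ (push t a b c d K) v
          | unpair-⟨⟩ ⟨ t , ⟨ a , ⟨ b , ⟨ c , d ⟩ ⟩ ⟩ ⟩ K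
          | unpair-⟨⟩ t ⟨ a , ⟨ b , ⟨ c , d ⟩ ⟩ ⟩
          | unpair-⟨⟩ a ⟨ b , ⟨ c , d ⟩ ⟩
          | unpair-⟨⟩ b ⟨ c , d ⟩
          | unpair-⟨⟩ c d = refl

opaque
  unfolding evalStep retStep evalBranches evalC retC failC push

  es-pick : ∀ K s e x {t} → fst e ≡ t → fn evalStep (K ∷ suc s ∷ e ∷ x ∷ []) ≡
    pick t (fns evalBranches (K ∷ suc s ∷ e ∷ x ∷ []))
  es-pick K s e x = cong (λ t → pick t (fns evalBranches (K ∷ suc s ∷ e ∷ x ∷ [])))

  es-fail : ∀ K e x → fn evalStep (K ∷ 0 ∷ e ∷ x ∷ []) ≡ failC
  es-fail K e x = refl

  es-zero : ∀ K s e x → fst e ≡ 0 → fn evalStep (K ∷ suc s ∷ e ∷ x ∷ []) ≡ retC K 0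
  es-zero K s e x = es-pick K s e x

  es-succ : ∀ K s e x → fst e ≡ 1 → fn evalStep (K ∷ suc s ∷ e ∷ x ∷ []) ≡ retC K (suc x)
  es-succ K s e x = es-pick K s e x

  es-left : ∀ K s e x → fst e ≡ 2 → fn evalStep (K ∷ suc s ∷ e ∷ x ∷ []) ≡ retC K (fst x)
  es-left K s e x = es-pick K s e x

  es-right : ∀ K s e x → fst e ≡ 3 → fn evalStep (K ∷ suc s ∷ e ∷ x ∷ []) ≡ retC K (snd x)
  es-right K s e x = es-pick K s e x

  es-pair : ∀ K s e x → fst e ≡ 4 → fn evalStep (K ∷ suc s ∷ e ∷ x ∷ []) ≡
    evalC (push 0 (suc s) (snd (snd e)) x 0 K) (suc s) (fst (snd e)) x
  es-pair K s e x = es-pick K s e x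

  es-comp : ∀ K s e x → fst e ≡ 5 → fn evalStep (K ∷ suc s ∷ e ∷ x ∷ []) ≡
    evalC (push 2 (suc s) (fst (snd e)) 0 0 K) (suc s) (snd (snd e)) x
  es-comp K s e x = es-pick K s e x

  es-prec-zero : ∀ K s e x a → fst e ≡ 6 → unpair x ≡ (a , 0) →
    fn evalStep (K ∷ suc s ∷ e ∷ x ∷ []) ≡ evalC K (suc s) (fst (snd e)) a
  es-prec-zero K s e x a eq eq′ = trans (es-pick K s e x eq)
    (cong (λ (a , k) → sw k (evalC K (suc s) (fst (snd e)) a)
       (evalC (push 3 (suc s) (snd (snd e)) a (pred k) K) s e ⟨ a , pred k ⟩)) eq′)

  es-prec-suc : ∀ K s e x a n → fst e ≡ 6 → unpair x ≡ (a , suc n) →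
    fn evalStep (K ∷ suc s ∷ e ∷ x ∷ []) ≡
    evalC (push 3 (suc s) (snd (snd e)) a n K) s e ⟨ a , n ⟩
  es-prec-suc K s e x a n eq eq′ = trans (es-pick K s e x eq)
    (cong (λ (a , k) → sw k (evalC K (suc s) (fst (snd e)) a)
       (evalC (push 3 (suc s) (snd (snd e)) a (pred k) K) s e ⟨ a , pred k ⟩)) eq′)

  es-min : ∀ K s e x t → fst e ≡ 7 + t → fn evalStep (K ∷ suc s ∷ e ∷ x ∷ []) ≡
    evalC (push 4 s e x 0 K) (suc s) (fst (snd e)) x
  es-min K s e x t eq = trans (es-pick K s e x eq) (pick-last t _)

  rs-pairL : ∀ v K s g x d → fn retStep (v ∷ K ∷ 0 ∷ s ∷ g ∷ x ∷ d ∷ []) ≡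
    evalC (push 1 v 0 0 0 K) s g x
  rs-pairL v K s g x d = refl

  rs-pairR : ∀ v K y b c d → fn retStep (v ∷ K ∷ 1 ∷ y ∷ b ∷ c ∷ d ∷ []) ≡ retC K ⟨ y , v ⟩
  rs-pairR v K y b c d = refl

  rs-comp : ∀ v K s f c d → fn retStep (v ∷ K ∷ 2 ∷ s ∷ f ∷ c ∷ d ∷ []) ≡ evalC K s f v
  rs-comp v K s f c d = refl

  rs-prec : ∀ v K s g a n → fn retStep (v ∷ K ∷ 3 ∷ s ∷ g ∷ a ∷ n ∷ []) ≡
    evalC K s g ⟨ a , ⟨ n , v ⟩ ⟩
  rs-prec v K s g a n = refl

  rs-min-zero : ∀ K s e x d → fn retStep (0 ∷ K ∷ 4 ∷ s ∷ e ∷ x ∷ d ∷ []) ≡ retC K (snd x)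
  rs-min-zero K s e x d = refl

  rs-min-suc : ∀ v K s e x d → fn retStep (suc v ∷ K ∷ 4 ∷ s ∷ e ∷ x ∷ d ∷ []) ≡
    evalC K s e ⟨ fst x , suc (snd x) ⟩
  rs-min-suc v K s e x d = refl

opaque
  unfolding retC failC

  machine : Exp 1
  machine = machineStep

  machine-eval : ∀ K s e x → fn machine (evalC K s e x ∷ []) ≡ fn evalStep (K ∷ s ∷ e ∷ x ∷ [])
  machine-eval = mstep-eval

  machine-ret : ∀ t a b c d K v → fn machine (retC (push t a b c d K) v ∷ []) ≡
    fn retStep (v ∷ K ∷ t ∷ a ∷ b ∷ c ∷ d ∷ [])
  machine-ret = mstep-ret

  Halted : ℕ → Set
  Halted z = 2 ≤ fst z ⊎ (fst z ≡ 1 × fst (snd z) ≡ 0)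

  haltedF : Form 1
  haltedF = withHolds (lit 2 ≤ᶠ fstE v0 ∨ᶠ fstE v0 ≡ᶠ lit 1 ∧ᶠ fstE (sndE v0) ≡ᶠ lit 0)
    (λ { (z ∷ []) → Halted z }) (λ { (z ∷ []) h → h }) (λ { (z ∷ []) h → h })

  haltedF⁺ : ∀ z → Halted z → Holds haltedF (z ∷ [])
  haltedF⁺ z h = h

  haltedF⁻ : ∀ z → Holds haltedF (z ∷ []) → Halted z
  haltedF⁻ z h = h

  halted-fixed : ∀ z → Halted z → fn machine (z ∷ []) ≡ z
  halted-fixed z (inj₁ 2≤m) with fst z
  halted-fixed z (inj₁ (s≤s (s≤s _))) | suc (suc _) = refl
  halted-fixed z (inj₂ (p , q)) rewrite p | q = refl

  halted-ret : ∀ v → Halted (retC 0 v)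
  halted-ret v = inj₂ (fst-⟨⟩ 1 ⟨ 0 , v ⟩ , trans (cong fst (snd-⟨⟩ 1 ⟨ 0 , v ⟩)) (fst-⟨⟩ 0 v))

  halted-fail : Halted failC
  halted-fail = inj₁ ≤-refl

iter : ℕ → ℕ → ℕ
iter z n = natrec z (λ _ y → fn machine (y ∷ [])) n

iter-+ : ∀ z n m → iter z (m + n) ≡ iter (iter z n) m
iter-+ z n zero    = refl
iter-+ z n (suc m) = cong (λ y → fn machine (y ∷ [])) (iter-+ z n m)

record _↝_ (z w : ℕ) : Set where
  constructor steps
  field
    duration : ℕ
    reaches  : iter z duration ≡ w

open _↝_

infixr 4 _∙_

_∙_ : ∀ {x y z} → x ↝ y → y ↝ z → x ↝ z
_∙_ {x} (steps n p) (steps m q) =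
  steps (m + n) (trans (iter-+ x n m) (trans (cong (λ y → iter y m) p) q))

done : ∀ {x y} → x ≡ y → x ↝ y
done = steps 0

eval↝ : ∀ {K s e x w} → fn evalStep (K ∷ s ∷ e ∷ x ∷ []) ≡ w → evalC K s e x ↝ w
eval↝ {K} {s} {e} {x} eq = steps 1 (trans (machine-eval K s e x) eq)

ret↝ : ∀ {t a b c d K v w} → fn retStep (v ∷ K ∷ t ∷ a ∷ b ∷ c ∷ d ∷ []) ≡ w →
  retC (push t a b c d K) v ↝ w
ret↝ {t} {a} {b} {c} {d} {K} {v} eq = steps 1 (trans (machine-ret t a b c d K v) eq)

resultC : ℕ → Maybe ℕ → ℕ
resultC K (just v) = retC K v
resultC K nothing  = failC

Shape : ℕ → Code → Set
Shape e zeroᶜ       = fst e ≡ 0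
Shape e succᶜ       = fst e ≡ 1
Shape e leftᶜ       = fst e ≡ 2
Shape e rightᶜ      = fst e ≡ 3
Shape e (pairᶜ f g) = fst e ≡ 4 × decode (fst (snd e)) ≡ f × decode (snd (snd e)) ≡ g
Shape e (compᶜ f g) = fst e ≡ 5 × decode (fst (snd e)) ≡ f × decode (snd (snd e)) ≡ g
Shape e (precᶜ f g) = fst e ≡ 6 × decode (fst (snd e)) ≡ f × decode (snd (snd e)) ≡ g
Shape e (minᶜ f)    = (∃[ t ] fst e ≡ 7 + t) × decode (fst (snd e)) ≡ f

shape : ∀ e {c} → decode e ≡ c → Shape e c
shape e refl = subst (Shape e) (sym (decode-unpair e)) (go (fst e) refl)
  where
  go : ∀ t → fst e ≡ t → Shape e (node t (decode (fst (snd e))) (decode (snd (snd e))))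
  go 0 eq = eq
  go 1 eq = eq
  go 2 eq = eq
  go 3 eq = eq
  go 4 eq = eq , refl , refl
  go 5 eq = eq , refl , refl
  go 6 eq = eq , refl , refl
  go (suc (suc (suc (suc (suc (suc (suc t))))))) eq = (t , eq) , refl

-- The recursion is that of `run`: the code shrinks under an unchanged bound, and the bound drops
-- exactly when a recursion or a search unfolds. `simulate′` is the part with a positive bound.
simulate : ∀ s c e → decode e ≡ c → ∀ x K → evalC K s e x ↝ resultC K (run s c x)
simulate′ : ∀ s c e → decode e ≡ c → ∀ x K → evalC K (suc s) e x ↝ resultC K (run (suc s) c x)

simulate zero    c e eq x K = eval↝ (es-fail K e x)
simulate (suc s) c e eq x K = simulate′ s c e eq x K

simulate′ s zeroᶜ  e eq x K = eval↝ (es-zero K s e x (shape e eq))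
simulate′ s succᶜ  e eq x K = eval↝ (es-succ K s e x (shape e eq))
simulate′ s leftᶜ  e eq x K = eval↝ (es-left K s e x (shape e eq))
simulate′ s rightᶜ e eq x K = eval↝ (es-right K s e x (shape e eq))
simulate′ s (pairᶜ f g) e eq x K =
  let t , p , q = shape e eq in
  eval↝ (es-pair K s e x t) ∙ left q (run (suc s) f x) (simulate′ s f (fst (snd e)) p x _)
  where
  right : ∀ {z v} m → z ↝ resultC (push 1 v 0 0 0 K) m → z ↝ resultC K (m >>= λ w → just ⟨ v , w ⟩)
  right nothing  r = r
  right (just w) r = r ∙ ret↝ (rs-pairR w K _ 0 0 0)
  left : decode (snd (snd e)) ≡ g → ∀ {z} m → z ↝ resultC (push 0 (suc s) (snd (snd e)) x 0 K) m →
    z ↝ resultC K (m >>= λ v → run (suc s) g x >>= λ w → just ⟨ v , w ⟩)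
  left q nothing  r = r
  left q (just v) r = r ∙ ret↝ (rs-pairL v K (suc s) (snd (snd e)) x 0) ∙
    right (run (suc s) g x) (simulate′ s g (snd (snd e)) q x _)
simulate′ s (compᶜ f g) e eq x K =
  let t , p , q = shape e eq in
  eval↝ (es-comp K s e x t) ∙ inner p (run (suc s) g x) (simulate′ s g (snd (snd e)) q x _)
  where
  inner : decode (fst (snd e)) ≡ f → ∀ {z} m → z ↝ resultC (push 2 (suc s) (fst (snd e)) 0 0 K) m →
    z ↝ resultC K (m >>= run (suc s) f)
  inner p nothing  r = r
  inner p (just v) r = r ∙ ret↝ (rs-comp v K (suc s) (fst (snd e)) 0 0) ∙ simulate′ s f (fst (snd e)) p v K
simulate′ s (precᶜ f g) e eq x K = let t , p , q = shape e eq in at t p q (unpair x) refl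
  where
  step : decode (snd (snd e)) ≡ g → ∀ {z a n} m → z ↝ resultC (push 3 (suc s) (snd (snd e)) a n K) m →
    z ↝ resultC K (m >>= λ y → run (suc s) g ⟨ a , ⟨ n , y ⟩ ⟩)
  step q nothing  r = r
  step q {a = a} {n} (just v) r = r ∙ ret↝ (rs-prec v K (suc s) (snd (snd e)) a n) ∙
    simulate′ s g (snd (snd e)) q ⟨ a , ⟨ n , v ⟩ ⟩ K
  at : fst e ≡ 6 → decode (fst (snd e)) ≡ f → decode (snd (snd e)) ≡ g → ∀ u → unpair x ≡ u →
    evalC K (suc s) e x ↝ resultC K (precStep (run (suc s) f) (run (suc s) g) (run s (precᶜ f g)) u)
  at t p q (a , zero)  eq′ = eval↝ (es-prec-zero K s e x a t eq′) ∙ simulate′ s f (fst (snd e)) p a K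
  at t p q (a , suc n) eq′ = eval↝ (es-prec-suc K s e x a n t eq′) ∙
    step q (run s (precᶜ f g) ⟨ a , n ⟩) (simulate s (precᶜ f g) e eq ⟨ a , n ⟩ _)
simulate′ s (minᶜ f) e eq x K =
  let (t , p) , q = shape e eq in
  eval↝ (es-min K s e x t p) ∙ test (run (suc s) f x) (simulate′ s f (fst (snd e)) q x _)
  where
  test : ∀ {z} m → z ↝ resultC (push 4 s e x 0 K) m →
    z ↝ resultC K (minStep m (run s (minᶜ f)) (unpair x))
  test nothing        r = r
  test (just zero)    r = r ∙ ret↝ (rs-min-zero K s e x 0)
  test (just (suc v)) r = r ∙ ret↝ (rs-min-suc v K s e x 0) ∙
    simulate s (minᶜ f) e eq ⟨ fst x , suc (snd x) ⟩ K

halted-result : ∀ m → Halted (resultC 0 m)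
halted-result (just v) = halted-ret v
halted-result nothing  = halted-fail

iter-halted : ∀ z n → Halted z → iter z n ≡ z
iter-halted z zero    h = refl
iter-halted z (suc n) h = trans (cong (λ y → fn machine (y ∷ [])) (iter-halted z n h)) (halted-fixed z h)

iter-halted-unique : ∀ z n m → Halted (iter z n) → Halted (iter z m) → iter z n ≡ iter z m
iter-halted-unique z n m h h′ =
  trans (sym (iter-halted (iter z n) m h))
  (trans (sym (iter-+ z n m))
  (trans (cong (iter z) (+-comm m n))
  (trans (iter-+ z m n) (iter-halted (iter z m) n h′))))

maybeCode : Maybe ℕ → ℕ
maybeCode nothing  = 0
maybeCode (just v) = suc v

opaque
  unfolding retC failC evalC

  resultE : Exp 1
  resultE = switch (predE (fstE v0)) (sucE (sndE (sndE v0))) (lit 0)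

  result-maybe : ∀ m → fn resultE (resultC 0 m ∷ []) ≡ maybeCode m
  result-maybe nothing = refl
  result-maybe (just v)
    rewrite unpair-⟨⟩ 1 ⟨ 0 , v ⟩ | unpair-⟨⟩ 0 v = refl

  iterX : ∀ {n} → Exp n → Exp n → Exp n
  iterX z n = recE z (app machine (v1 ∷ [])) n

  fn-iterX : ∀ {n} (z k : Exp n) ρ → fn (iterX z k) ρ ≡ iter (fn z ρ) (fn k ρ)
  fn-iterX z k ρ = refl

  evalCE : ∀ {n} → Exp n → Exp n → Exp n → Exp n
  evalCE s e x = evalX (lit 0) s e x

  fn-evalCE : ∀ {n} (s e x : Exp n) ρ → fn (evalCE s e x) ρ ≡ evalC 0 (fn s ρ) (fn e ρ) (fn x ρ)
  fn-evalCE s e x ρ = refl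

stopsF : Form 4
stopsF = withHolds (appF haltedF (iterX (evalCE v1 v2 v3) v0 ∷ []))
  (λ { (n ∷ s ∷ e ∷ x ∷ []) → Halted (iter (evalC 0 s e x) n) })
  (λ { (n ∷ s ∷ e ∷ x ∷ []) h → subst Halted (eq n s e x) (haltedF⁻ _ h) })
  (λ { (n ∷ s ∷ e ∷ x ∷ []) h → haltedF⁺ _ (subst Halted (sym (eq n s e x)) h) })
  where
  eq : ∀ n s e x → fn (iterX (evalCE v1 v2 v3) v0) (n ∷ s ∷ e ∷ x ∷ []) ≡ iter (evalC 0 s e x) n
  eq n s e x = trans (fn-iterX (evalCE v1 v2 v3) v0 (n ∷ s ∷ e ∷ x ∷ []))
    (cong (λ z → iter z n) (fn-evalCE v1 v2 v3 (n ∷ s ∷ e ∷ x ∷ [])))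

-- Even for a diverging code the machine halts, since `run` under a finite bound always returns
-- something. This makes the search for the halting time total.
stops : ∀ ρ → ∃[ n ] Holds stopsF (n ∷ ρ)
stops (s ∷ e ∷ x ∷ []) with simulate s (decode e) e refl x 0
... | steps n eq = n , subst Halted (sym eq) (halted-result (run s (decode e) x))

stopTime : Exp 3
stopTime = minE stopsF stops

stopTime-halted : ∀ s e x → Halted (iter (evalC 0 s e x) (fn stopTime (s ∷ e ∷ x ∷ [])))
stopTime-halted s e x = min-holds stopsF stops (s ∷ e ∷ x ∷ [])

finalE : Exp 3
finalE = iterX (evalCE v0 v1 v2) stopTime

fn-finalE : ∀ s e x → fn finalE (s ∷ e ∷ x ∷ []) ≡ resultC 0 (run s (decode e) x)
fn-finalE s e x =
  trans (fn-iterX (evalCE v0 v1 v2) stopTime (s ∷ e ∷ x ∷ []))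
  (trans (cong (λ z → iter z k) (fn-evalCE v0 v1 v2 (s ∷ e ∷ x ∷ [])))
  (go (simulate s (decode e) e refl x 0)))
  where
  k : ℕ
  k = fn stopTime (s ∷ e ∷ x ∷ [])
  go : evalC 0 s e x ↝ resultC 0 (run s (decode e) x) →
    iter (evalC 0 s e x) k ≡ resultC 0 (run s (decode e) x)
  go (steps n p) = trans
    (iter-halted-unique (evalC 0 s e x) k n (stopTime-halted s e x)
      (subst Halted (sym p) (halted-result (run s (decode e) x)))) p

runFn : Vec ℕ 3 → ℕ
runFn (s ∷ e ∷ x ∷ []) = maybeCode (run s (decode e) x)

runFn-correct : ∀ ρ → fn (app resultE (finalE ∷ [])) ρ ≡ runFn ρ
runFn-correct (s ∷ e ∷ x ∷ []) =
  trans (cong (λ z → fn resultE (z ∷ [])) (fn-finalE s e x)) (result-maybe (run s (decode e) x))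

opaque
  runE : Exp 3
  runE = withFn (app resultE (finalE ∷ [])) runFn runFn-correct

  fn-runE : ∀ s e x → fn runE (s ∷ e ∷ x ∷ []) ≡ maybeCode (run s (decode e) x)
  fn-runE s e x = refl

is-just-code : ∀ m → 0 < maybeCode m → Is-just m
is-just-code (just v) _ = Maybe.just tt

code-is-just : ∀ {m} → Is-just m → 0 < maybeCode m
code-is-just (Maybe.just tt) = z<s

-- Decidability of the stagewise approximations

opaque
  sealX : ∀ {n} → Exp n → Exp n
  sealX e = e

  fn-sealX : ∀ {n} (e : Exp n) ρ → fn (sealX e) ρ ≡ fn e ρ
  fn-sealX e ρ = refl

-- The meaning stays transparent, while the arithmetic of the characteristic function is hidden from
-- conversion checking.
seal : ∀ {n} → Form n → Form n
seal φ = mkForm (Holds φ) (sealX (χ φ))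
  (λ ρ eq → sound φ ρ (trans (sym (fn-sealX (χ φ) ρ)) eq))
  (λ ρ h → trans (fn-sealX (χ φ) ρ) (complete φ ρ h))

-- variables: index, stage, element
atF : Form 3
atF = seal (withHolds (v2 <ᶠ v1 ∧ᶠ lit 0 <ᶠ app runE (v1 ∷ v0 ∷ v2 ∷ []))
  (λ ρ → (W[ fn v0 ρ ]at fn v1 ρ) (fn v2 ρ))
  (λ { (e ∷ s ∷ x ∷ []) (p , q) → p , is-just-code _ (subst (0 <_) (fn-runE s e x) q) })
  (λ { (e ∷ s ∷ x ∷ []) (p , q) → p , subst (0 <_) (sym (fn-runE s e x)) (code-is-just q) }))

-- variables: index, input, stage
Delayed : ℕ → ℕ → ℕ → Set
Delayed q t s = ∃[ v ] (v < s × run s (decode q) t ≡ just v)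

delayedF : Form 3
delayedF = seal (withHolds (lit 0 <ᶠ r ∧ᶠ r ≤ᶠ v2) (λ ρ → Delayed (fn v0 ρ) (fn v1 ρ) (fn v2 ρ))
    to from)
  where
  r : Exp 3
  r = app runE (v2 ∷ v0 ∷ v1 ∷ [])
  to : ∀ ρ → 0 < fn r ρ × fn r ρ ≤ fn v2 ρ → Delayed (fn v0 ρ) (fn v1 ρ) (fn v2 ρ)
  to (q ∷ t ∷ s ∷ []) (p , p′) rewrite fn-runE s q t with run s (decode q) t
  ... | just v = v , p′ , refl
  from : ∀ ρ → Delayed (fn v0 ρ) (fn v1 ρ) (fn v2 ρ) → 0 < fn r ρ × fn r ρ ≤ fn v2 ρ
  from (q ∷ t ∷ s ∷ []) (v , v<s , eq) rewrite fn-runE s q t | eq = z<s , v<s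

opaque
  at? : ∀ e s x → Dec ((W[ e ]at s) x)
  at? e s x = holds? atF (e ∷ s ∷ x ∷ [])

-- The construction

-- wait: not yet in C; rest r: r rounds completed; climb r ℓ t: in round r, the
-- gates at levels ≥ ℓ being passed, and in this state since stage t.
data St : Set where
  wait  : St
  rest  : ℕ → St
  climb : ℕ → ℕ → ℕ → St
  inA   : St
  inY   : St

nth : ℕ → ℕ → ℕ
nth e r = fst (natrec e (λ _ → snd) r)

-- The gate n serves the condition on W (snd n) as a superset of the complement
-- of C if fst n = 0, the delay function with index snd n if fst n = 1, and
-- otherwise the sequence Bix n with the splitting of C into W (Six n), W (Rix n).
Bix Six Rix : ℕ → ℕ
Bix n = fst (snd n)
Six n = fst (snd (snd n))
Rix n = snd (snd (snd n))

module Notions (N : ℕ) (len : ℕ → ℕ) (bit : ℕ → ℕ → ℕ) (st : ℕ → ℕ → St) where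

  -- bit x i is 1 if the node of x guesses that gate i blocks no element forever,
  -- and 0 otherwise. Stage t cuts x at d if its node is to the left of that of x.
  CutAt : ℕ → ℕ → ℕ → Set
  CutAt x t d = x < t × d < len x × d < len t × (∀ i → i < d → bit t i ≡ bit x i) ×
    bit t d ≡ 1 × bit x d ≡ 0

  Uncut : ℕ → ℕ → ℕ → Set
  Uncut x n s = ∀ t → t < s → ∀ d → d < suc n → ¬ CutAt x t d

  Cancelled : ℕ → ℕ → Set
  Cancelled x s = ∃[ t ] (t < s × ∃[ d ] (d < len x × CutAt x t d))

  -- The sets Dᵣ may depend on the sequence B but not on the splitting: of all gates
  -- for B with x ∈ S only the one of highest priority puts x into Dᵣ.
  Asks : ℕ → ℕ → ℕ → Set
  Asks x n s = (W[ Six n ]at s) x ×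
    (∀ n′ → n′ < n → bit x n′ ≡ 1 → 2 ≤ fst n′ → Bix n′ ≡ Bix n → ¬ (W[ Six n′ ]at s) x)

  -- Each kind of gate acts in one state. In `wait` and in `rest` the obstruction is the absence
  -- from c.e. sets and so never returns once lifted. In `climb` only the gate faced at the present
  -- level can obstruct, and t is the time of arrival there.
  Obstructed : ℕ → ℕ → ℕ → St → Set
  Obstructed x n s wait = fst n ≡ 0 × ¬ (W[ snd n ]at s) x
  Obstructed x n s (rest r) = 2 ≤ fst n × ¬ ((W[ Six n ]at s) x ⊎ (W[ Rix n ]at s) x)
  Obstructed x n s (climb r ℓ t) = ℓ ≡ suc n ×
    ((fst n ≡ 1 × ¬ Delayed (snd n) t s) ⊎
     (2 ≤ fst n × Asks x n s × ¬ (W[ nth (Bix n) r ]at s) x))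
  Obstructed x n s inA = ⊥
  Obstructed x n s inY = ⊥

  Blocked : ℕ → ℕ → ℕ → Set
  Blocked x n s = n < len x × bit x n ≡ 1 × Uncut x n s × Obstructed x n s (st x s)

  Open : ℕ → ℕ → Set
  Open x s = ∀ n → n < len x → ¬ Blocked x n s

  Trigger : ℕ → ℕ → Set
  Trigger x s = (X[ N , len x ]at s) x ⊎ Cancelled x s

  -- b n is the guess of the node considered about gate n.
  Extends : (ℕ → ℕ) → ℕ → ℕ → Set
  Extends b t n = n < len t × (∀ i → i < n → bit t i ≡ b i) × bit t n ≡ 1

  -- The guess 1 is repeated only when the gate releases all elements up to every earlier stage that
  -- made this guess. Infinitely many such guesses thus show that no element is blocked forever.
  -- Elements of all nodes are tested, so the truth about a gate is independent of the node.
  Expansionary : (ℕ → ℕ) → ℕ → ℕ → Set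
  Expansionary b n s = ∀ t → t < s → Extends b t n → ∀ x → x < suc t → ¬ Blocked x n s

  Follower : (ℕ → ℕ) → ℕ → ℕ → ℕ → Set
  Follower b y n s = len y ≡ n × (∀ i → i < n → bit y i ≡ b i) × ¬ Cancelled y s

  -- Being a relation, it separates the verification from the program that computes the next state.
  -- A cancelled element in `wait` has to stay there: this makes its absence from C a c.e. event.
  data Step (k : ℕ) (final : St) (x s : ℕ) : St → St → Set where
    stay-wait  : (Cancelled x s ⊎ ¬ Open x s) → Step k final x s wait wait
    go-wait    : ¬ Cancelled x s → Open x s → Step k final x s wait (rest 0)
    stay-rest  : ∀ {r} → (¬ Trigger x s ⊎ ¬ Open x s) → Step k final x s (rest r) (rest r)
    go-rest    : ∀ {r} → Trigger x s → Open x s → Step k final x s (rest r) (climb r (len x) (suc s))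
    stay-climb : ∀ {r n t} → Blocked x n s → Step k final x s (climb r (suc n) t) (climb r (suc n) t)
    go-climb   : ∀ {r n t} → ¬ Blocked x n s → Step k final x s (climb r (suc n) t) (climb r n (suc s))
    top-A      : ∀ {r t} → Trigger x s → Step k final x s (climb r 0 t) inA
    top-rest   : ∀ {r t} → ¬ Trigger x s → suc r < k → Step k final x s (climb r 0 t) (rest (suc r))
    top-final  : ∀ {r t} → ¬ Trigger x s → k ≤ suc r → Step k final x s (climb r 0 t) final
    stay-A     : Step k final x s inA inA
    stay-Y     : Step k final x s inY inY

-- The node of stage s grows by one guess as long as the string reached so far has an uncancelled
-- follower, and s becomes the follower of the first string without one. The length is capped at s,
-- whence the proviso in `node-stop`.
record Construction (N k : ℕ) (final : St) : Set where
  field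
    len : ℕ → ℕ
    bit : ℕ → ℕ → ℕ
    st  : ℕ → ℕ → St
  open Notions N len bit st public
  field
    st-early  : ∀ x s → s ≤ suc x → st x s ≡ wait
    st-step   : ∀ x s → x < s → Step k final x s (st x s) (st x (suc s))
    len≤      : ∀ s → len s ≤ s
    node-live : ∀ s n → n < len s → ∃[ y ] (y < s × Follower (bit s) y n s)
    node-bit  : ∀ s n → n < len s →
      (bit s n ≡ 1 × Expansionary (bit s) n s) ⊎ (bit s n ≡ 0 × ¬ Expansionary (bit s) n s)
    node-stop : ∀ s → len s < s → ∀ y → y < s → ¬ Follower (bit s) y (len s) s

W-mono : ∀ e {s s′ x} → s ≤ s′ → (W[ e ]at s) x → (W[ e ]at s′) x
W-mono e {s} {s′} {x} s≤s′ (x<s , j) = ≤-trans x<s s≤s′ , go j refl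
  where
  go : ∀ {m} → Is-just m → run s (decode e) x ≡ m → Is-just (run s′ (decode e) x)
  go (Maybe.just _) eq rewrite run-mono (decode e) s≤s′ eq = Maybe.just tt

W-cong : ∀ {e e′ s x} → e ≡ e′ → (W[ e ]at s) x → (W[ e′ ]at s) x
W-cong refl w = w

Delayed-mono : ∀ q {t s s′} → s ≤ s′ → Delayed q t s → Delayed q t s′
Delayed-mono q s≤s′ (v , v<s , eq) = v , ≤-trans v<s s≤s′ , run-mono (decode q) s≤s′ eq

-- Settling of states and the true path

module Verification (em : ExcludedMiddle 0ℓ) {N k : ℕ} {final : St} (0<k : 0 < k)
  (final-is : final ≡ inA ⊎ final ≡ inY) (𝓒 : Construction N k final) where

  open Construction 𝓒 public

  decide : (P : Set) → Dec P
  decide P = em {P}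

  by-contra : {P : Set} → ¬ ¬ P → P
  by-contra {P} = decidable-stable (decide P)

  ¬∀⇒∃¬ : {P : ℕ → Set} → ¬ (∀ s → P s) → ∃[ s ] ¬ P s
  ¬∀⇒∃¬ nall = by-contra λ nex → nall λ s → by-contra λ np → nex (s , np)

  C A Y E : ℕ → Set
  C x = ∃[ s ] ¬ st x s ≡ wait
  A x = ∃[ s ] st x s ≡ inA
  Y x = ∃[ s ] st x s ≡ inY
  E x = A x ⊎ Y x

  Reached : ℕ → St → Set
  Reached x z = ∃[ s ] st x s ≡ z

  Eventually : (ℕ → Set) → Set
  Eventually P = ∃[ s₀ ] (∀ s → s₀ ≤ s → P s)

  Eventually-× : ∀ {P R : ℕ → Set} → Eventually P → Eventually R → Eventually (λ s → P s × R s)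
  Eventually-× (s₀ , p) (s₁ , q) = s₀ ⊔ s₁ , λ s le → p s (m⊔n≤o⇒m≤o s₀ s₁ le) , q s (m⊔n≤o⇒n≤o s₀ s₁ le)

  Eventually-∀< : ∀ {P : ℕ → ℕ → Set} n → (∀ i → i < n → Eventually (P i)) →
    Eventually (λ s → ∀ i → i < n → P i s)
  Eventually-∀< zero    h = 0 , λ s _ i ()
  Eventually-∀< {P} (suc n) h with Eventually-∀< n (λ i i<n → h i (m<n⇒m<1+n i<n)) | h n ≤-refl
  ... | s₀ , p | s₁ , q = s₀ ⊔ s₁ , r
    where
    r : ∀ s → s₀ ⊔ s₁ ≤ s → ∀ i → i < suc n → P i s
    r s le i i<n with m≤n⇒m<n∨m≡n (s≤s⁻¹ i<n)
    ... | inj₁ i<n′ = p s (m⊔n≤o⇒m≤o s₀ s₁ le) i i<n′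
    ... | inj₂ refl = q s (m⊔n≤o⇒n≤o s₀ s₁ le)

  active : ∀ {x s z} → st x s ≡ z → ¬ z ≡ wait → x < s
  active {x} {s} eq nw with x <? s
  ... | yes p = p
  ... | no np = contradiction (trans (sym eq) (st-early x s (m≤n⇒m≤1+n (≮⇒≥ np)))) nw

  step-from : ∀ {x s z} → x < s → st x s ≡ z → ∃[ z′ ] (st x (suc s) ≡ z′ × Step k final x s z z′)
  step-from {x} {s} x<s refl = st x (suc s) , refl , st-step x s x<s

  ≤-induct : (P : ℕ → Set) {s : ℕ} → P s → (∀ s′ → s ≤ s′ → P s′ → P (suc s′)) → ∀ s′ → s ≤ s′ → P s′
  ≤-induct P {s} p q s′ le = go (≤⇒≤′ le)
    where
    go : ∀ {s′} → s ≤′ s′ → P s′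
    go ≤′-refl       = p
    go (≤′-step s≤n) = q _ (≤′⇒≤ s≤n) (go s≤n)

  A-stays : ∀ {x s} → st x s ≡ inA → ∀ s′ → s ≤ s′ → st x s′ ≡ inA
  A-stays {x} {s} eq = ≤-induct (λ s′ → st x s′ ≡ inA) eq λ s′ _ eq′ →
    case step-from (active eq′ (λ ())) eq′ of λ { (_ , e , stay-A) → e }

  Y-stays : ∀ {x s} → st x s ≡ inY → ∀ s′ → s ≤ s′ → st x s′ ≡ inY
  Y-stays {x} {s} eq = ≤-induct (λ s′ → st x s′ ≡ inY) eq λ s′ _ eq′ →
    case step-from (active eq′ (λ ())) eq′ of λ { (_ , e , stay-Y) → e }

  Settled : ℕ → St → Set
  Settled x z = Eventually (λ s → st x s ≡ z)

  first-change : ∀ x z s → st x s ≡ z → ∀ d → ¬ st x (d + s) ≡ z →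
    ∃[ s′ ] (s ≤ s′ × st x s′ ≡ z × ¬ st x (suc s′) ≡ z)
  first-change x z s eq zero    ne = contradiction eq ne
  first-change x z s eq (suc d) ne with decide (st x (d + s) ≡ z)
  ... | yes p = d + s , m≤n+m s d , p , ne
  ... | no np = first-change x z s eq d np

  settles-or-moves : ∀ x z s → st x s ≡ z →
    Settled x z ⊎ ∃[ s′ ] (s ≤ s′ × st x s′ ≡ z × ¬ st x (suc s′) ≡ z)
  settles-or-moves x z s eq with decide (∀ s′ → s ≤ s′ → st x s′ ≡ z)
  ... | yes p = inj₁ (s , p)
  ... | no np with ¬∀⇒∃¬ {λ s′ → s ≤ s′ → st x s′ ≡ z} np
  ...   | s′ , nq = inj₂ (first-change x z s eq (s′ ∸ s)
            (λ eq′ → nq λ le → trans (cong (st x) (sym (m∸n+n≡m le))) eq′))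

  moves : ∀ {x z s} → x < s → st x s ≡ z → ¬ st x (suc s) ≡ z →
    ∃[ z′ ] (st x (suc s) ≡ z′ × Step k final x s z z′ × ¬ z′ ≡ z)
  moves x<s eq ne with step-from x<s eq
  ... | z′ , eq′ , stp = z′ , eq′ , stp , λ e → ne (trans eq′ e)

  -- Within a round the level only falls, and there are at most k rounds; f bounds the number of
  -- rounds still to come.
  settle : ∀ x → ∃[ z ] Settled x z
  settle-rest : ∀ x f r s → k ∸ r ≤ f → st x s ≡ rest r → ∃[ z ] Settled x z
  settle-climb : ∀ x f r ℓ t s → k ∸ r ≤ f → st x s ≡ climb r ℓ t → ∃[ z ] Settled x z
  settle-final : ∀ x s z → st x s ≡ z → z ≡ inA ⊎ z ≡ inY → ∃[ z ] Settled x z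

  settle-final x s z eq (inj₁ refl) = inA , s , A-stays eq
  settle-final x s z eq (inj₂ refl) = inY , s , Y-stays eq

  settle x with settles-or-moves x wait (suc x) (st-early x (suc x) ≤-refl)
  ... | inj₁ p = wait , p
  ... | inj₂ (s , le , eq , ne) with moves le eq ne
  ...   | _ , eq′ , stay-wait _ , ne′ = contradiction refl ne′
  ...   | _ , eq′ , go-wait _ _ , _ = settle-rest x k 0 (suc s) ≤-refl eq′

  settle-rest x f r s kr eq with settles-or-moves x (rest r) s eq
  ... | inj₁ p = rest r , p
  ... | inj₂ (s′ , le , eq₁ , ne) with moves (active eq₁ (λ ())) eq₁ ne
  ...   | _ , eq′ , stay-rest _ , ne′ = contradiction refl ne′
  ...   | _ , eq′ , go-rest _ _ , _ = settle-climb x f r _ _ (suc s′) kr eq′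

  settle-climb x f r ℓ t s kr eq with settles-or-moves x (climb r ℓ t) s eq
  ... | inj₁ p = climb r ℓ t , p
  settle-climb x f r (suc n) t s kr eq | inj₂ (s′ , le , eq₁ , ne) with moves (active eq₁ (λ ())) eq₁ ne
  ... | _ , eq′ , stay-climb _ , ne′ = contradiction refl ne′
  ... | _ , eq′ , go-climb _ , _ = settle-climb x f r n _ (suc s′) kr eq′
  settle-climb x f r zero t s kr eq | inj₂ (s′ , le , eq₁ , ne) with moves (active eq₁ (λ ())) eq₁ ne
  ... | _ , eq′ , top-A _ , _ = settle-final x (suc s′) _ eq′ (inj₁ refl)
  ... | _ , eq′ , top-final _ _ , _ = settle-final x (suc s′) _ eq′ final-is
  settle-climb x zero r zero t s kr eq | inj₂ (s′ , le , eq₁ , ne) | _ , eq′ , top-rest _ r<k , _ =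
    contradiction (≤-trans (m<n⇒0<n∸m (<-trans ≤-refl r<k)) kr) λ ()
  settle-climb x (suc f) r zero t s kr eq | inj₂ (s′ , le , eq₁ , ne) | _ , eq′ , top-rest _ r<k , _ =
    settle-rest x f (suc r) (suc s′)
      (s≤s⁻¹ (≤-trans (∸-monoʳ-< ≤-refl (<⇒≤ r<k)) kr)) eq′

  Free : ℕ → ℕ → Set
  Free x n = Eventually (λ s → ¬ Blocked x n s)

  Cancelled-mono : ∀ {x s s′} → s ≤ s′ → Cancelled x s → Cancelled x s′
  Cancelled-mono le (t , t<s , h) = t , ≤-trans t<s le , h

  Uncut-anti : ∀ {x n s s′} → s ≤ s′ → Uncut x n s′ → Uncut x n s
  Uncut-anti le u t t<s = u t (≤-trans t<s le)

  Uncut-level : ∀ {x m n s} → m ≤ n → Uncut x n s → Uncut x m s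
  Uncut-level m≤n u t t<s d d<m = u t t<s d (≤-trans d<m (s≤s m≤n))

  gate-moves : ∀ {x r n t} → Settled x (climb r (suc n) t) → ∃[ s₀ ] (∀ s → s₀ ≤ s → Blocked x n s)
  gate-moves {n = n} (s₀ , p) = s₀ , λ s le →
    case step-from (active (p s le) (λ ())) (p s le) of λ
      { (_ , _ , stay-climb b) → b
      ; (_ , e , go-climb _) → case trans (sym e) (p (suc s) (m≤n⇒m≤1+n le)) of λ () }

  final≢climb : ∀ {r ℓ t} → ¬ final ≡ climb r ℓ t
  final≢climb eq = [ (λ p → case trans (sym p) eq of λ ()) , (λ p → case trans (sym p) eq of λ ()) ]′ final-is

  not-settled-top : ∀ {x r t} → ¬ Settled x (climb r 0 t)
  not-settled-top {x} (s₀ , p) with step-from (active (p s₀ ≤-refl) (λ ())) (p s₀ ≤-refl)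
  ... | _ , e , top-A _ = case trans (sym e) (p (suc s₀) (n≤1+n s₀)) of λ ()
  ... | _ , e , top-rest _ _ = case trans (sym e) (p (suc s₀) (n≤1+n s₀)) of λ ()
  ... | _ , e , top-final _ _ = final≢climb (trans (sym e) (p (suc s₀) (n≤1+n s₀)))

  wait-anti : ∀ {x n s s′} → s ≤ s′ → Obstructed x n s′ wait → Obstructed x n s wait
  wait-anti {n = n} le (p , q) = p , λ w → q (W-mono (snd n) le w)

  rest-anti : ∀ {x n r s s′} → s ≤ s′ → Obstructed x n s′ (rest r) → Obstructed x n s (rest r)
  rest-anti {n = n} le (p , q) = p , λ w → q ([ inj₁ ∘ W-mono (Six n) le , inj₂ ∘ W-mono (Rix n) le ]′ w)

  Stable : ℕ → ℕ → Set
  Stable x n = Eventually (Blocked x n) ⊎ Free x n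

  anti-stable : ∀ x n z → Settled x z →
    (∀ {s s′} → s ≤ s′ → Obstructed x n s′ z → Obstructed x n s z) → Stable x n
  anti-stable x n z (s₀ , p) anti with decide (∀ s → s₀ ≤ s → Blocked x n s)
  ... | yes b = inj₁ (s₀ , b)
  ... | no nb with ¬∀⇒∃¬ {λ s → s₀ ≤ s → Blocked x n s} nb
  ...   | s₁ , nb₁ = inj₂ (s₀ ⊔ s₁ , λ s le (b₁ , b₂ , b₃ , b₄) → nb₁ λ le₁ →
            b₁ , b₂ , Uncut-anti (m⊔n≤o⇒n≤o s₀ s₁ le) b₃ ,
            subst (Obstructed x n s₁) (sym (p s₁ le₁))
              (anti (m⊔n≤o⇒n≤o s₀ s₁ le)
                (subst (Obstructed x n s) (p s (m⊔n≤o⇒m≤o s₀ s₁ le)) b₄)))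

  never-obstructed : ∀ x n z → Settled x z → (∀ s → ¬ Obstructed x n s z) → Stable x n
  never-obstructed x n z (s₀ , p) h =
    inj₂ (s₀ , λ s le (_ , _ , _ , b) → h s (subst (Obstructed x n s) (p s le) b))

  -- Once the state has settled, `wait` and `rest` leave only obstructions that cannot return, and
  -- `Uncut` can only be lost. An element settled in `climb` is blocked by the gate it faces and by
  -- no other.
  stable : ∀ x n → Stable x n
  stable x n with settle x
  ... | wait , p = anti-stable x n wait p (λ {s} {s′} → wait-anti {x} {n} {s} {s′})
  ... | rest r , p = anti-stable x n (rest r) p (λ {s} {s′} → rest-anti {x} {n} {r} {s} {s′})
  ... | climb r zero t , p = contradiction p not-settled-top
  ... | climb r (suc m) t , p with m ≟ n
  ...   | yes refl = inj₁ (gate-moves p)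
  ...   | no m≢n = never-obstructed x n _ p (λ { s (refl , _) → m≢n refl })
  stable x n | inA , p = never-obstructed x n inA p (λ s b → b)
  stable x n | inY , p = never-obstructed x n inY p (λ s b → b)

  -- The true path

  -- Truth of a gate refers to all elements and to no node, so `tp` is defined gate by gate, without
  -- recursion along the path.
  H : ℕ → Set
  H n = ∀ x → Free x n

  tp : ℕ → ℕ
  tp n with decide (H n)
  ... | yes _ = 1
  ... | no _  = 0

  tp-yes : ∀ {n} → H n → tp n ≡ 1
  tp-yes {n} h with decide (H n)
  ... | yes _ = refl
  ... | no nh = contradiction h nh

  tp-1 : ∀ {n} → tp n ≡ 1 → H n
  tp-1 {n} eq with decide (H n)
  ... | yes h = h

  tp-0 : ∀ {n} → tp n ≡ 0 → ¬ H n
  tp-0 {n} eq with decide (H n)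
  ... | no nh = nh

  tp-cases : ∀ n → tp n ≡ 1 ⊎ tp n ≡ 0
  tp-cases n with decide (H n)
  ... | yes _ = inj₁ refl
  ... | no _  = inj₂ refl

  bit-cases : ∀ {s n} → n < len s → bit s n ≡ 1 ⊎ bit s n ≡ 0
  bit-cases {s} {n} n< with node-bit s n n<
  ... | inj₁ (p , _) = inj₁ p
  ... | inj₂ (p , _) = inj₂ p

  Follows : ℕ → ℕ → Set
  Follows n t = n ≤ len t × (∀ i → i < n → bit t i ≡ tp i)

  LeftOf : ℕ → ℕ → Set
  LeftOf n t = ∃[ d ] (d < n × d < len t × (∀ i → i < d → bit t i ≡ tp i) × bit t d ≡ 1 × tp d ≡ 0)

  Follows-suc : ∀ {n t} → Follows n t → n < len t → bit t n ≡ tp n → Follows (suc n) t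
  Follows-suc {n} {t} (_ , p) n< eq = n< , q
    where
    q : ∀ i → i < suc n → bit t i ≡ tp i
    q i i<n with m≤n⇒m<n∨m≡n (s≤s⁻¹ i<n)
    ... | inj₁ i<n′ = p i i<n′
    ... | inj₂ refl = eq

  cut-left : ∀ {x t d n} → Follows n x → d < n → CutAt x t d → LeftOf n t
  cut-left {d = d} (_ , f) d<n (_ , _ , d<t , eq , b₁ , b₀) =
    d , d<n , d<t , (λ i i<d → trans (eq i i<d) (f i (<-trans i<d d<n))) , b₁ ,
    trans (sym (f d d<n)) b₀

  Visited Quiet Past : ℕ → Set
  Visited n = ∀ M → ∃[ t ] (M ≤ t × Follows n t)
  Quiet n = Eventually (λ t → ¬ LeftOf n t)
  Past n = Eventually (λ t → Follows n t → n < len t)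

  -- A late stage that ends at length n on the path is a follower that nothing can cancel, as a cut
  -- would come from a stage to the left of the path. From then on `node-stop` forbids ending there
  -- again.
  past : ∀ n → Quiet n → Past n
  past n (s₀ , q) with decide (∃[ x ] (s₀ ≤ x × Follows n x × len x ≡ n))
  ... | no nex = s₀ , λ t le f → ≤∧≢⇒< (proj₁ f) λ eq → nex (t , le , f , sym eq)
  ... | yes (x , s₀≤x , f , eq) = suc (x ⊔ n) , λ t le f′ → ≤∧≢⇒< (proj₁ f′) λ eq′ → bad t le f′ (sym eq′)
    where
    bad : ∀ t → suc (x ⊔ n) ≤ t → Follows n t → ¬ len t ≡ n
    bad t le f′ refl = node-stop t (≤-trans (s≤s (m≤n⊔m x n)) le) x (≤-trans (s≤s (m≤m⊔n x n)) le)
      ( eq , (λ i i<n → trans (proj₂ f i i<n) (sym (proj₂ f′ i i<n)))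
      , λ { (t′ , t′<t , d , d<x , cut) →
            q t′ (≤-trans s₀≤x (<⇒≤ (proj₁ cut))) (cut-left f (subst (d <_) eq d<x) cut) })

  -- If no stage from M on made the guess 1, only elements below M would be tested. They are
  -- finitely many and all become free, so a late visit is expansionary after all.
  path-1 : ∀ n → tp n ≡ 1 → Visited n → Past n → Visited (suc n)
  path-1 n eq vis (p₀ , past) M with decide (∃[ t ] (M ≤ t × Follows (suc n) t))
  ... | yes h = h
  ... | no none with Eventually-∀< M (λ x _ → tp-1 eq x)
  ...   | s₀ , free with vis (M ⊔ (s₀ ⊔ p₀))
  ...     | s , le , f with node-bit s n (past s (≤-trans (≤-trans (m≤n⊔m s₀ p₀) (m≤n⊔m M (s₀ ⊔ p₀))) le) f)
  ...       | inj₁ (b , _) = s , ≤-trans (m≤m⊔n M _) le ,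
                Follows-suc f (past s (≤-trans (≤-trans (m≤n⊔m s₀ p₀) (m≤n⊔m M (s₀ ⊔ p₀))) le) f)
                  (trans b (sym eq))
  ...       | inj₂ (_ , nexp) = contradiction expan nexp
    where
    expan : Expansionary (bit s) n s
    expan t t<s (n<t , eqs , b) x x≤t =
      free s (≤-trans (≤-trans (m≤m⊔n s₀ p₀) (m≤n⊔m M (s₀ ⊔ p₀))) le) x (≤-trans x≤t (≰⇒> λ M≤t →
        none (t , M≤t , Follows-suc (<⇒≤ n<t , λ i i<n → trans (eqs i i<n) (proj₂ f i i<n)) n<t
          (trans b (sym eq)))))

  -- Some x is blocked forever. As soon as one stage t ≥ x has guessed 1, x is among the elements
  -- tested at every later visit and spoils the test.
  path-0 : ∀ n → tp n ≡ 0 → Eventually (λ t → Follows n t → n < len t → bit t n ≡ 0)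
  path-0 n eq with ¬∀⇒∃¬ {λ x → Free x n} (tp-0 eq)
  ... | x , nfree with stable x n
  ...   | inj₂ fr = contradiction fr nfree
  ...   | inj₁ (s₀ , bl) with decide (∃[ t ] (x ≤ t × Follows n t × n < len t × bit t n ≡ 1))
  ...     | no none = x , λ t le f n<t → case bit-cases n<t of λ
                { (inj₁ b) → contradiction (t , le , f , n<t , b) none ; (inj₂ b) → b }
  ...     | yes (t , x≤t , f , n<t , b) = suc t ⊔ s₀ , λ s le f′ n<s → case node-bit s n n<s of λ
                { (inj₂ (b′ , _)) → b′
                ; (inj₁ (_ , expan)) → contradiction (bl s (m⊔n≤o⇒n≤o (suc t) s₀ le))
                    (expan t (m⊔n≤o⇒m≤o (suc t) s₀ le)
                      (n<t , (λ i i<n → trans (proj₂ f i i<n) (sym (proj₂ f′ i i<n))) , b) x (s≤s x≤t)) }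

  quiet-suc : ∀ n → Quiet n → (tp n ≡ 0 → Eventually (λ t → Follows n t → n < len t → bit t n ≡ 0)) →
    Quiet (suc n)
  quiet-suc n (s₀ , q) z with tp-cases n
  ... | inj₁ eq = s₀ , λ t le (d , d<n , d<t , eqs , b , e) → case m≤n⇒m<n∨m≡n (s≤s⁻¹ d<n) of λ
        { (inj₁ d<n′) → q t le (d , d<n′ , d<t , eqs , b , e)
        ; (inj₂ refl) → case trans (sym eq) e of λ () }
  ... | inj₂ eq with z eq
  ...   | s₁ , q₁ = s₀ ⊔ s₁ , λ t le (d , d<n , d<t , eqs , b , e) → case m≤n⇒m<n∨m≡n (s≤s⁻¹ d<n) of λ
        { (inj₁ d<n′) → q t (m⊔n≤o⇒m≤o s₀ s₁ le) (d , d<n′ , d<t , eqs , b , e)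
        ; (inj₂ refl) → case trans (sym b) (q₁ t (m⊔n≤o⇒n≤o s₀ s₁ le) (<⇒≤ d<t , eqs) d<t) of λ () }

  true-path : ∀ n → Visited n × Quiet n
  true-path zero = (λ M → M , ≤-refl , z≤n , λ i ()) , 0 , λ { t le (d , () , _) }
  true-path (suc n) with true-path n
  ... | vis , q with past n q
  ...   | p₀ , pst = vis′ , quiet-suc n q (path-0 n)
    where
    vis′ : Visited (suc n)
    vis′ with tp-cases n
    ... | inj₁ eq = path-1 n eq vis (p₀ , pst)
    ... | inj₂ eq with path-0 n eq
    ...   | s₀ , z = λ M → case vis (M ⊔ (p₀ ⊔ s₀)) of λ (t , le , f) →
              let le₁ = ≤-trans (≤-trans (m≤m⊔n p₀ s₀) (m≤n⊔m M (p₀ ⊔ s₀))) le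
                  le₂ = ≤-trans (≤-trans (m≤n⊔m p₀ s₀) (m≤n⊔m M (p₀ ⊔ s₀))) le
              in t , ≤-trans (m≤m⊔n M _) le ,
                 Follows-suc f (pst t le₁ f) (trans (z t le₂ f (pst t le₁ f)) (sym eq))

  RightOf : ℕ → ℕ → Set
  RightOf n t = ∃[ d ] (d < n × d < len t × (∀ i → i < d → bit t i ≡ tp i) × bit t d ≡ 0 × tp d ≡ 1)

  follows-or-right : ∀ n → Eventually (λ t → ¬ LeftOf n t × (Follows n t ⊎ RightOf n t))
  follows-or-right zero = 0 , λ t _ → (λ { (d , () , _) }) , inj₁ (z≤n , λ i ())
  follows-or-right (suc n) with Eventually-× (follows-or-right n)
      (Eventually-× (past n (proj₂ (true-path n))) (proj₂ (true-path (suc n))))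
  ... | s₀ , h = s₀ , λ t le → proj₂ (proj₂ (h t le)) , go t (h t le)
    where
    go : ∀ t → (¬ LeftOf n t × (Follows n t ⊎ RightOf n t)) × (Follows n t → n < len t) × ¬ LeftOf (suc n) t →
      Follows (suc n) t ⊎ RightOf (suc n) t
    go t ((_ , inj₂ (d , d<n , r)) , _) = inj₂ (d , m<n⇒m<1+n d<n , r)
    go t ((_ , inj₁ f) , pst , nl) with bit-cases (pst f) | tp-cases n
    ... | inj₁ b | inj₁ e = inj₁ (Follows-suc f (pst f) (trans b (sym e)))
    ... | inj₁ b | inj₂ e = contradiction (n , ≤-refl , pst f , proj₂ f , b , e) nl
    ... | inj₂ b | inj₁ e = inj₂ (n , ≤-refl , pst f , proj₂ f , b , e)
    ... | inj₂ b | inj₂ e = inj₁ (Follows-suc f (pst f) (trans b (sym e)))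

  -- A visit after the stages to the left have died out goes beyond length n, so by `node-live` that
  -- string has a follower which is uncancelled and will remain so.
  follower : ∀ n → ∃[ x ] (len x ≡ n × Follows n x × (∀ s → ¬ Cancelled x s))
  follower n with true-path n
  ... | vis , (s₀ , q) with past n (s₀ , q)
  ...   | p₀ , pst with vis (s₀ ⊔ p₀)
  ...     | s , le , f with node-live s n (pst s (m⊔n≤o⇒n≤o s₀ p₀ le) f)
  ...       | y , y<s , refl , eqs , nc = y , refl , f′ , never
    where
    f′ : Follows (len y) y
    f′ = ≤-refl , λ i i<n → trans (eqs i i<n) (proj₂ f i i<n)
    never : ∀ s → ¬ Cancelled y s
    never s′ (t , t<s′ , d , d<n , cut) with t <? s
    ... | yes t<s = nc (t , t<s , d , d<n , cut)
    ... | no t≮s = q t (≤-trans (m⊔n≤o⇒m≤o s₀ p₀ le) (≮⇒≥ t≮s)) (cut-left f′ d<n cut)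

-- Histories of elements

module Histories (em : ExcludedMiddle 0ℓ) {N k : ℕ} {final : St} (0<k : 0 < k)
  (final-is : final ≡ inA ⊎ final ≡ inY) (𝓒 : Construction N k final) where

  open Verification em 0<k final-is 𝓒 public

  Passed : ℕ → ℕ → ℕ → ℕ → Set
  Passed x r n s = ∃[ s′ ] ∃[ t ] (s′ < s × st x s′ ≡ climb r (suc n) t ×
    st x t ≡ climb r (suc n) t × ¬ Blocked x n s′)

  -- The history of an x that up to stage s has completed the rounds below r
  -- and passed the gates at levels ≥ ℓ in round r.
  record Hist (x s r ℓ : ℕ) : Set where
    field
      rests  : ∀ r′ → r′ ≤ r → ∃[ s′ ] (s′ ≤ s × st x s′ ≡ rest r′)
      passes : ∀ r′ n → n < len x → r′ < r ⊎ (r′ ≡ r × ℓ ≤ n) → Passed x r′ n s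
      top    : ∀ s′ r′ → s′ ≤ s → st x s′ ≡ rest r′ → r′ ≤ r
      bound  : r < k

  open Hist

  -- The rest before the present ascent ended with all gates open; at that moment every believed
  -- uncut splitting had already placed x on one side.
  Sorted : ℕ → ℕ → ℕ → Set
  Sorted x r s = ∃[ s′ ] (s′ < s × st x s′ ≡ rest r × Open x s′)

  Inv : ℕ → ℕ → St → Set
  Inv x s wait          = ∀ s′ → s′ ≤ s → st x s′ ≡ wait
  Inv x s (rest r)      = Hist x s r (len x)
  Inv x s (climb r ℓ t) = Hist x s r ℓ × ℓ ≤ len x × t ≤ s × st x t ≡ climb r ℓ t × Sorted x r s
  Inv x s inA           = ∃[ r ] Hist x s r 0
  Inv x s inY           = ∃[ r ] Hist x s r 0

  Hist-suc : ∀ {x s r ℓ} → Hist x s r ℓ → (∀ r′ → st x (suc s) ≡ rest r′ → r′ ≤ r) →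
    Hist x (suc s) r ℓ
  Hist-suc {x} {s} {r} h new = record
    { rests = λ r′ le → let s′ , p , q = rests h r′ le in s′ , m≤n⇒m≤1+n p , q
    ; passes = λ r′ n n< c → let s′ , t , p , q = passes h r′ n n< c in s′ , t , m<n⇒m<1+n p , q
    ; top = t
    ; bound = bound h
    }
    where
    t : ∀ s′ r′ → s′ ≤ suc s → st x s′ ≡ rest r′ → r′ ≤ r
    t s′ r′ le eq with m≤n⇒m<n∨m≡n le
    ... | inj₁ lt = top h s′ r′ (s≤s⁻¹ lt) eq
    ... | inj₂ refl = new r′ eq

  not-rest : ∀ {x s z r} → st x s ≡ z → (∀ r′ → ¬ z ≡ rest r′) → ∀ r′ → st x s ≡ rest r′ → r′ ≤ r
  not-rest eq nz r′ eq′ = contradiction (trans (sym eq) eq′) (nz r′)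

  rest-rest : ∀ {x s r} → st x s ≡ rest r → ∀ r′ → st x s ≡ rest r′ → r′ ≤ r
  rest-rest eq r′ eq′ with trans (sym eq) eq′
  ... | refl = ≤-refl

  Sorted-suc : ∀ {x r s} → Sorted x r s → Sorted x r (suc s)
  Sorted-suc (s′ , lt , h) = s′ , m<n⇒m<1+n lt , h

  inv-step : ∀ {x s z z′} → st x s ≡ z → st x (suc s) ≡ z′ → Step k final x s z z′ →
    Inv x s z → Inv x (suc s) z′
  inv-step {x} {s} eq eq′ (stay-wait _) i s′ le with m≤n⇒m<n∨m≡n le
  ... | inj₁ lt = i s′ (s≤s⁻¹ lt)
  ... | inj₂ refl = eq′
  inv-step {x} {s} eq eq′ (go-wait _ _) i = record
    { rests = λ { zero z≤n → suc s , ≤-refl , eq′ }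
    ; passes = λ { r′ n n< (inj₁ ()) ; r′ n n< (inj₂ (_ , le)) → contradiction n< (≤⇒≯ le) }
    ; top = t
    ; bound = 0<k
    }
    where
    t : ∀ s′ r′ → s′ ≤ suc s → st x s′ ≡ rest r′ → r′ ≤ 0
    t s′ r′ le e with m≤n⇒m<n∨m≡n le
    ... | inj₁ lt = case trans (sym (i s′ (s≤s⁻¹ lt))) e of λ ()
    ... | inj₂ refl = rest-rest eq′ r′ e
  inv-step eq eq′ (stay-rest _) i = Hist-suc i (rest-rest eq′)
  inv-step {x} {s} eq eq′ (go-rest _ op) i =
    Hist-suc i (not-rest eq′ (λ _ ())) , ≤-refl , ≤-refl , eq′ , s , ≤-refl , eq , op
  inv-step eq eq′ (stay-climb _) (i , le , t≤s , et , so) =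
    Hist-suc i (not-rest eq′ (λ _ ())) , le , m≤n⇒m≤1+n t≤s , et , Sorted-suc so
  inv-step {x} {s} eq eq′ (go-climb {r} {n} {t} nb) (i , le , t≤s , et , so) =
    record
      { rests = rests h
      ; passes = ps
      ; top = top h
      ; bound = bound h
      } , <⇒≤ le , ≤-refl , eq′ , Sorted-suc so
    where
    h : Hist x (suc s) r (suc n)
    h = Hist-suc i (not-rest eq′ (λ _ ()))
    ps : ∀ r′ m → m < len x → r′ < r ⊎ (r′ ≡ r × n ≤ m) → Passed x r′ m (suc s)
    ps r′ m m< (inj₁ lt) = passes h r′ m m< (inj₁ lt)
    ps r′ m m< (inj₂ (refl , n≤m)) with m≤n⇒m<n∨m≡n n≤m
    ... | inj₁ lt = passes h r′ m m< (inj₂ (refl , lt))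
    ... | inj₂ refl = s , t , ≤-refl , eq , et , nb
  inv-step eq eq′ (top-A {r} _) (i , _) = r , Hist-suc i (not-rest eq′ (λ _ ()))
  inv-step {x} {s} eq eq′ (top-rest {r} _ r<k) (i , _) = record
    { rests = λ r′ le → case m≤n⇒m<n∨m≡n le of λ
        { (inj₁ lt) → let s′ , p , q = rests i r′ (s≤s⁻¹ lt) in s′ , m≤n⇒m≤1+n p , q
        ; (inj₂ refl) → suc s , ≤-refl , eq′ }
    ; passes = λ r′ n n< c → let s′ , t , p , q = passes i r′ n n< (ps r′ n n< c) in s′ , t , m<n⇒m<1+n p , q
    ; top = t
    ; bound = r<k
    }
    where
    ps : ∀ r′ n → n < len x → r′ < suc r ⊎ (r′ ≡ suc r × len x ≤ n) → r′ < r ⊎ (r′ ≡ r × 0 ≤ n)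
    ps r′ n n< (inj₂ (_ , le)) = contradiction n< (≤⇒≯ le)
    ps r′ n n< (inj₁ lt) with m≤n⇒m<n∨m≡n (s≤s⁻¹ lt)
    ... | inj₁ lt′ = inj₁ lt′
    ... | inj₂ e = inj₂ (e , z≤n)
    t : ∀ s′ r′ → s′ ≤ suc s → st x s′ ≡ rest r′ → r′ ≤ suc r
    t s′ r′ le e with m≤n⇒m<n∨m≡n le
    ... | inj₁ lt = m≤n⇒m≤1+n (top i s′ r′ (s≤s⁻¹ lt) e)
    ... | inj₂ refl = rest-rest eq′ r′ e
  inv-step {x} {s} eq eq′ (top-final {r} _ _) (i , _) = go final-is eq′
    where
    go : ∀ {z} → z ≡ inA ⊎ z ≡ inY → st x (suc s) ≡ z → Inv x (suc s) z
    go (inj₁ refl) e = r , Hist-suc i (not-rest e (λ _ ()))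
    go (inj₂ refl) e = r , Hist-suc i (not-rest e (λ _ ()))
  inv-step eq eq′ stay-A (r , i) = r , Hist-suc i (not-rest eq′ (λ _ ()))
  inv-step eq eq′ stay-Y (r , i) = r , Hist-suc i (not-rest eq′ (λ _ ()))

  inv : ∀ x s → Inv x s (st x s)
  inv x s with x <? s
  inv x s | no x≮s = subst (Inv x s) (sym (st-early x s (m≤n⇒m≤1+n (≮⇒≥ x≮s))))
    (λ s′ le → st-early x s′ (m≤n⇒m≤1+n (≤-trans le (≮⇒≥ x≮s))))
  inv x (suc s) | yes _ with x <? s
  ... | yes x<s = inv-step refl refl (st-step x s x<s) (inv x s)
  ... | no x≮s = subst (Inv x (suc s)) (sym (st-early x (suc s) (s≤s (≮⇒≥ x≮s))))
    (λ s′ le → st-early x s′ (≤-trans le (s≤s (≮⇒≥ x≮s))))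

  inv-at : ∀ {x s z} → st x s ≡ z → Inv x s z
  inv-at {x} {s} refl = inv x s

  C-rest : ∀ {x} → C x → Reached x (rest 0)
  C-rest {x} (s , nw) with st x s in eq
  ... | wait = contradiction refl nw
  ... | rest r = let s′ , _ , e = rests (inv-at eq) 0 z≤n in s′ , e
  ... | climb r ℓ t = let s′ , _ , e = rests (proj₁ (inv-at eq)) 0 z≤n in s′ , e
  ... | inA = let s′ , _ , e = rests (proj₂ (inv-at eq)) 0 z≤n in s′ , e
  ... | inY = let s′ , _ , e = rests (proj₂ (inv-at eq)) 0 z≤n in s′ , e

  reached-C : ∀ {x z} → Reached x z → ¬ z ≡ wait → C x
  reached-C (s , eq) nw = s , λ e → nw (trans (sym eq) e)

  E⇒C : ∀ {x} → E x → C x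
  E⇒C (inj₁ (s , eq)) = reached-C (s , eq) λ ()
  E⇒C (inj₂ (s , eq)) = reached-C (s , eq) λ ()

  rest-≤ : ∀ {x r r′} → r′ ≤ r → Reached x (rest r) → Reached x (rest r′)
  rest-≤ le (s , eq) = let s′ , _ , e = rests (inv-at eq) _ le in s′ , e

  rest-bound : ∀ {x r} → Reached x (rest r) → r < k
  rest-bound (s , eq) = bound (inv-at eq)

  settled-wait : ∀ {x} → Settled x wait → ¬ C x
  settled-wait (s₀ , p) (s , nw) = nw (inv-at (p (s₀ ⊔ s) (m≤m⊔n s₀ s)) s (m≤n⊔m s₀ s))

  A-Y-disjoint : ∀ {x} → A x → ¬ Y x
  A-Y-disjoint (s , e) (s′ , e′) =
    case trans (sym (A-stays e (s ⊔ s′) (m≤m⊔n s s′))) (Y-stays e′ (s ⊔ s′) (m≤n⊔m s s′)) of λ ()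

  E-settled : ∀ {x z} → Settled x z → E x → z ≡ inA ⊎ z ≡ inY
  E-settled (s₀ , p) (inj₁ (s , e)) =
    inj₁ (trans (sym (p (s₀ ⊔ s) (m≤m⊔n s₀ s))) (A-stays e (s₀ ⊔ s) (m≤n⊔m s₀ s)))
  E-settled (s₀ , p) (inj₂ (s , e)) =
    inj₂ (trans (sym (p (s₀ ⊔ s) (m≤m⊔n s₀ s))) (Y-stays e (s₀ ⊔ s) (m≤n⊔m s₀ s)))

  E-stays : ∀ {x s} → st x s ≡ inA ⊎ st x s ≡ inY → ∀ s′ r → s ≤ s′ → ¬ st x s′ ≡ rest r
  E-stays (inj₁ e) s′ r le e′ = case trans (sym (A-stays e s′ le)) e′ of λ ()
  E-stays (inj₂ e) s′ r le e′ = case trans (sym (Y-stays e s′ le)) e′ of λ ()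

  -- If x ended in E, it did so in some round r₀. The rest with number r came before that, so `top`
  -- yields r ≤ r₀ and round r was completed.
  passed : ∀ {x r} → Reached x (rest r) → E x ⊎ Reached x (rest (suc r)) →
    ∀ n → n < len x → ∃[ s ] Passed x r n s
  passed {x} {r} _ (inj₂ (s , eq)) n n< = s , passes (inv-at eq) r n n< (inj₁ ≤-refl)
  passed {x} {r} (s₁ , eq₁) (inj₁ e) n n< = go e
    where
    by : ∀ s r₀ → Hist x s r₀ 0 → (st x s ≡ inA ⊎ st x s ≡ inY) → ∃[ s ] Passed x r n s
    by s r₀ h es = s , passes h r n n< (case m≤n⇒m<n∨m≡n r≤r₀ of λ
        { (inj₁ lt) → inj₁ lt ; (inj₂ e) → inj₂ (e , z≤n) })
      where
      r≤r₀ : r ≤ r₀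
      r≤r₀ = top h s₁ r (<⇒≤ (≰⇒> λ s≤s₁ → E-stays es s₁ r s≤s₁ eq₁)) eq₁
    go : E x → ∃[ s ] Passed x r n s
    go (inj₁ (s , eq)) = by s (proj₁ (inv-at eq)) (proj₂ (inv-at eq)) (inj₁ eq)
    go (inj₂ (s , eq)) = by s (proj₁ (inv-at eq)) (proj₂ (inv-at eq)) (inj₂ eq)

  climb-top : ∀ {x r} ℓ {t s} → st x s ≡ climb r ℓ t → (∀ n → n < ℓ → Free x n) →
    ∃[ s′ ] ∃[ t′ ] (s ≤ s′ × st x s′ ≡ climb r 0 t′)
  climb-top zero    {t} {s} eq fr = s , t , ≤-refl , eq
  climb-top {x} {r} (suc n) {t} {s} eq fr with settles-or-moves x _ s eq
  ... | inj₁ p = let s₀ , b = gate-moves p ; s₁ , nb = fr n ≤-refl in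
    contradiction (b (s₀ ⊔ s₁) (m≤m⊔n s₀ s₁)) (nb (s₀ ⊔ s₁) (m≤n⊔m s₀ s₁))
  ... | inj₂ (s′ , le , eq₁ , ne) with moves (active eq₁ (λ ())) eq₁ ne
  ...   | _ , eq′ , stay-climb _ , ne′ = contradiction refl ne′
  ...   | _ , eq′ , go-climb _ , _ =
    let s₂ , t₂ , le₂ , e₂ = climb-top n eq′ (λ m m<n → fr m (m<n⇒m<1+n m<n))
    in s₂ , t₂ , ≤-trans le (≤-trans (n≤1+n s′) le₂) , e₂

  final-E : ∀ {x s} → st x s ≡ final → E x
  final-E {x} {s} eq = [ (λ p → inj₁ (s , trans eq p)) , (λ p → inj₂ (s , trans eq p)) ]′ final-is

  climb-through : ∀ {x r ℓ t s} → st x s ≡ climb r ℓ t → (∀ n → n < ℓ → Free x n) →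
    E x ⊎ Reached x (rest (suc r))
  climb-through {x} {r} {ℓ} eq fr with climb-top ℓ eq fr
  ... | s′ , t′ , _ , eq₁ with step-from (active eq₁ (λ ())) eq₁
  ...   | _ , e , top-A _ = inj₁ (inj₁ (suc s′ , e))
  ...   | _ , e , top-rest _ _ = inj₂ (suc s′ , e)
  ...   | _ , e , top-final _ _ = inj₁ (final-E e)

  -- An invariant of all states from the time at which level ℓ of round r is reached. It orders the
  -- events of a round in time: what is not `After` must have come earlier.
  After : ℕ → ℕ → St → Set
  After r ℓ wait            = ⊥
  After r ℓ (rest r′)       = r < r′
  After r ℓ (climb r′ ℓ′ _) = r < r′ ⊎ (r ≡ r′ × ℓ′ ≤ ℓ)
  After r ℓ inA             = ⊤
  After r ℓ inY             = ⊤

  after-step : ∀ {r ℓ x s z z′} → Step k final x s z z′ → After r ℓ z → After r ℓ z′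
  after-step (stay-rest _) a = a
  after-step (go-rest _ _) a = inj₁ a
  after-step (stay-climb _) a = a
  after-step (go-climb _) (inj₁ lt) = inj₁ lt
  after-step (go-climb _) (inj₂ (e , le)) = inj₂ (e , <⇒≤ le)
  after-step (top-A _) a = tt
  after-step (top-rest _ _) (inj₁ lt) = m<n⇒m<1+n lt
  after-step (top-rest _ _) (inj₂ (refl , _)) = ≤-refl
  after-step {r} {ℓ} (top-final _ _) a =
    [ (λ p → subst (After r ℓ) (sym p) tt) , (λ p → subst (After r ℓ) (sym p) tt) ]′ final-is
  after-step stay-A a = tt
  after-step stay-Y a = tt

  after : ∀ {x r ℓ t s} → st x s ≡ climb r ℓ t → ∀ s′ → s ≤ s′ → After r ℓ (st x s′)
  after {x} {r} {ℓ} {t} {s} eq = ≤-induct (λ s′ → After r ℓ (st x s′))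
    (subst (After r ℓ) (sym eq) (inj₂ (refl , ≤-refl)))
    (λ s′ le a → after-step (st-step x s′ (≤-trans (active eq (λ ())) le)) a)

  Free-all : ∀ {x} → (∀ n → n < len x → Free x n) → Eventually (Open x)
  Free-all {x} h = Eventually-∀< (len x) h

  -- Cancellation is a permanent trigger, so no rest is final once the gates are open, and no gate
  -- holds x. The result is E and not A, because x may have entered Y before it was cancelled.
  cancelled-E : ∀ {x s} → C x → Cancelled x s → (∀ n → n < len x → Free x n) → E x
  cancelled-E {x} {s} c can fr with settle x
  ... | wait , p = contradiction c (settled-wait p)
  ... | inA , (s₀ , p) = inj₁ (s₀ , p s₀ ≤-refl)
  ... | inY , (s₀ , p) = inj₂ (s₀ , p s₀ ≤-refl)
  ... | climb r zero t , p = contradiction p not-settled-top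
  ... | climb r (suc n) t , (s₀ , p) =
    let s₁ , b = gate-moves (s₀ , p) ; s₂ , nb = fr n (proj₁ (proj₂ (inv-at (p s₀ ≤-refl))))
    in contradiction (b (s₁ ⊔ s₂) (m≤m⊔n s₁ s₂)) (nb (s₁ ⊔ s₂) (m≤n⊔m s₁ s₂))
  ... | rest r , (s₀ , p) with Free-all fr
  ...   | s₁ , op = contradiction (p (suc u) (m≤n⇒m≤1+n (≤-trans (m≤m⊔n s₀ _) (m≤m⊔n (s₀ ⊔ s₁) s)))) go
    where
    u : ℕ
    u = s₀ ⊔ s₁ ⊔ s
    eu : st x u ≡ rest r
    eu = p u (≤-trans (m≤m⊔n s₀ _) (m≤m⊔n (s₀ ⊔ s₁) s))
    go : ¬ st x (suc u) ≡ rest r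
    go e with step-from (active eu (λ ())) eu
    ... | _ , e′ , go-rest _ _ = case trans (sym e) e′ of λ ()
    ... | _ , e′ , stay-rest (inj₁ nt) = nt (inj₂ (Cancelled-mono (m≤n⊔m (s₀ ⊔ s₁) s) can))
    ... | _ , e′ , stay-rest (inj₂ no′) = no′ (op u (≤-trans (m≤n⊔m s₀ s₁) (m≤m⊔n (s₀ ⊔ s₁) s)))

  Free-bit-0 : ∀ {x n} → bit x n ≡ 0 → Free x n
  Free-bit-0 eq = 0 , λ { s _ (_ , b , _) → case trans (sym eq) b of λ () }

  Free-follows : ∀ {x n} → Follows n x → ∀ m → m < n → Free x m
  Free-follows {x} (_ , f) m m<n with tp-cases m
  ... | inj₁ e = tp-1 e x
  ... | inj₂ e = Free-bit-0 (trans (f m m<n) e)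

  -- A later stage on the path through d cuts x at d. This disables the gates from d on; those
  -- before d are guessed as on the path and hence free.
  right-cancelled : ∀ {n x} → RightOf n x →
    (∃[ s ] (x < s × Cancelled x s)) × (∀ m → m < len x → Free x m)
  right-cancelled {n} {x} (d , d<n , d<x , eqs , b , e) with proj₁ (true-path (suc d)) (suc x)
  ... | t , x<t , d<t , f = (suc t , m<n⇒m<1+n x<t , t , ≤-refl , d , d<x , cut) , free
    where
    cut : CutAt x t d
    cut = x<t , d<x , d<t , (λ i i<d → trans (f i (m<n⇒m<1+n i<d)) (sym (eqs i i<d))) ,
      trans (f d ≤-refl) e , b
    free : ∀ m → m < len x → Free x m
    free m m<x with m <? d
    ... | yes m<d = Free-follows (<⇒≤ d<x , eqs) m m<d
    ... | no m≮d = suc t , λ s le (_ , _ , u , _) → u t le d (s≤s (≮⇒≥ m≮d)) cut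

  -- Cancelled while waiting, x can never enter C. Thus an element off the path and outside C is
  -- recognised effectively, and T₁ can cover the complement of C without admitting elements of C
  -- that guess wrongly.
  Dead : ℕ → Set
  Dead x = ∃[ s ] (x < s × st x s ≡ wait × Cancelled x s)

  dead-¬C : ∀ {x} → Dead x → ¬ C x
  dead-¬C {x} (s , x<s , eq , can) = settled-wait (s , ≤-induct (λ s′ → st x s′ ≡ wait) eq
    λ s′ le e → case step-from (≤-trans x<s le) e of λ
      { (_ , e′ , stay-wait _) → e′
      ; (_ , _ , go-wait nc _) → contradiction (Cancelled-mono le can) nc })

  off-path : ∀ n → Eventually (λ x → ¬ Follows n x → (C x → E x) × (¬ C x → Dead x))
  off-path n with follows-or-right n
  ... | s₀ , h = s₀ , λ x le nf → case proj₂ (h x le) of λ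
      { (inj₁ f) → contradiction f nf
      ; (inj₂ r) → let (s , x<s , can) , fr = right-cancelled r in
          (λ c → cancelled-E c can fr) ,
          (λ nc → s , x<s , by-contra (λ nw → nc (s , nw)) , can) }

  -- A cut at a level up to n would come from a stage to the left of the path.
  on-path : ∀ n → Eventually (λ x → Follows (suc n) x → ∀ s → Uncut x n s)
  on-path n with proj₂ (true-path (suc n))
  ... | s₀ , q = s₀ , λ x le f s t t<s d d≤n cut →
    q t (≤-trans le (<⇒≤ (proj₁ cut))) (cut-left f d≤n cut)

-- A set given by n c.e. sets changes its mind at most n times.
count : ∀ {n} → Vec ℕ n → ℕ → ℕ → ℕ
count []      s x = 0
count (e ∷ v) s x with at? e s x
... | yes _ = suc (count v s x)
... | no _  = count v s x

count-≤ : ∀ {n} (v : Vec ℕ n) s x → count v s x ≤ n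
count-≤ []      s x = z≤n
count-≤ (e ∷ v) s x with at? e s x
... | yes _ = s≤s (count-≤ v s x)
... | no _  = m≤n⇒m≤1+n (count-≤ v s x)

Differences : ∀ {n} → Vec ℕ n → ℕ → ℕ → Set
Differences v s = differences (Vec.map (W[_]at s) v)

Same : ∀ {n} → Vec ℕ n → ℕ → ℕ → ℕ → Set
Same []      s s′ x = ⊤
Same (e ∷ v) s s′ x = ((W[ e ]at s′) x → (W[ e ]at s) x) × Same v s s′ x

count-mono : ∀ {n} (v : Vec ℕ n) {s s′} x → s ≤ s′ → count v s x ≤ count v s′ x
count-mono []      x le = z≤n
count-mono (e ∷ v) {s} {s′} x le
  with at? e s x | at? e s′ x
... | yes p | yes _ = s≤s (count-mono v x le)
... | yes p | no q = contradiction (W-mono e le p) q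
... | no _  | yes _ = m≤n⇒m≤1+n (count-mono v x le)
... | no _  | no _ = count-mono v x le

same-or-grows : ∀ {n} (v : Vec ℕ n) {s s′} x → s ≤ s′ → Same v s s′ x ⊎ count v s x < count v s′ x
same-or-grows []      x le = inj₁ tt
same-or-grows (e ∷ v) {s} {s′} x le
  with at? e s x | at? e s′ x
... | yes p | no q = contradiction (W-mono e le p) q
... | no _  | yes _ = inj₂ (s≤s (count-mono v x le))
... | yes p | yes _ = [ (λ h → inj₁ ((λ _ → p) , h)) , (λ lt → inj₂ (s≤s lt)) ]′ (same-or-grows v x le)
... | no _  | no q = [ (λ h → inj₁ ((λ w → contradiction w q) , h)) , inj₂ ]′ (same-or-grows v x le)

same-differences : ∀ {n} (v : Vec ℕ n) {s s′} x → s ≤ s′ → Same v s s′ x →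
  (Differences v s x → Differences v s′ x) × (Differences v s′ x → Differences v s x)
same-differences []          x le h = (λ ()) , (λ ())
same-differences (e ∷ [])    x le (h , _) = W-mono e le , h
same-differences (e ∷ f ∷ v) x le (h , h′ , hs) =
  [ (λ (p , q) → inj₁ (W-mono e le p , λ w → q (h′ w))) , inj₂ ∘ proj₁ ih ]′ ,
  [ (λ (p , q) → inj₁ (h p , λ w → q (W-mono f le w))) , inj₂ ∘ proj₂ ih ]′
  where ih = same-differences v x le hs

-- The requirements

module Requirements (em : ExcludedMiddle 0ℓ) {N k : ℕ} {final : St} (0<k : 0 < k)
  (final-is : final ≡ inA ⊎ final ≡ inY) (𝓒 : Construction N k final) where

  open Histories em 0<k final-is 𝓒 public

  -- Major subsets

  -- By `stable`, a gate fails to be true only if some element settles in a state in which the gate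
  -- obstructs it forever.
  true-gate : ∀ n → (∀ x z → Settled x z → Eventually (λ s → Blocked x n s × Obstructed x n s z) → ⊥) →
    tp n ≡ 1
  true-gate n h = tp-yes λ x → [ (λ (s₀ , b) → bad x (s₀ , b)) , id ]′ (stable x n)
    where
    bad : ∀ x → Eventually (Blocked x n) → Free x n
    bad x (s₀ , b) with settle x
    ... | z , s₁ , p = ⊥-elim (h x z (s₁ , p) (s₀ ⊔ s₁ , λ s le →
          let bl = b s (m⊔n≤o⇒m≤o s₀ s₁ le) in
          bl , subst (Obstructed x n s) (p s (m⊔n≤o⇒n≤o s₀ s₁ le)) (proj₂ (proj₂ (proj₂ bl)))))

  entry : ∀ {x} → C x → ∃[ s ] (st x s ≡ wait × ¬ Cancelled x s × Open x s)
  entry {x} c with settles-or-moves x wait (suc x) (st-early x (suc x) ≤-refl)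
  ... | inj₁ p = contradiction c (settled-wait p)
  ... | inj₂ (s , le , eq , ne) with moves le eq ne
  ...   | _ , _ , stay-wait _ , ne′ = contradiction refl ne′
  ...   | _ , _ , go-wait nc op , _ = s , eq , nc , op

  obstructed-wait : ∀ n s₀ x → W (snd n) x → ¬ (∀ s → s₀ ≤ s → Obstructed x n s wait)
  obstructed-wait n s₀ x (s₁ , w) o =
    proj₂ (o (s₀ ⊔ s₁) (m≤m⊔n s₀ s₁)) (W-mono (snd n) (m≤n⊔m s₀ s₁) w)

  -- The gate is true, because an element that waits forever is outside C and so in `W e`. Entry
  -- into C requires all gates to be open, which puts the elements that guess this gate correctly
  -- into `W e`; almost all other elements of C end in E.
  major-gate : ∀ e n → fst n ≡ 0 → snd n ≡ e → (∀ x → ¬ C x → W e x) →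
    Eventually (λ x → ¬ E x → W e x)
  major-gate e n fst-n snd-n co = proj₁ (off-path (suc n)) , λ x le ne → case decide (C x) of λ
      { (no nc) → co x nc
      ; (yes c) → case decide (Follows (suc n) x) of λ
          { (no nf) → contradiction (proj₁ (proj₂ (off-path (suc n)) x le nf) c) ne
          ; (yes f) → enters x f c } }
    where
    on : tp n ≡ 1
    on = true-gate n refute
      where
      refute : ∀ x z → Settled x z → Eventually (λ s → Blocked x n s × Obstructed x n s z) → ⊥
      refute x wait p (s₀ , o) = obstructed-wait n s₀ x (subst (λ i → W i x) (sym snd-n) (co x (settled-wait p))) (λ s le → proj₂ (o s le))
      refute x (rest r) p (s₀ , o) =
        contradiction (subst (2 ≤_) fst-n (proj₁ (proj₂ (o s₀ ≤-refl)))) λ ()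
      refute x (climb r ℓ t) p (s₀ , o) =
        [ (λ h → contradiction (trans (sym fst-n) (proj₁ h)) λ ())
        , (λ h → contradiction (subst (2 ≤_) fst-n (proj₁ h)) λ ()) ]′ (proj₂ (proj₂ (o s₀ ≤-refl)))
      refute x inA p (s₀ , o) = proj₂ (o s₀ ≤-refl)
      refute x inY p (s₀ , o) = proj₂ (o s₀ ≤-refl)
    enters : ∀ x → Follows (suc n) x → C x → W e x
    enters x (n< , f) c = let s , eq , nc , op = entry c in by-contra λ nw → op n n<
      ( n< , trans (f n ≤-refl) on
      , (λ t t<s d d≤n cut → nc (t , t<s , d , ≤-trans d≤n n< , cut))
      , subst (Obstructed x n s) (sym eq) (fst-n , λ w → nw (s , W-cong snd-n w)))

  major : ∀ e → (∀ x → ¬ C x → W e x) → Eventually (λ x → ¬ E x → W e x)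
  major e = major-gate e ⟨ 0 , e ⟩ (fst-⟨⟩ 0 e) (snd-⟨⟩ 0 e)

  -- Non-tardiness

  InX : ℕ → ℕ → ℕ → Set
  InX i s x = (X[ N , i ]at s) x

  follower-free : ∀ {x n} → len x ≡ n → Follows n x → ∀ m → m < len x → Free x m
  follower-free refl f = Free-follows f

  free-enters : ∀ {x} → (∀ s → ¬ Cancelled x s) → (∀ m → m < len x → Free x m) → C x
  free-enters {x} nc free with settles-or-moves x wait (suc x) (st-early x (suc x) ≤-refl)
  ... | inj₂ (s , le , eq , ne) = suc s , ne
  ... | inj₁ (s₀ , p) with Free-all free
  ...   | s₁ , op = suc u , λ e → case step-from (≤-trans (m≤m⊔n (suc x) s₀) (m≤m⊔n (suc x ⊔ s₀) s₁)) eu of λ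
            { (_ , _ , stay-wait (inj₁ can)) → nc u can
            ; (_ , _ , stay-wait (inj₂ nop)) → nop (op u (m≤n⊔m (suc x ⊔ s₀) s₁))
            ; (_ , e′ , go-wait _ _) → case trans (sym e) e′ of λ () }
    where
    u : ℕ
    u = suc x ⊔ s₀ ⊔ s₁
    eu : st x u ≡ wait
    eu = p u (≤-trans (m≤n⊔m (suc x) s₀) (m≤m⊔n (suc x ⊔ s₀) s₁))

  -- If X[ N ] i is always empty, the permanent follower of the node of length i enters C but is
  -- never triggered, and rests there forever.
  infinite : (∀ M → ∃[ i ] (M ≤ i × (∀ s x → ¬ InX i s x))) → ∀ M → ∃[ x ] (M ≤ x × C x × ¬ E x)
  infinite empty M with empty M
  ... | i , M≤i , none with follower i
  ...   | x , refl , f , nc = x , ≤-trans M≤i (len≤ x) , free-enters nc (follower-free refl f) , stays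
    where
    stays-put : ∀ s → st x s ≡ wait ⊎ st x s ≡ rest 0
    stays-put s with x <? s
    stays-put s | no x≮s = inj₁ (st-early x s (m≤n⇒m≤1+n (≮⇒≥ x≮s)))
    stays-put (suc s) | yes _ with x <? s
    ... | no x≮s = inj₁ (st-early x (suc s) (s≤s (≮⇒≥ x≮s)))
    ... | yes x<s with stays-put s
    ...   | inj₁ eq = case step-from x<s eq of λ
            { (_ , e , stay-wait _) → inj₁ e ; (_ , e , go-wait _ _) → inj₂ e }
    ...   | inj₂ eq = case step-from x<s eq of λ
            { (_ , e , stay-rest _) → inj₂ e
            ; (_ , e , go-rest (inj₁ d) _) → contradiction d (none s x)
            ; (_ , e , go-rest (inj₂ can) _) → contradiction can (nc s) }
    stays : ¬ E x
    stays (inj₁ (s , e)) = [ (λ e′ → case trans (sym e) e′ of λ ()) , (λ e′ → case trans (sym e) e′ of λ ()) ]′ (stays-put s)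
    stays (inj₂ (s , e)) = [ (λ e′ → case trans (sym e) e′ of λ ()) , (λ e′ → case trans (sym e) e′ of λ ()) ]′ (stays-put s)

  eventually-differences : ∀ {n} (v : Vec ℕ n) x → differences (Vec.map W v) x →
    Eventually (λ s → Differences v s x)
  eventually-differences (e ∷ [])    x (s₀ , w) = s₀ , λ s le → W-mono e le w
  eventually-differences (e ∷ f ∷ v) x (inj₁ ((s₀ , w) , nw)) =
    s₀ , λ s le → inj₁ (W-mono e le w , λ w′ → nw (s , w′))
  eventually-differences (e ∷ f ∷ v) x (inj₂ h) with eventually-differences v x h
  ... | s₀ , p = s₀ , λ s le → inj₂ (p s le)

  module _ (i : ℕ) where

    private
      c : ℕ → ℕ → ℕ
      c = count (tuple N i)

    enters-grows : ∀ {s s′} x → s ≤ s′ → ¬ InX i s x → InX i s′ x → c s x < c s′ x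
    enters-grows x le nd d with same-or-grows (tuple N i) x le
    ... | inj₂ lt = lt
    ... | inj₁ same = contradiction (proj₂ (same-differences (tuple N i) x le same) d) nd

    leaves-grows : ∀ {s s′} x → s ≤ s′ → InX i s x → ¬ InX i s′ x → c s x < c s′ x
    leaves-grows x le d nd with same-or-grows (tuple N i) x le
    ... | inj₂ lt = lt
    ... | inj₁ same = contradiction (proj₁ (same-differences (tuple N i) x le same) d) nd

    InX-zero : ∀ x → ¬ InX i 0 x
    InX-zero x = go (tuple N i)
      where
      go : ∀ {n} (v : Vec ℕ n) → ¬ Differences v 0 x
      go []          ()
      go (e ∷ [])    (() , _)
      go (e ∷ f ∷ v) (inj₁ ((() , _) , _))
      go (e ∷ f ∷ v) (inj₂ h) = go v h

    Caught : Set
    Caught = ∃[ x ] ∃[ s ] (InX i s x × st x (suc s) ≡ inA)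

    -- Each completed round costs X[ N ] i two changes of mind on the follower
    -- of the i-th requirement.
    caught : (final ≡ inA × N < 2 * k) ⊎ (final ≡ inY × N < suc (2 * k)) →
      X[ N ] i ≐ ∁ A → Caught
    caught few (_ , co⊆) with follower i
    ... | x , len-x , f , nc =
          round k 0 ≤-refl 0 z≤n (InX-zero x) (C-rest enters .proj₁) z≤n (C-rest enters .proj₂)
      where
      free : ∀ m → m < len x → Free x m
      free = follower-free len-x f
      D-of : ∀ {s} → (X[ N , len x ]at s) x → InX i s x
      D-of {s} = subst (λ j → (X[ N , j ]at s) x) len-x
      D-to : ∀ {s} → InX i s x → (X[ N , len x ]at s) x
      D-to {s} = subst (λ j → (X[ N , j ]at s) x) (sym len-x)
      in-X : ¬ A x → Eventually (λ s → InX i s x)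
      in-X na = eventually-differences (tuple N i) x (co⊆ na)
      enters : C x
      enters = free-enters nc free
      stuck-rest : ∀ r → ¬ Settled x (rest r)
      stuck-rest r (s₀ , p) with Eventually-× (Free-all free)
          (in-X λ a → case E-settled (s₀ , p) (inj₁ a) of λ { (inj₁ ()) ; (inj₂ ()) })
      ... | s₁ , h = case step-from (active eu (λ ())) eu of λ
            { (_ , e , go-rest _ _) → case trans (sym e) (p (suc u) (m≤n⇒m≤1+n (m≤m⊔n s₀ s₁))) of λ ()
            ; (_ , _ , stay-rest (inj₁ nt)) → nt (inj₁ (D-to (proj₂ (h u (m≤n⊔m s₀ s₁)))))
            ; (_ , _ , stay-rest (inj₂ nop)) → nop (proj₁ (h u (m≤n⊔m s₀ s₁))) }
        where
        u : ℕ
        u = s₀ ⊔ s₁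
        eu : st x u ≡ rest r
        eu = p u (m≤m⊔n s₀ s₁)
      out-twice : ∀ r {s₀ s₁ s₂} → 2 * r ≤ c s₀ x → c s₀ x < c s₁ x → c s₁ x < c s₂ x → 2 * suc r ≤ c s₂ x
      out-twice r {s₂ = s₂} p q q′ = subst (_≤ c s₂ x) (sym (*-suc 2 r)) (≤-trans (s≤s (≤-trans (s≤s p) q)) q′)
      round : ∀ fuel r → k ∸ r ≤ fuel → ∀ s₀ → 2 * r ≤ c s₀ x → ¬ InX i s₀ x →
        ∀ s₁ → s₀ ≤ s₁ → st x s₁ ≡ rest r → Caught
      round fuel r kr s₀ bnd nd s₁ s₀≤s₁ eq with settles-or-moves x (rest r) s₁ eq
      ... | inj₁ p = contradiction p (stuck-rest r)
      ... | inj₂ (s₂ , le₂ , eq₂ , ne₂) with moves (active eq₂ (λ ())) eq₂ ne₂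
      ...   | _ , _ , stay-rest _ , ne′ = contradiction refl ne′
      ...   | _ , _ , go-rest (inj₂ can) _ , _ = contradiction can (nc s₂)
      ...   | _ , eq₃ , go-rest (inj₁ d₂) _ , _ with climb-top (len x) eq₃ free
      ...     | s₄ , t₄ , le₄ , eq₄ = at-top fuel kr (step-from (active eq₄ (λ ())) eq₄)
        where
        g₁ : c s₀ x < c s₂ x
        g₁ = enters-grows x (≤-trans s₀≤s₁ le₂) nd (D-of d₂)
        at-top : ∀ fuel → k ∸ r ≤ fuel →
          ∃[ z ] (st x (suc s₄) ≡ z × Step k final x s₄ (climb r 0 t₄) z) → Caught
        at-top fuel kr (_ , e , top-A (inj₁ d₄)) = x , s₄ , D-of d₄ , e
        at-top fuel kr (_ , e , top-A (inj₂ can)) = contradiction can (nc s₄)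
        at-top zero kr (_ , e , top-rest nt r<k) =
          contradiction (≤-trans (m<n⇒0<n∸m (<-trans ≤-refl r<k)) kr) λ ()
        at-top (suc fuel) kr (_ , e , top-rest nt r<k) =
          round fuel (suc r) (s≤s⁻¹ (≤-trans (∸-monoʳ-< ≤-refl (<⇒≤ r<k)) kr)) s₄
            (out-twice r bnd g₁ (leaves-grows x (≤-trans (n≤1+n s₂) le₄) (D-of d₂) (λ d → nt (inj₁ (D-to d)))))
            (λ d → nt (inj₁ (D-to d))) (suc s₄) (n≤1+n s₄) e
        at-top fuel kr (_ , e , top-final nt k≤) = at-last few
          where
          nd₄ : ¬ InX i s₄ x
          nd₄ d = nt (inj₁ (D-to d))
          2k≤ : 2 * k ≤ c s₄ x
          2k≤ = ≤-trans (*-monoʳ-≤ 2 k≤)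
            (out-twice r bnd g₁ (leaves-grows x (≤-trans (n≤1+n s₂) le₄) (D-of d₂) nd₄))
          -- With `inA`, the k rounds alone exceed N. With `inY`, x is out of A for good, so X[ N ]
          -- i must take it in once more: 2k + 1 changes in all.
          at-last : (final ≡ inA × N < 2 * k) ⊎ (final ≡ inY × N < suc (2 * k)) → Caught
          at-last (inj₁ (_ , N<)) = contradiction (≤-trans 2k≤ (count-≤ (tuple N i) s₄ x)) (<⇒≱ N<)
          at-last (inj₂ (isY , N<)) with in-X (λ a → A-Y-disjoint a (suc s₄ , trans e isY))
          ... | s₅ , h = contradiction (≤-trans (≤-trans (s≤s 2k≤)
                  (enters-grows x (m≤m⊔n s₄ s₅) nd₄ (h (s₄ ⊔ s₅) (m≤n⊔m s₄ s₅))))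
                  (count-≤ (tuple N i) (s₄ ⊔ s₅) x)) (<⇒≱ N<)

  -- The gates for the properties Q

  module QGate (n : ℕ) (2≤n : 2 ≤ fst n) where

    B : ℕ → ℕ → Set
    B r = W (nth (Bix n) r)

    Asked : ℕ → ℕ → ℕ → ℕ → Set
    Asked r x m s = ∃[ r′ ] ∃[ t ] (r ≤ r′ × st x s ≡ climb r′ (suc m) t × m < len x × bit x m ≡ 1 ×
      Uncut x m s × 2 ≤ fst m × Bix m ≡ Bix n × Asks x m s)

    D : ℕ → ℕ → Set
    D r x = ∃[ s ] ∃[ m ] Asked r x m s

    module _ (split : ∀ x → C x → W (Six n) x ⊎ W (Rix n) x)
             (disjoint : ∀ x → W (Six n) x → ¬ W (Rix n) x)
             (D⇒B : ∀ r → r < k → ∀ x → W (Six n) x → ¬ E x → D r x → B r x)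
             (B⇒D : ∀ r → r < k → ∀ x → W (Six n) x → ¬ E x → B r x → D r x) where

      private
        refute : ∀ x z → Settled x z → Eventually (λ s → Blocked x n s × Obstructed x n s z) → ⊥
        refute x wait p (s₀ , o) =
          contradiction (subst (2 ≤_) (proj₁ (proj₂ (o s₀ ≤-refl))) 2≤n) λ ()
        refute x (rest r) (s₀ , p) (s₁ , o) = [ (λ (s , w) → bad s (inj₁ w)) , (λ (s , w) → bad s (inj₂ w)) ]′
            (split x (reached-C (s₀ , p s₀ ≤-refl) (λ ())))
          where
          bad : ∀ s → (W[ Six n ]at s) x ⊎ (W[ Rix n ]at s) x → ⊥
          bad s w = proj₂ (proj₂ (o (s ⊔ s₁) (m≤n⊔m s s₁)))
            ([ inj₁ ∘ W-mono (Six n) (m≤m⊔n s s₁) , inj₂ ∘ W-mono (Rix n) (m≤m⊔n s s₁) ]′ w)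
        refute x (climb r ℓ t) (s₀ , p) (s₁ , o) = go (proj₂ (o u (m≤n⊔m s₀ s₁)))
          where
          u : ℕ
          u = s₀ ⊔ s₁
          eu : st x u ≡ climb r ℓ t
          eu = p u (m≤m⊔n s₀ s₁)
          r<k : r < k
          r<k = Hist.bound (proj₁ (inv-at eu))
          ¬E : ¬ E x
          ¬E e = [ (λ ()) , (λ ()) ]′ (E-settled (s₀ , p) e)
          go : ¬ Obstructed x n u (climb r ℓ t)
          go (_ , inj₁ (eq , _)) = contradiction (subst (2 ≤_) eq 2≤n) λ { (s≤s ()) }
          -- An element held here is asked for and so lies in Dᵣ. It is in S and outside E, hence in
          -- Bᵣ, and this lifts the obstruction.
          go (refl , inj₂ (_ , asks , nb)) = never (D⇒B r r<k x (u , proj₁ asks) ¬E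
            (u , n , r , t , ≤-refl , eu , proj₁ bl , proj₁ (proj₂ bl) , proj₁ (proj₂ (proj₂ bl)) , 2≤n , refl , asks))
            where
            bl : Blocked x n u
            bl = proj₁ (o u (m≤n⊔m s₀ s₁))
            never : ¬ B r x
            never (s , w) = [ (λ h → contradiction (subst (2 ≤_) (proj₁ h) 2≤n) λ { (s≤s ()) })
                            , (λ h → proj₂ (proj₂ h) (W-mono (nth (Bix n) r) (m≤m⊔n s u) w)) ]′
              (proj₂ (proj₂ (o (s ⊔ u) (≤-trans (m≤n⊔m s₀ s₁) (m≤n⊔m s u)))))
        refute x inA p (s₀ , o) = proj₂ (o s₀ ≤-refl)
        refute x inY p (s₀ , o) = proj₂ (o s₀ ≤-refl)

      on : tp n ≡ 1
      on = true-gate n refute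

      module _ {x : ℕ} (f : Follows (suc n) x) (uncut : ∀ s → Uncut x n s) (Sx : W (Six n) x) where

        n<x : n < len x
        n<x = proj₁ f

        bit-n : bit x n ≡ 1
        bit-n = trans (proj₂ f n ≤-refl) on

        -- Otherwise gate n would have blocked x at the rest from which the ascent began.
        sorted : ∀ {r ℓ t s} → st x s ≡ climb r ℓ t → (W[ Six n ]at s) x
        sorted {s = s} eq = let s′ , s′<s , eq′ , op = proj₂ (proj₂ (proj₂ (proj₂ (inv-at eq)))) in
          W-mono (Six n) (<⇒≤ s′<s) (by-contra λ nS → op n n<x
            (n<x , bit-n , uncut s′ , subst (Obstructed x n s′) (sym eq′)
              (2≤n , [ nS , (λ w → disjoint x Sx (s′ , w)) ]′)))

        -- Induction on priority over the gates for the same B that have x in their S. A gate which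
        -- lets x pass without Bᵣ was silenced by one of higher priority; x passes that gate later
        -- in the same round, so the argument repeats with it.
        granted : ∀ {r} → (∀ m → m < len x → ∃[ s ] Passed x r m s) → B r x
        granted {r} ps = let _ , s , t , _ , eq , _ , nb = ps n n<x in
            <-rec P go n ≤-refl n<x bit-n 2≤n refl s t eq nb (sorted eq)
          where
          P : ℕ → Set
          P m = m ≤ n → m < len x → bit x m ≡ 1 → 2 ≤ fst m → Bix m ≡ Bix n →
            ∀ s t → st x s ≡ climb r (suc m) t → ¬ Blocked x m s → (W[ Six m ]at s) x → B r x
          later : ∀ {m m′ s s′ t t′} → m′ < m → st x s ≡ climb r (suc m) t →
            st x s′ ≡ climb r (suc m′) t′ → s ≤ s′
          later {s = s} {s′} m′<m eq eq′ = ≮⇒≥ λ s′<s →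
            [ <-irrefl refl , (λ h → <⇒≱ (s≤s m′<m) (proj₂ h)) ]′
              (subst (After _ _) eq (after eq′ s (<⇒≤ s′<s)))
          go : ∀ m → (∀ {m′} → m′ < m → P m′) → P m
          go m ih m≤n m<x b 2≤m beq s t eq nb Sm = by-contra λ nB →
            nb (m<x , b , Uncut-level m≤n (uncut s) , subst (Obstructed x m s) (sym eq)
              (refl , inj₂ (2≤m , (Sm , λ m′ m′<m b′ 2≤m′ beq′ Sm′ →
                  let _ , s″ , t″ , _ , eq″ , _ , nb″ = ps m′ (<-trans m′<m m<x) in
                  nB (ih m′<m (≤-trans (<⇒≤ m′<m) m≤n) (<-trans m′<m m<x) b′ 2≤m′ (trans beq′ beq)
                        s″ t″ eq″ nb″ (W-mono (Six m′) (later m′<m eq eq″) Sm′)))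
                , λ w → nB (s , subst (λ e → (W[ nth e r ]at s) x) beq w))))

        -- Outside E, membership in Bᵣ means that some gate m has asked for x. If this was in round
        -- r, then m ≤ n: otherwise gate n, which serves the same B and has x in S, would have
        -- silenced m. So x faces gate m ≤ n and has only correctly guessed gates before it.
        completes : ∀ {r} → r < k → B r x → E x ⊎ Reached x (rest (suc r))
        completes {r} r<k Bx = by-contra λ none → none (goes (B⇒D r r<k x Sx (λ e → none (inj₁ e)) Bx))
          where
          goes : D r x → E x ⊎ Reached x (rest (suc r))
          goes (s , m , r′ , t , r≤r′ , eq , m<x , b , _ , 2≤m , beq , asks) =
            [ (λ r<r′ → let s′ , _ , e = Hist.rests (proj₁ (inv-at eq)) (suc r) r<r′ in inj₂ (s′ , e))
            , (λ { refl → climb-through eq λ i i<m → Free-follows f i (≤-trans i<m (s≤s (≮⇒≥ λ n<m →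
                proj₂ asks n n<m bit-n 2≤n (sym beq) (sorted eq)))) }) ]′ (m≤n⇒m<n∨m≡n r≤r′)

  -- The gates for tardiness

  module DelayGate (n : ℕ) (kind : fst n ≡ 1)
    (total : ∀ t → ∃[ s ] Delayed (snd n) t s) where

    Arrives : ℕ → ℕ → ℕ → Set
    Arrives r x u = st x u ≡ climb r (suc n) u

    private
      refute : ∀ x z → Settled x z → Eventually (λ s → Blocked x n s × Obstructed x n s z) → ⊥
      refute x wait p (s₀ , o) = contradiction (trans (sym kind) (proj₁ (proj₂ (o s₀ ≤-refl)))) λ ()
      refute x (rest r) p (s₀ , o) =
        contradiction (subst (2 ≤_) kind (proj₁ (proj₂ (o s₀ ≤-refl)))) λ { (s≤s ()) }
      refute x (climb r ℓ t) p (s₀ , o) =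
        [ (λ h → proj₂ h (Delayed-mono (snd n) (m≤n⊔m s₀ s₁) d))
        , (λ h → contradiction (subst (2 ≤_) kind (proj₁ h)) λ { (s≤s ()) }) ]′
        (proj₂ (proj₂ (o (s₀ ⊔ s₁) (m≤m⊔n s₀ s₁))))
        where
        s₁ : ℕ
        s₁ = proj₁ (total t)
        d : Delayed (snd n) t s₁
        d = proj₂ (total t)
      refute x inA p (s₀ , o) = proj₂ (o s₀ ≤-refl)
      refute x inY p (s₀ , o) = proj₂ (o s₀ ≤-refl)

    on : tp n ≡ 1
    on = true-gate n refute

    module _ {x : ℕ} (f : Follows (suc n) x) (uncut : ∀ s → Uncut x n s) where

      -- Take the round r in which x settles. Had x arrived at gate n in this round, the remaining
      -- gates, all guessed correctly, would have let it through.
      stays-in : ¬ E x → C x → ∃[ r ] (Reached x (rest r) × (∀ u → ¬ Arrives r x u))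
      stays-in ne c = go (settle x)
        where
        go : ∃[ z ] Settled x z → ∃[ r ] (Reached x (rest r) × (∀ u → ¬ Arrives r x u))
        go (wait , p) = contradiction c (settled-wait p)
        go (inA , (s₀ , p)) = contradiction (inj₁ (s₀ , p s₀ ≤-refl)) ne
        go (inY , (s₀ , p)) = contradiction (inj₂ (s₀ , p s₀ ≤-refl)) ne
        go (rest r , (s₀ , p)) = r , (s₀ , p s₀ ≤-refl) , λ u a →
          <-irrefl refl (subst (After r (suc n)) (p (s₀ ⊔ u) (m≤m⊔n s₀ u)) (after a (s₀ ⊔ u) (m≤n⊔m s₀ u)))
        go (climb r ℓ t , (s₀ , p)) = r ,
            (let s′ , _ , e = Hist.rests (proj₁ (inv-at (p s₀ ≤-refl))) r ≤-refl in s′ , e) ,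
            λ u a → not-arrived (subst (After r (suc n)) (p (s₀ ⊔ u) (m≤m⊔n s₀ u)) (after a (s₀ ⊔ u) (m≤n⊔m s₀ u)))
          where
          not-arrived : ¬ After r (suc n) (climb r ℓ t)
          not-arrived (inj₁ r<r) = <-irrefl refl r<r
          not-arrived (inj₂ (_ , ℓ≤)) =
            [ ne , (λ (s , e) → <-irrefl refl (Hist.top (proj₁ (inv-at (p (s₀ ⊔ s) (m≤m⊔n s₀ s)))) s (suc r) (m≤n⊔m s₀ s) e)) ]′
            (climb-through (p s₀ ≤-refl) (λ i i<ℓ → Free-follows f i (≤-trans i<ℓ ℓ≤)))

      -- On its way into A, x must have passed gate n in round r. It did so only after the
      -- computation of the delay at its arrival u had ended, with a value below the stage of
      -- passing.
      delays : ∀ {r} → A x → Reached x (rest r) →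
        ∃[ u ] ∃[ s ] (Arrives r x u × Delayed (snd n) u s × ¬ st x s ≡ inA)
      delays {r} a re = let _ , s , u , _ , eq , arr , nb = passed re (inj₁ (inj₁ a)) n (proj₁ f) in
        u , s , arr ,
        by-contra (λ nd → nb (proj₁ f , trans (proj₂ f n ≤-refl) on , uncut s ,
          subst (Obstructed x n s) (sym eq) (refl , inj₁ (kind , nd)))) ,
        λ e → case trans (sym e) eq of λ ()

-- Lists, stored with the most recent element first and indexed from the end

look : ℕ → ℕ → ℕ → ℕ
look l s x = fst (natrec l (λ _ → snd) (s ∸ suc x))

natrec-shift : ∀ (f : ℕ → ℕ) z n → natrec z (λ _ → f) (suc n) ≡ natrec (f z) (λ _ → f) n
natrec-shift f z zero    = refl
natrec-shift f z (suc n) = cong f (natrec-shift f z n)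

look-new : ∀ b l n → look ⟨ b , l ⟩ (suc n) n ≡ b
look-new b l n = trans (cong (λ k → fst (natrec ⟨ b , l ⟩ (λ _ → snd) k)) (n∸n≡0 n)) (fst-⟨⟩ b l)

look-old : ∀ b l {n i} → i < n → look ⟨ b , l ⟩ (suc n) i ≡ look l n i
look-old b l {n} {i} i<n =
  trans (cong (λ k → fst (natrec ⟨ b , l ⟩ (λ _ → snd) k)) (∸-suc i<n))
  (cong fst (trans (natrec-shift snd ⟨ b , l ⟩ (n ∸ suc i))
    (cong (λ z → natrec z (λ _ → snd) (n ∸ suc i)) (snd-⟨⟩ b l))))
  where
  ∸-suc : ∀ {n i} → i < n → n ∸ i ≡ suc (n ∸ suc i)
  ∸-suc {suc n} {zero}  _   = refl
  ∸-suc {suc n} {suc i} i<n = ∸-suc (s≤s⁻¹ i<n)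

tab : (ℕ → ℕ) → ℕ → ℕ
tab f s = natrec 0 (λ i l → ⟨ f i , l ⟩) s

look-tab : ∀ f {s x} → x < s → look (tab f s) s x ≡ f x
look-tab f {suc s} {x} x<s with m≤n⇒m<n∨m≡n (s≤s⁻¹ x<s)
... | inj₁ x<s′ = trans (look-old (f s) (tab f s) x<s′) (look-tab f x<s′)
... | inj₂ refl = look-new (f s) (tab f s) s

iterSnd : ∀ {n} → Exp n → Exp n → Exp n
iterSnd l k = recE l (sndE v1) k

lookX : ∀ {n} → Exp n → Exp n → Exp n → Exp n
lookX l s x = fstE (iterSnd l (s ⊖ sucE x))

nthX : ∀ {n} → Exp n → Exp n → Exp n
nthX e r = fstE (iterSnd e r)

opaque
  encSt : St → ℕ
  encSt wait          = ⟨ 0 , 0 ⟩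
  encSt (rest r)      = ⟨ 1 , ⟨ r , 0 ⟩ ⟩
  encSt (climb r ℓ t) = ⟨ 2 , ⟨ r , ⟨ ℓ , t ⟩ ⟩ ⟩
  encSt inA           = ⟨ 3 , 0 ⟩
  encSt inY           = ⟨ 4 , 0 ⟩

  restX : ∀ {n} → Exp n → Exp n
  restX r = pairE (lit 1) (pairE r (lit 0))

  climbX : ∀ {n} → Exp n → Exp n → Exp n → Exp n
  climbX r ℓ t = pairE (lit 2) (pairE r (pairE ℓ t))

  fn-restX : ∀ {n} (r : Exp n) ρ → fn (restX r) ρ ≡ encSt (rest (fn r ρ))
  fn-restX r ρ = refl

  fn-climbX : ∀ {n} (r ℓ t : Exp n) ρ → fn (climbX r ℓ t) ρ ≡ encSt (climb (fn r ρ) (fn ℓ ρ) (fn t ρ))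
  fn-climbX r ℓ t ρ = refl

rd lv tm : ℕ → ℕ
rd w = fst w
lv w = fst (snd w)
tm w = snd (snd w)

decTag : ℕ → ℕ → St
decTag 0 w = wait
decTag 1 w = rest (rd w)
decTag 2 w = climb (rd w) (lv w) (tm w)
decTag 3 w = inA
decTag (suc (suc (suc (suc _)))) w = inY

decSt : ℕ → St
decSt z = decTag (fst z) (snd z)

decSt-⟨⟩ : ∀ t w → decSt ⟨ t , w ⟩ ≡ decTag t w
decSt-⟨⟩ t w = cong₂ decTag (fst-⟨⟩ t w) (snd-⟨⟩ t w)

climb-≡ : ∀ {r r′ ℓ ℓ′ t t′} → r ≡ r′ → ℓ ≡ ℓ′ → t ≡ t′ → climb r ℓ t ≡ climb r′ ℓ′ t′
climb-≡ refl refl refl = refl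

opaque
  unfolding encSt

  decSt-encSt : ∀ z → decSt (encSt z) ≡ z
  decSt-encSt wait        = decSt-⟨⟩ 0 0
  decSt-encSt (rest r)    = trans (decSt-⟨⟩ 1 ⟨ r , 0 ⟩) (cong rest (fst-⟨⟩ r 0))
  decSt-encSt (climb r ℓ t) = trans (decSt-⟨⟩ 2 ⟨ r , ⟨ ℓ , t ⟩ ⟩)
    (climb-≡ (fst-⟨⟩ r ⟨ ℓ , t ⟩)
             (trans (cong fst (snd-⟨⟩ r ⟨ ℓ , t ⟩)) (fst-⟨⟩ ℓ t))
             (trans (cong snd (snd-⟨⟩ r ⟨ ℓ , t ⟩)) (snd-⟨⟩ ℓ t)))
  decSt-encSt inA         = decSt-⟨⟩ 3 0
  decSt-encSt inY         = decSt-⟨⟩ 4 0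

-- The notions at stage s depend only on what was defined before stage s. The
-- lemmas are spread over several modules because each uses the previous ones
-- also with the two versions exchanged.

record Agree (len len′ : ℕ → ℕ) (bit bit′ : ℕ → ℕ → ℕ) (st st′ : ℕ → ℕ → St) (s : ℕ) : Set where
  field
    len-≡ : ∀ {t} → t < s → len t ≡ len′ t
    bit-≡ : ∀ {t} i → t < s → bit t i ≡ bit′ t i
    st-≡  : ∀ {x} → x < s → st x s ≡ st′ x s

Agree-sym : ∀ {len len′ bit bit′ st st′ s} → Agree len len′ bit bit′ st st′ s →
  Agree len′ len bit′ bit st′ st s
Agree-sym a = record
  { len-≡ = λ t< → sym (Agree.len-≡ a t<)
  ; bit-≡ = λ i t< → sym (Agree.bit-≡ a i t<)
  ; st-≡  = λ x< → sym (Agree.st-≡ a x<)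
  }

module LocalCuts {N : ℕ} {len len′ : ℕ → ℕ} {bit bit′ : ℕ → ℕ → ℕ} {st st′ : ℕ → ℕ → St} where

  private
    module P = Notions N len bit st
    module P′ = Notions N len′ bit′ st′

  open Agree

  cut-local : ∀ {s x t d} → Agree len len′ bit bit′ st st′ s → t < s → P.CutAt x t d → P′.CutAt x t d
  cut-local {s} {x} {t} {d} a t<s (x<t , d<x , d<t , eqs , b₁ , b₀) =
    x<t , subst (d <_) (len-≡ a x<s) d<x , subst (d <_) (len-≡ a t<s) d<t ,
    (λ i i<d → trans (sym (bit-≡ a i t<s)) (trans (eqs i i<d) (bit-≡ a i x<s))) ,
    trans (sym (bit-≡ a d t<s)) b₁ , trans (sym (bit-≡ a d x<s)) b₀
    where
    x<s : x < s
    x<s = <-trans x<t t<s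

  cancelled-local : ∀ {s x} → Agree len len′ bit bit′ st st′ s → P.Cancelled x s → P′.Cancelled x s
  cancelled-local a (t , t<s , d , d<x , cut) =
    let cut′ = cut-local a t<s cut in t , t<s , d , proj₁ (proj₂ cut′) , cut′

module LocalBlocking {N : ℕ} {len len′ : ℕ → ℕ} {bit bit′ : ℕ → ℕ → ℕ} {st st′ : ℕ → ℕ → St} where

  private
    module P = Notions N len bit st
    module P′ = Notions N len′ bit′ st′

  open Agree
  open LocalCuts {N} using (cut-local; cancelled-local)

  asks-local : ∀ {s x n} → Agree len len′ bit bit′ st st′ s → x < s → P.Asks x n s → P′.Asks x n s
  asks-local a x<s (w , h) = w , λ n′ n′< b → h n′ n′< (trans (bit-≡ a n′ x<s) b)

  obstructed-local : ∀ {s x n} → Agree len len′ bit bit′ st st′ s → x < s → ∀ z →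
    P.Obstructed x n s z → P′.Obstructed x n s z
  obstructed-local a x<s wait o = o
  obstructed-local a x<s (rest r) o = o
  obstructed-local a x<s (climb r ℓ t) (eq , inj₁ h) = eq , inj₁ h
  obstructed-local {s} {x} {n} a x<s (climb r ℓ t) (eq , inj₂ (p , q , h)) =
    eq , inj₂ (p , asks-local {s} {x} {n} a x<s q , h)

  uncut-local : ∀ {s x n} → Agree len len′ bit bit′ st st′ s → P.Uncut x n s → P′.Uncut x n s
  uncut-local a u t t<s d d≤n cut = u t t<s d d≤n (cut-local (Agree-sym a) t<s cut)

  blocked-local : ∀ {s x n} → Agree len len′ bit bit′ st st′ s → x < s → P.Blocked x n s → P′.Blocked x n s
  blocked-local {s} {x} {n} a x<s (n< , b , u , o) =
    subst (n <_) (len-≡ a x<s) n< , trans (sym (bit-≡ a n x<s)) b , uncut-local {s} {x} {n} a u ,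
    subst (P′.Obstructed x n s) (st-≡ a x<s) (obstructed-local {s} {x} {n} a x<s (st x s) o)

module LocalTriggers {N : ℕ} {len len′ : ℕ → ℕ} {bit bit′ : ℕ → ℕ → ℕ} {st st′ : ℕ → ℕ → St} where

  private
    module P = Notions N len bit st
    module P′ = Notions N len′ bit′ st′

  open Agree
  open LocalCuts {N} using (cancelled-local)
  open LocalBlocking {N} using (blocked-local)

  open-local : ∀ {s x} → Agree len len′ bit bit′ st st′ s → x < s → P.Open x s → P′.Open x s
  open-local {s} {x} a x<s op n n< b =
    op n (subst (n <_) (sym (len-≡ a x<s)) n<) (blocked-local {s = s} {x} {n} (Agree-sym a) x<s b)

  trigger-local : ∀ {s x} → Agree len len′ bit bit′ st st′ s → x < s → P.Trigger x s → P′.Trigger x s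
  trigger-local {s} {x} a x<s (inj₁ d) = inj₁ (subst (λ j → (X[ N , j ]at s) x) (len-≡ a x<s) d)
  trigger-local a x<s (inj₂ c) = inj₂ (cancelled-local a c)

module LocalSteps {N : ℕ} {len len′ : ℕ → ℕ} {bit bit′ : ℕ → ℕ → ℕ} {st st′ : ℕ → ℕ → St} where

  private
    module P = Notions N len bit st
    module P′ = Notions N len′ bit′ st′

  open Agree
  open LocalCuts {N} using (cancelled-local)
  open LocalBlocking {N} using (blocked-local)
  open LocalTriggers {N} using (open-local; trigger-local)

  step-local : ∀ {k final s x z z′} → Agree len len′ bit bit′ st st′ s → x < s →
    P.Step k final x s z z′ → P′.Step k final x s z z′
  step-local a x<s (P.stay-wait (inj₁ c)) = P′.stay-wait (inj₁ (cancelled-local a c))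
  step-local a x<s (P.stay-wait (inj₂ nop)) = P′.stay-wait (inj₂ (nop ∘ open-local (Agree-sym a) x<s))
  step-local a x<s (P.go-wait nc op) = P′.go-wait (nc ∘ cancelled-local (Agree-sym a)) (open-local a x<s op)
  step-local a x<s (P.stay-rest (inj₁ nt)) = P′.stay-rest (inj₁ (nt ∘ trigger-local (Agree-sym a) x<s))
  step-local a x<s (P.stay-rest (inj₂ nop)) = P′.stay-rest (inj₂ (nop ∘ open-local (Agree-sym a) x<s))
  step-local {k} {final} {s} {x} a x<s (P.go-rest {r} tr op) =
    subst (λ l → P′.Step k final x s (rest r) (climb r l (suc s))) (sym (len-≡ a x<s))
      (P′.go-rest (trigger-local a x<s tr) (open-local a x<s op))
  step-local {s = s} {x} a x<s (P.stay-climb {n = n} b) =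
    P′.stay-climb (blocked-local {s = s} {x} {n} a x<s b)
  step-local {s = s} {x} a x<s (P.go-climb {n = n} nb) =
    P′.go-climb (nb ∘ blocked-local {s = s} {x} {n} (Agree-sym a) x<s)
  step-local a x<s (P.top-A tr) = P′.top-A (trigger-local a x<s tr)
  step-local a x<s (P.top-rest nt lt) = P′.top-rest (nt ∘ trigger-local (Agree-sym a) x<s) lt
  step-local a x<s (P.top-final nt le) = P′.top-final (nt ∘ trigger-local (Agree-sym a) x<s) le
  step-local a x<s P.stay-A = P′.stay-A
  step-local a x<s P.stay-Y = P′.stay-Y

module LocalNodes {N : ℕ} {len len′ : ℕ → ℕ} {bit bit′ : ℕ → ℕ → ℕ} {st st′ : ℕ → ℕ → St} where

  private
    module P = Notions N len bit st
    module P′ = Notions N len′ bit′ st′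

  open Agree
  open LocalCuts {N} using (cancelled-local)
  open LocalBlocking {N} using (blocked-local)

  follower-local : ∀ {s b y n} → Agree len len′ bit bit′ st st′ s → y < s →
    P.Follower b y n s → P′.Follower b y n s
  follower-local a y<s (p , q , nc) = trans (sym (len-≡ a y<s)) p ,
    (λ i i<n → trans (sym (bit-≡ a i y<s)) (q i i<n)) , nc ∘ cancelled-local (Agree-sym a)

  expansionary-local : ∀ {s b n} → Agree len len′ bit bit′ st st′ s →
    P.Expansionary b n s → P′.Expansionary b n s
  expansionary-local {s} {b} {n} a h t t<s (p , q , c) x x≤t bl =
    h t t<s ( subst (n <_) (sym (len-≡ a t<s)) p , (λ i i<n → trans (bit-≡ a i t<s) (q i i<n))
            , trans (bit-≡ a n t<s) c) x x≤t
      (blocked-local {s = s} {x} {n} (Agree-sym a) (≤-trans x≤t t<s) bl)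

-- variables: index, stage, element
diffF : ∀ n → Form 3
diffF n = withHolds (go n v0) (λ ρ → (X[ n , fn v0 ρ ]at fn v1 ρ) (fn v2 ρ))
    (λ { ρ@(e ∷ s ∷ x ∷ []) → to n v0 ρ }) (λ { ρ@(e ∷ s ∷ x ∷ []) → from n v0 ρ })
  where
  go : ℕ → Exp 3 → Form 3
  go 0             e = lit 1 ≤ᶠ lit 0
  go 1             e = appF atF (fstE e ∷ v1 ∷ v2 ∷ [])
  go (suc (suc n)) e = (appF atF (fstE e ∷ v1 ∷ v2 ∷ []) ∧ᶠ ¬ᶠ appF atF (fstE (sndE e) ∷ v1 ∷ v2 ∷ []))
    ∨ᶠ go n (sndE (sndE e))
  to : ∀ n e ρ → Holds (go n e) ρ → (X[ n , fn e ρ ]at fn v1 ρ) (fn v2 ρ)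
  to 0             e ρ ()
  to 1             e ρ h = h
  to (suc (suc n)) e ρ (inj₁ h) = inj₁ h
  to (suc (suc n)) e ρ (inj₂ h) = inj₂ (to n (sndE (sndE e)) ρ h)
  from : ∀ n e ρ → (X[ n , fn e ρ ]at fn v1 ρ) (fn v2 ρ) → Holds (go n e) ρ
  from 1             e ρ h = h
  from (suc (suc n)) e ρ (inj₁ h) = inj₁ h
  from (suc (suc n)) e ρ (inj₂ h) = inj₂ (from n (sndE (sndE e)) ρ h)

-- A history G at stage s lists, for every x < s, the node of x paired with the code of its state at
-- s. A node is its length paired with the list of its guesses.
lenN : ℕ → ℕ → ℕ → ℕ
lenN G s x = fst (fst (look G s x))

bitN : ℕ → ℕ → ℕ → ℕ → ℕ
bitN G s x i = look (snd (fst (look G s x))) (fst (fst (look G s x))) i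

stN : ℕ → ℕ → ℕ → ℕ → St
stN G s x _ = decSt (snd (look G s x))

module Snapshot (N G s : ℕ) = Notions N (lenN G s) (bitN G s) (stN G s)

-- Computability of the construction

module Program (N k : ℕ) (final : St) where

  lenX : ∀ {n} → Exp n → Exp n → Exp n → Exp n
  lenX G s x = fstE (fstE (lookX G s x))

  bitX : ∀ {n} → Exp n → Exp n → Exp n → Exp n → Exp n
  bitX G s x i = lookX (sndE (fstE (lookX G s x))) (fstE (fstE (lookX G s x))) i

  stX : ∀ {n} → Exp n → Exp n → Exp n → Exp n
  stX G s x = sndE (lookX G s x)

  open Snapshot N

  -- variables: history, stage, x, t, d
  cutF : Form 5
  cutF = seal (withHolds
    (v2 <ᶠ v3 ∧ᶠ v4 <ᶠ lenX v0 v1 v2 ∧ᶠ v4 <ᶠ lenX v0 v1 v3 ∧ᶠ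
     all< v4 (bitX v1 v2 v4 v0 ≡ᶠ bitX v1 v2 v3 v0) ∧ᶠ
     bitX v0 v1 v3 v4 ≡ᶠ lit 1 ∧ᶠ bitX v0 v1 v2 v4 ≡ᶠ lit 0)
    (λ ρ → CutAt (fn v0 ρ) (fn v1 ρ) (fn v2 ρ) (fn v3 ρ) (fn v4 ρ))
    (λ _ h → h) (λ _ h → h))

  -- variables: history, stage, x, n
  uncutF : Form 4
  uncutF = seal (withHolds
    (all< v1 (all< (sucE v4) (¬ᶠ appF cutF (v2 ∷ v3 ∷ v4 ∷ v1 ∷ v0 ∷ []))))
    (λ ρ → Uncut (fn v0 ρ) (fn v1 ρ) (fn v2 ρ) (fn v3 ρ) (fn v1 ρ))
    (λ _ h → h) (λ _ h → h))

  -- variables: history, stage, x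
  cancelledF : Form 3
  cancelledF = seal (withHolds
    (ex< v1 (ex< (lenX v1 v2 v3) (appF cutF (v2 ∷ v3 ∷ v4 ∷ v1 ∷ v0 ∷ []))))
    (λ ρ → Cancelled (fn v0 ρ) (fn v1 ρ) (fn v2 ρ) (fn v1 ρ))
    (λ _ h → h) (λ _ h → h))

  bixX sixX rixX : ∀ {n} → Exp n → Exp n
  bixX e = fstE (sndE e)
  sixX e = fstE (sndE (sndE e))
  rixX e = sndE (sndE (sndE e))

  asksF : Form 4
  asksF = seal (withHolds
    (appF atF (sixX v3 ∷ v1 ∷ v2 ∷ []) ∧ᶠ
     all< v3 (bitX v1 v2 v3 v0 ≡ᶠ lit 1 ⇒ᶠ lit 2 ≤ᶠ fstE v0 ⇒ᶠ bixX v0 ≡ᶠ bixX v4 ⇒ᶠ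
       ¬ᶠ appF atF (sixX v0 ∷ v2 ∷ v3 ∷ [])))
    (λ ρ → Asks (fn v0 ρ) (fn v1 ρ) (fn v2 ρ) (fn v3 ρ) (fn v1 ρ))
    (λ _ h → h) (λ _ h → h))

  obstructedF : Form 4
  obstructedF = seal (withHolds
    ((T ≡ᶠ lit 0 ∧ᶠ fstE v3 ≡ᶠ lit 0 ∧ᶠ ¬ᶠ appF atF (sndE v3 ∷ v1 ∷ v2 ∷ [])) ∨ᶠ
     (T ≡ᶠ lit 1 ∧ᶠ lit 2 ≤ᶠ fstE v3 ∧ᶠ
       ¬ᶠ (appF atF (sixX v3 ∷ v1 ∷ v2 ∷ []) ∨ᶠ appF atF (rixX v3 ∷ v1 ∷ v2 ∷ []))) ∨ᶠ
     (T ≡ᶠ lit 2 ∧ᶠ fstE (sndE w) ≡ᶠ sucE v3 ∧ᶠ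
       ((fstE v3 ≡ᶠ lit 1 ∧ᶠ ¬ᶠ appF delayedF (sndE v3 ∷ sndE (sndE w) ∷ v1 ∷ [])) ∨ᶠ
        (lit 2 ≤ᶠ fstE v3 ∧ᶠ asksF ∧ᶠ ¬ᶠ appF atF (nthX (bixX v3) (fstE w) ∷ v1 ∷ v2 ∷ [])))))
    (λ ρ → Obstructed (fn v0 ρ) (fn v1 ρ) (fn v2 ρ) (fn v3 ρ) (fn v1 ρ) (stN (fn v0 ρ) (fn v1 ρ) (fn v2 ρ) (fn v1 ρ)))
    (λ { (G ∷ s ∷ x ∷ n ∷ []) → to G s x n (fst (snd (look G s x))) (snd (snd (look G s x))) })
    (λ { (G ∷ s ∷ x ∷ n ∷ []) → from G s x n (fst (snd (look G s x))) (snd (snd (look G s x))) }))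
    where
    z T w : Exp 4
    z = stX v0 v1 v2
    T = fstE z
    w = sndE z
    Cases : ℕ → ℕ → ℕ → ℕ → ℕ → ℕ → Set
    Cases G s x n T w =
      (T ≡ 0 × Obstructed G s x n s wait) ⊎ (T ≡ 1 × Obstructed G s x n s (rest (rd w))) ⊎
      (T ≡ 2 × Obstructed G s x n s (climb (rd w) (lv w) (tm w)))
    to : ∀ G s x n T w → Cases G s x n T w → Obstructed G s x n s (decTag T w)
    to G s x n _ w (inj₁ (refl , h))        = h
    to G s x n _ w (inj₂ (inj₁ (refl , h))) = h
    to G s x n _ w (inj₂ (inj₂ (refl , h))) = h
    from : ∀ G s x n T w → Obstructed G s x n s (decTag T w) → Cases G s x n T w
    from G s x n 0 w h = inj₁ (refl , h)
    from G s x n 1 w h = inj₂ (inj₁ (refl , h))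
    from G s x n 2 w h = inj₂ (inj₂ (refl , h))
    from G s x n 3 w ()
    from G s x n (suc (suc (suc (suc _)))) w ()

  blockedF : Form 4
  blockedF = seal (withHolds
    (v3 <ᶠ lenX v0 v1 v2 ∧ᶠ bitX v0 v1 v2 v3 ≡ᶠ lit 1 ∧ᶠ uncutF ∧ᶠ obstructedF)
    (λ ρ → Blocked (fn v0 ρ) (fn v1 ρ) (fn v2 ρ) (fn v3 ρ) (fn v1 ρ))
    (λ _ h → h) (λ _ h → h))

  openF : Form 3
  openF = seal (withHolds
    (all< (lenX v0 v1 v2) (¬ᶠ appF blockedF (v1 ∷ v2 ∷ v3 ∷ v0 ∷ [])))
    (λ ρ → Open (fn v0 ρ) (fn v1 ρ) (fn v2 ρ) (fn v1 ρ))
    (λ _ h → h) (λ _ h → h))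

  triggerF : Form 3
  triggerF = seal (withHolds
    (appF (diffF N) (lenX v0 v1 v2 ∷ v1 ∷ v2 ∷ []) ∨ᶠ cancelledF)
    (λ ρ → Trigger (fn v0 ρ) (fn v1 ρ) (fn v2 ρ) (fn v1 ρ))
    (λ _ h → h) (λ _ h → h))

  zX rX ℓX gateX topX : Exp 3
  zX = stX v0 v1 v2
  rX = fstE (sndE zX)
  ℓX = fstE (sndE (sndE zX))
  gateX = climbX rX (predE ℓX) (sucE v1)
  topX = ifE (sucE rX <ᶠ lit k) (restX (sucE rX)) (lit (encSt final))

  waitX restingX climbingX : Exp 3
  waitX = ifE (¬ᶠ cancelledF ∧ᶠ openF) (restX (lit 0)) zX
  restingX = ifE (triggerF ∧ᶠ openF) (climbX rX (lenX v0 v1 v2) (sucE v1)) zX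
  climbingX = switch ℓX (ifE triggerF (lit (encSt inA)) topX)
    (ifE (appF blockedF (v0 ∷ v1 ∷ v2 ∷ predE ℓX ∷ [])) zX gateX)

  -- variables: history, stage, x
  nextX : Exp 3
  nextX = cases (fstE zX) (waitX ∷ restingX ∷ climbingX ∷ zX ∷ zX ∷ [])

  decide-× : {P R : Set} → Dec P → ¬ (P × R) → ¬ P ⊎ ¬ R
  decide-× (yes p) h = inj₂ λ r → h (p , r)
  decide-× (no np) h = inj₁ np

  module _ (G s x : ℕ) where

    private
      ρ : Vec ℕ 3
      ρ = G ∷ s ∷ x ∷ []
      z : ℕ
      z = snd (look G s x)
      Stp : St → St → Set
      Stp = Step G s k final x s

    Next : St → ℕ → Set
    Next u v = Stp u (decSt v)

    next-same : ∀ {u} T → fst z ≡ T → decTag T (snd z) ≡ u → Stp u u → Next u z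
    next-same {u} T eq eq′ = subst (Stp u) (sym (trans (cong (λ T → decTag T (snd z)) eq) eq′))

    next-new : ∀ {u v} u′ → v ≡ encSt u′ → Stp u u′ → Next u v
    next-new {u} u′ refl = subst (Stp u) (sym (decSt-encSt u′))

    next-wait : fst z ≡ 0 → Next wait (fn waitX ρ)
    next-wait eq = if-elim (¬ᶠ cancelledF ∧ᶠ openF) (restX (lit 0)) zX ρ (Next wait)
      (λ (nc , op) → next-new (rest 0) (fn-restX (lit 0) ρ) (Notions.go-wait nc op))
      (λ nh → next-same 0 eq refl (Notions.stay-wait
        (map-⊎ (decidable-stable (holds? cancelledF ρ)) id (decide-× (holds? (¬ᶠ cancelledF) ρ) nh))))

    next-resting : fst z ≡ 1 → Next (rest (rd (snd z))) (fn restingX ρ)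
    next-resting eq = if-elim (triggerF ∧ᶠ openF) (climbX rX (lenX v0 v1 v2) (sucE v1)) zX ρ
      (Next (rest (rd (snd z))))
      (λ (tr , op) → next-new (climb (rd (snd z)) (lenN G s x) (suc s))
        (fn-climbX rX (lenX v0 v1 v2) (sucE v1) ρ) (Notions.go-rest tr op))
      (λ nh → next-same 1 eq refl (Notions.stay-rest (decide-× (holds? triggerF ρ) nh)))

    next-climbing : fst z ≡ 2 → Next (climb (rd (snd z)) (lv (snd z)) (tm (snd z))) (fn climbingX ρ)
    next-climbing eq = at (lv (snd z)) refl
      where
      at : ∀ l → lv (snd z) ≡ l → Next (climb (rd (snd z)) l (tm (snd z)))
        (sw l (fn (ifE triggerF (lit (encSt inA)) topX) ρ)
              (fn (ifE (appF blockedF (v0 ∷ v1 ∷ v2 ∷ predE ℓX ∷ [])) zX gateX) ρ))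
      at zero eq′ = if-elim triggerF (lit (encSt inA)) topX ρ (Next (climb (rd (snd z)) 0 (tm (snd z))))
        (λ tr → next-new inA refl (Notions.top-A tr))
        (λ nt → if-elim (sucE rX <ᶠ lit k) (restX (sucE rX)) (lit (encSt final)) ρ
          (Next (climb (rd (snd z)) 0 (tm (snd z))))
          (λ lt → next-new (rest (suc (rd (snd z)))) (fn-restX (sucE rX) ρ) (Notions.top-rest nt lt))
          (λ ge → next-new final refl (Notions.top-final nt (≮⇒≥ ge))))
      at (suc n) eq′ = if-elim (appF blockedF (v0 ∷ v1 ∷ v2 ∷ predE ℓX ∷ [])) zX gateX ρ
        (Next (climb (rd (snd z)) (suc n) (tm (snd z))))
        (λ b → next-same 2 eq (cong (λ l → climb (rd (snd z)) l (tm (snd z))) eq′)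
          (Notions.stay-climb (subst (λ m → Blocked G s x m s) (cong pred eq′) b)))
        (λ nb → next-new (climb (rd (snd z)) n (suc s))
          (trans (fn-climbX rX (predE ℓX) (sucE v1) ρ)
                 (cong (λ m → encSt (climb (rd (snd z)) m (suc s))) (cong pred eq′)))
          (Notions.go-climb (λ b → nb (subst (λ m → Blocked G s x m s) (sym (cong pred eq′)) b))))

    next-tag : ∀ T → fst z ≡ T → Next (decTag T (snd z))
      (pick T (fn waitX ρ ∷ fn restingX ρ ∷ fn climbingX ρ ∷ z ∷ z ∷ []))
    next-tag 0 eq = next-wait eq
    next-tag 1 eq = next-resting eq
    next-tag 2 eq = next-climbing eq
    next-tag 3 eq = next-same 3 eq refl Notions.stay-A
    next-tag (suc (suc (suc (suc t)))) eq =
      subst (Next inY) (sym (pick-last t z)) (next-same (suc (suc (suc (suc t)))) eq refl Notions.stay-Y)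

    next-step : Next (stN G s x s) (fn nextX ρ)
    next-step = next-tag (fst z) refl

  -- Nodes; a partial node is coded by its length and the list of its guesses.

  guess : ℕ → ℕ → ℕ
  guess a = look (snd a) (fst a)

  -- variables: history, stage, partial node, y
  followerF : Form 4
  followerF = seal (withHolds
    (lenX v0 v1 v3 ≡ᶠ fstE v2 ∧ᶠ
     all< (fstE v2) (bitX v1 v2 v4 v0 ≡ᶠ lookX (sndE v3) (fstE v3) v0) ∧ᶠ
     ¬ᶠ appF cancelledF (v0 ∷ v1 ∷ v3 ∷ []))
    (λ ρ → Follower (fn v0 ρ) (fn v1 ρ) (guess (fn v2 ρ)) (fn v3 ρ) (fst (fn v2 ρ)) (fn v1 ρ))
    (λ _ h → h) (λ _ h → h))

  liveF : Form 3
  liveF = seal (ex< v1 (appF followerF (v1 ∷ v2 ∷ v3 ∷ v0 ∷ [])))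

  extendsF : Form 4
  extendsF = seal (withHolds
    (fstE v2 <ᶠ lenX v0 v1 v3 ∧ᶠ
     all< (fstE v2) (bitX v1 v2 v4 v0 ≡ᶠ lookX (sndE v3) (fstE v3) v0) ∧ᶠ
     bitX v0 v1 v3 (fstE v2) ≡ᶠ lit 1)
    (λ ρ → Extends (fn v0 ρ) (fn v1 ρ) (guess (fn v2 ρ)) (fn v3 ρ) (fst (fn v2 ρ)))
    (λ _ h → h) (λ _ h → h))

  expansionaryF : Form 3
  expansionaryF = seal (withHolds
    (all< v1 (appF extendsF (v1 ∷ v2 ∷ v3 ∷ v0 ∷ []) ⇒ᶠ
      all< (sucE v0) (¬ᶠ appF blockedF (v2 ∷ v3 ∷ v0 ∷ fstE v4 ∷ []))))
    (λ ρ → Expansionary (fn v0 ρ) (fn v1 ρ) (guess (fn v2 ρ)) (fst (fn v2 ρ)) (fn v1 ρ))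
    (λ _ h → h) (λ _ h → h))

  opaque
    newGuess : Exp 3
    newGuess = ifE expansionaryF (lit 1) (lit 0)

    newGuess-elim : ∀ ρ (P : ℕ → Set) → (Holds expansionaryF ρ → P 1) →
      (¬ Holds expansionaryF ρ → P 0) → P (fn newGuess ρ)
    newGuess-elim = if-elim expansionaryF (lit 1) (lit 0)

    extended : Exp 3
    extended = pairE (sucE (fstE v2)) (pairE newGuess (sndE v2))

    fn-extended : ∀ G s a → fn extended (G ∷ s ∷ a ∷ []) ≡
      ⟨ suc (fst a) , ⟨ fn newGuess (G ∷ s ∷ a ∷ []) , snd a ⟩ ⟩
    fn-extended G s a = refl

  nodeStep : Exp 3
  nodeStep = ifE liveF extended v2

  module _ (G s : ℕ) where

    partial : ℕ → ℕ
    partial j = natrec ⟨ 0 , 0 ⟩ (λ _ a → fn nodeStep (G ∷ s ∷ a ∷ [])) j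

    Live : ℕ → (ℕ → ℕ) → Set
    Live n b = ∃[ y ] (y < s × Follower G s b y n s)

    Guessed : ℕ → (ℕ → ℕ) → Set
    Guessed n b = (b n ≡ 1 × Expansionary G s b n s) ⊎ (b n ≡ 0 × ¬ Expansionary G s b n s)

    Live-cong : ∀ {n b b′} → (∀ i → i < n → b i ≡ b′ i) → Live n b → Live n b′
    Live-cong eq (y , y<s , p , q , c) = y , y<s , p , (λ i i<n → trans (q i i<n) (eq i i<n)) , c

    Expansionary-cong : ∀ {n b b′} → (∀ i → i < n → b i ≡ b′ i) → Expansionary G s b n s → Expansionary G s b′ n s
    Expansionary-cong eq h t t<s (p , q , c) = h t t<s (p , (λ i i<n → trans (q i i<n) (sym (eq i i<n))) , c)

    Guessed-cong : ∀ {n b b′} → (∀ i → i < suc n → b i ≡ b′ i) → Guessed n b → Guessed n b′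
    Guessed-cong {n} eq (inj₁ (p , h)) =
      inj₁ (trans (sym (eq n ≤-refl)) p , Expansionary-cong (λ i i<n → eq i (m<n⇒m<1+n i<n)) h)
    Guessed-cong {n} eq (inj₂ (p , h)) =
      inj₂ (trans (sym (eq n ≤-refl)) p , λ h′ → h (Expansionary-cong (λ i i<n → sym (eq i (m<n⇒m<1+n i<n))) h′))

    Good : ℕ → Set
    Good a = ∀ n → n < fst a → Live n (guess a) × Guessed n (guess a)

    newBit extend : ℕ → ℕ
    newBit a = fn newGuess (G ∷ s ∷ a ∷ [])
    extend a = fn extended (G ∷ s ∷ a ∷ [])

    fst-extend : ∀ a → fst (extend a) ≡ suc (fst a)
    fst-extend a = trans (cong fst (fn-extended G s a)) (fst-⟨⟩ (suc (fst a)) ⟨ newBit a , snd a ⟩)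

    snd-extend : ∀ a → snd (extend a) ≡ ⟨ newBit a , snd a ⟩
    snd-extend a = trans (cong snd (fn-extended G s a)) (snd-⟨⟩ (suc (fst a)) ⟨ newBit a , snd a ⟩)

    guess-extend : ∀ a i → guess (extend a) i ≡ look ⟨ newBit a , snd a ⟩ (suc (fst a)) i
    guess-extend a i = cong₂ (λ l m → look l m i) (snd-extend a) (fst-extend a)

    guess-old : ∀ a i → i < fst a → guess a i ≡ guess (extend a) i
    guess-old a i i< = sym (trans (guess-extend a i) (look-old (newBit a) (snd a) i<))

    guess-new : ∀ a → guess (extend a) (fst a) ≡ newBit a
    guess-new a = trans (guess-extend a (fst a)) (look-new (newBit a) (snd a) (fst a))

    guessed-new : ∀ a → Guessed (fst a) (guess (extend a))
    guessed-new a = newGuess-elim (G ∷ s ∷ a ∷ [])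
      (λ v → guess (extend a) (fst a) ≡ v → Guessed (fst a) (guess (extend a)))
      (λ h eq → inj₁ (eq , Expansionary-cong (guess-old a) h))
      (λ nh eq → inj₂ (eq , λ h → nh (Expansionary-cong (λ i i< → sym (guess-old a i i<)) h)))
      (guess-new a)

    good-extend : ∀ a a′ → fst a′ ≡ suc (fst a) → (∀ i → i < fst a → guess a i ≡ guess a′ i) →
      Guessed (fst a) (guess a′) → Live (fst a) (guess a) → Good a → Good a′
    good-extend a a′ eq old new live good n n< = go (m≤n⇒m<n∨m≡n (s≤s⁻¹ (subst (n <_) eq n<)))
      where
      go : n < fst a ⊎ n ≡ fst a → Live n (guess a′) × Guessed n (guess a′)
      go (inj₁ lt) = Live-cong (λ i i<n → old i (<-trans i<n lt)) (proj₁ (good n lt)) ,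
        Guessed-cong (λ i i≤n → old i (≤-trans i≤n lt)) (proj₂ (good n lt))
      go (inj₂ refl) = Live-cong old live , new

    -- After j steps the string has length j unless the growth has stopped for want of a live
    -- follower.
    Built : ℕ → ℕ → Set
    Built j a = Good a × fst a ≤ j × (fst a ≡ j ⊎ ¬ Live (fst a) (guess a))

    built-suc : ∀ j a → Built j a → Built (suc j) (fn nodeStep (G ∷ s ∷ a ∷ []))
    built-suc j a (good , le , stop) = if-elim liveF extended v2 (G ∷ s ∷ a ∷ []) (Built (suc j))
      (λ live → good-extend a (extend a) (fst-extend a) (guess-old a) (guessed-new a) live good ,
        subst (_≤ suc j) (sym (fst-extend a)) (s≤s le) ,
        inj₁ (trans (fst-extend a) ([ cong suc , (λ nl → ⊥-elim (nl live)) ]′ stop)))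
      (λ nl → good , m≤n⇒m≤1+n le , inj₂ nl)

    built : ∀ j → Built j (partial j)
    built zero    = (λ n ()) , z≤n , inj₁ refl
    built (suc j) = built-suc j (partial j) (built j)

  -- variables: history, stage
  nodeX : Exp 2
  nodeX = recE (lit ⟨ 0 , 0 ⟩) (app nodeStep (v2 ∷ v3 ∷ v1 ∷ [])) v1

  opaque
    -- Stage s adds the element s, waiting at its new node, and recomputes the states of all older
    -- elements from the previous history; their nodes are copied.
    histX : Exp 1
    histX = recE (lit 0)
      (pairE (pairE (app nodeX (v1 ∷ v0 ∷ [])) (lit (encSt wait)))
        (recE (lit 0) (pairE (pairE (fstE (lookX v3 v2 v0)) (app nextX (v3 ∷ v2 ∷ v0 ∷ []))) v1) v0))
      v0

  hist : ℕ → ℕ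
  hist s = fn histX (s ∷ [])

  entry : ℕ → ℕ → ℕ
  entry s x = ⟨ fst (look (hist s) s x) , fn nextX (hist s ∷ s ∷ x ∷ []) ⟩

  opaque
    unfolding histX

    hist-suc : ∀ s → hist (suc s) ≡ ⟨ ⟨ partial (hist s) s s , encSt wait ⟩ , tab (entry s) s ⟩
    hist-suc s = refl

  look-hist-new : ∀ s → look (hist (suc s)) (suc s) s ≡ ⟨ partial (hist s) s s , encSt wait ⟩
  look-hist-new s = trans (cong (λ G → look G (suc s) s) (hist-suc s)) (look-new ⟨ partial (hist s) s s , encSt wait ⟩ (tab (entry s) s) s)

  look-hist-old : ∀ {s x} → x < s → look (hist (suc s)) (suc s) x ≡ entry s x
  look-hist-old {s} {x} x<s = trans (cong (λ G → look G (suc s) x) (hist-suc s))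
    (trans (look-old ⟨ partial (hist s) s s , encSt wait ⟩ (tab (entry s) s) x<s) (look-tab (entry s) x<s))

  nodeOf : ℕ → ℕ
  nodeOf x = fst (look (hist (suc x)) (suc x) x)

  nodeOf-partial : ∀ x → nodeOf x ≡ partial (hist x) x x
  nodeOf-partial x = trans (cong fst (look-hist-new x)) (fst-⟨⟩ (partial (hist x) x x) (encSt wait))

  node-const : ∀ s {x} → x < s → fst (look (hist s) s x) ≡ nodeOf x
  node-const (suc s) {x} x<s = [ (λ x<s′ → trans (cong fst (look-hist-old x<s′))
      (trans (fst-⟨⟩ (fst (look (hist s) s x)) (fn nextX (hist s ∷ s ∷ x ∷ []))) (node-const s x<s′))) , (λ { refl → refl }) ]′
    (m≤n⇒m<n∨m≡n (s≤s⁻¹ x<s))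

  stC′ : ∀ {x s} → Dec (x < s) → St
  stC′ {x} {s} (yes _) = stN (hist s) s x s
  stC′ {x} {s} (no _)  = wait

  opaque
    lenC : ℕ → ℕ
    lenC x = fst (nodeOf x)

    bitC : ℕ → ℕ → ℕ
    bitC x = guess (nodeOf x)

    stC : ℕ → ℕ → St
    stC x s = stC′ (x <? s)

    stC-active : ∀ {x s} → x < s → stC x s ≡ stN (hist s) s x s
    stC-active {x} {s} x<s = go (x <? s)
      where
      go : (d : Dec (x < s)) → stC′ d ≡ stN (hist s) s x s
      go (yes _) = refl
      go (no nx) = contradiction x<s nx

    agree : ∀ s → Agree (lenN (hist s) s) lenC (bitN (hist s) s) bitC (stN (hist s) s) stC s
    agree s = record
      { len-≡ = λ t<s → cong fst (node-const s t<s)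
      ; bit-≡ = λ i t<s → cong (λ a → guess a i) (node-const s t<s)
      ; st-≡  = λ x<s → sym (stC-active x<s)
      }

    stC-early : ∀ x s → s ≤ suc x → stC x s ≡ wait
    stC-early x s s≤ = go (x <? s)
      where
      go : (d : Dec (x < s)) → stC′ d ≡ wait
      go (no _)    = refl
      go (yes x<s) = trans (cong (λ u → stN (hist u) u x u) (≤-antisym s≤ x<s))
        (trans (cong decSt (trans (cong snd (look-hist-new x)) (snd-⟨⟩ (partial (hist x) x x) (encSt wait))))
               (decSt-encSt wait))

    bitC-partial : ∀ s i → bitC s i ≡ guess (partial (hist s) s s) i
    bitC-partial s i = cong (λ a → guess a i) (nodeOf-partial s)

    <-partial : ∀ s n → n < lenC s → n < fst (partial (hist s) s s)
    <-partial s n = subst (λ a → n < fst a) (nodeOf-partial s)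

    lenC-≤ : ∀ s → lenC s ≤ s
    lenC-≤ s = subst (λ a → fst a ≤ s) (sym (nodeOf-partial s)) (proj₁ (proj₂ (built (hist s) s s)))

  stC-suc : ∀ {x s} → x < s → stC x (suc s) ≡ decSt (fn nextX (hist s ∷ s ∷ x ∷ []))
  stC-suc {x} {s} x<s = trans (stC-active (m<n⇒m<1+n x<s))
    (cong decSt (trans (cong snd (look-hist-old x<s))
      (snd-⟨⟩ (fst (look (hist s) s x)) (fn nextX (hist s ∷ s ∷ x ∷ [])))))

  private
    module 𝓝 = Notions N lenC bitC stC

  stepC : ∀ x s → x < s → 𝓝.Step k final x s (stC x s) (stC x (suc s))
  stepC x s x<s = subst₂ (𝓝.Step k final x s) (sym (stC-active x<s)) (sym (stC-suc x<s))
    (LocalSteps.step-local (agree s) x<s (next-step (hist s) s x))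

  liveC : ∀ s n → n < lenC s → ∃[ y ] (y < s × 𝓝.Follower (bitC s) y n s)
  liveC s n n< = let y , y<s , fol = Live-cong (hist s) s (λ i _ → sym (bitC-partial s i))
                       (proj₁ (proj₁ (built (hist s) s s) n (<-partial s n n<))) in
    y , y<s , LocalNodes.follower-local {N} {b = bitC s} (agree s) y<s fol

  guessedC : ∀ s n → n < lenC s → (bitC s n ≡ 1 × 𝓝.Expansionary (bitC s) n s) ⊎
    (bitC s n ≡ 0 × ¬ 𝓝.Expansionary (bitC s) n s)
  guessedC s n n< = [ (λ (eq , h) → inj₁ (eq , LocalNodes.expansionary-local {N} {b = bitC s} {n} (agree s) h))
    , (λ (eq , h) → inj₂ (eq , λ h′ → h (LocalNodes.expansionary-local {N} {b = bitC s} {n} (Agree-sym (agree s)) h′))) ]′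
    (Guessed-cong (hist s) s {n} (λ i _ → sym (bitC-partial s i))
      (proj₂ (proj₁ (built (hist s) s s) n (<-partial s n n<))))

  opaque
    unfolding lenC

    stopC : ∀ s → lenC s < s → ∀ y → y < s → ¬ 𝓝.Follower (bitC s) y (lenC s) s
    stopC s len< y y<s fol = [ (λ eq → <-irrefl (trans (cong fst (nodeOf-partial s)) eq) len<)
      , (λ nl → nl (y , y<s , subst (λ a → Snapshot.Follower N (hist s) s (guess a) y (fst a) s) (nodeOf-partial s)
          (LocalNodes.follower-local {N} {b = bitC s} (Agree-sym (agree s)) y<s fol))) ]′
      (proj₂ (proj₂ (built (hist s) s s)))

  construction : Construction N k final
  construction = record
    { len = lenC
    ; bit = bitC
    ; st = stC
    ; st-early = stC-early
    ; st-step = stepC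
    ; len≤ = lenC-≤
    ; node-live = liveC
    ; node-bit = guessedC
    ; node-stop = stopC
    }

-- Indices of c.e. sets

run-fn : ∀ {n} (e : Exp n) ρ s {v} → run s (code e) (enc ρ) ≡ just v → v ≡ fn e ρ
run-fn e ρ s eq = just-injective
  (trans (sym (run-mono (code e) (m≤m⊔n s (suc (fuel (computes e ρ)))) eq))
         (run-mono (code e) (m≤n⊔m s (suc (fuel (computes e ρ)))) (runs (computes e ρ))))

-- Every failed test costs one unit of the resource bound, so a search that succeeds within t has
-- made fewer than t of them.
search-sound : ∀ {n} (φ : Form (suc n)) ρ t i {v} → run t (searchᶜ φ) ⟨ enc ρ , i ⟩ ≡ just v →
  ∃[ u ] (u < i + t × Holds φ (u ∷ ρ))
search-sound φ ρ (suc t) i {v} eq = go (run (suc t) test ⟨ enc ρ , i ⟩) refl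
    (trans (sym (cong (minStep (run (suc t) test ⟨ enc ρ , i ⟩) (run t (searchᶜ φ))) (unpair-⟨⟩ (enc ρ) i))) eq)
  where
  test : Code
  test = compᶜ (code (χ φ)) (pairᶜ rightᶜ leftᶜ)
  value : ∀ {w} → run (suc t) test ⟨ enc ρ , i ⟩ ≡ just w → w ≡ fn (χ φ) (i ∷ ρ)
  value h = run-fn (χ φ) (i ∷ ρ) (suc t) (trans (sym (cong₂ (λ y z → run (suc t) (code (χ φ)) ⟨ y , z ⟩)
    (snd-⟨⟩ (enc ρ) i) (fst-⟨⟩ (enc ρ) i))) h)
  go : ∀ m → run (suc t) test ⟨ enc ρ , i ⟩ ≡ m → minStep m (run t (searchᶜ φ)) (enc ρ , i) ≡ just v →
    ∃[ u ] (u < i + suc t × Holds φ (u ∷ ρ))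
  go (just zero)    h _ = i , m<m+n i z<s , sound φ (i ∷ ρ) (sym (value h))
  go (just (suc w)) h p = let u , lt , hu = search-sound φ ρ t (suc i) p in
    u , subst (u <_) (sym (+-suc i t)) lt , hu

enumᶜ : ∀ {n} → Form (suc n) → Code
enumᶜ φ = compᶜ (searchᶜ φ) (pairᶜ idᶜ zeroᶜ)

enum-run : ∀ {n} (φ : Form (suc n)) s x → run (suc s) (enumᶜ φ) x ≡ run (suc s) (searchᶜ φ) ⟨ x , 0 ⟩
enum-run φ s x = cong (λ y → run (suc s) (searchᶜ φ) ⟨ y , 0 ⟩) (⟨⟩-unpair x)

paramsᶜ : ∀ {p} → Vec ℕ p → Code
paramsᶜ []      = zeroᶜ
paramsᶜ (a ∷ ρ) = pairᶜ (constᶜ a) (paramsᶜ ρ)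

params-run : ∀ {p} (ρ : Vec ℕ p) s x → run (suc s) (paramsᶜ ρ) x ≡ just (enc ρ)
params-run []      s x = refl
params-run (a ∷ ρ) s x rewrite const-run a s x | params-run ρ s x = refl

opaque
  index : Code → ℕ
  index = encode

  decode-index : ∀ c → decode (index c) ≡ c
  decode-index = decode-encode

opaque
  ce : ∀ {p} → Form (2 + p) → Vec ℕ p → ℕ
  ce φ ρ = index (compᶜ (enumᶜ φ) (pairᶜ idᶜ (paramsᶜ ρ)))

  -- Supplying constants costs nothing, so the two sides agree under each single bound and not only
  -- in the limit. This lets the stages of a set be decided with the parameters as variables.
  ce-run : ∀ {p} (φ : Form (2 + p)) ρ s x → run s (decode (ce φ ρ)) x ≡ run s (enumᶜ φ) (enc (x ∷ ρ))
  ce-run φ ρ zero    x = refl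
  ce-run φ ρ (suc s) x = trans (cong (λ c → run (suc s) c x) (decode-index (compᶜ (enumᶜ φ) (pairᶜ idᶜ (paramsᶜ ρ)))))
    (go (run (suc s) (paramsᶜ ρ) x) (params-run ρ s x))
    where
    go : ∀ m → m ≡ just (enc ρ) →
      ((m >>= λ z → just ⟨ ⟨ fst x , snd x ⟩ , z ⟩) >>= run (suc s) (enumᶜ φ)) ≡ run (suc s) (enumᶜ φ) (enc (x ∷ ρ))
    go _ refl = cong (λ y → run (suc s) (enumᶜ φ) ⟨ y , enc ρ ⟩) (⟨⟩-unpair x)

is-just : ∀ {m : Maybe ℕ} → Is-just m → ∃[ v ] m ≡ just v
is-just {just v} _ = v , refl

just-is : ∀ {m : Maybe ℕ} {v} → m ≡ just v → Is-just m
just-is refl = Maybe.just tt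

-- An element listed by stage t has a witness below t. This relates the standard enumeration to the
-- stages of the construction: nothing is listed in A before it has entered A.
ce-at : ∀ {p} (φ : Form (2 + p)) ρ {t x} → (W[ ce φ ρ ]at t) x → ∃[ s ] (s < t × Holds φ (s ∷ x ∷ ρ))
ce-at φ ρ {suc t} {x} (_ , j) = let v , eq = is-just j in
  search-sound φ (x ∷ ρ) (suc t) 0
    (trans (sym (trans (ce-run φ ρ (suc t) x) (enum-run φ t (enc (x ∷ ρ))))) eq)

ce⁻ : ∀ {p} (φ : Form (2 + p)) ρ {x} → W (ce φ ρ) x → ∃[ s ] Holds φ (s ∷ x ∷ ρ)
ce⁻ φ ρ (t , w) = let s , _ , h = ce-at φ ρ w in s , h

enum-halts : ∀ {n} (φ : Form (suc n)) ρ i → Holds φ (i ∷ ρ) →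
  ∃[ t ] ∃[ v ] (∀ t′ → t ≤ t′ → run t′ (enumᶜ φ) (enc ρ) ≡ just v)
enum-halts φ ρ i h = let u , hu , below = least (λ i → holds? φ (i ∷ ρ)) i h
                         c = search-⇓ φ ρ 0 u (λ j _ → below j) hu in
  suc (fuel c) , u , λ { (suc t′) le → trans (enum-run φ t′ (enc ρ)) (run-mono (searchᶜ φ) {⟨ enc ρ , 0 ⟩} le (runs c)) }

ce-eventually : ∀ {p} (φ : Form (2 + p)) ρ {s x} → Holds φ (s ∷ x ∷ ρ) →
  ∃[ t ] (∀ t′ → t ≤ t′ → (W[ ce φ ρ ]at t′) x)
ce-eventually φ ρ {s} {x} h = let t , v , eq = enum-halts φ (x ∷ ρ) s h in
  suc x ⊔ t , λ t′ le → m⊔n≤o⇒m≤o (suc x) t le ,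
    just-is (trans (ce-run φ ρ t′ x) (eq t′ (m⊔n≤o⇒n≤o (suc x) t le)))

ce⁺ : ∀ {p} (φ : Form (2 + p)) ρ {s x} → Holds φ (s ∷ x ∷ ρ) → W (ce φ ρ) x
ce⁺ φ ρ h = let t , w = ce-eventually φ ρ h in t , w t ≤-refl

computable : (e : Exp 1) → Computable (λ x → fn e (x ∷ []))
computable e = index c , λ x → suc (fuel (d x)) ,
    trans (cong (λ c → run (suc (fuel (d x))) c x) (decode-index c)) (runs (d x))
  where
  c : Code
  c = compᶜ (code e) (pairᶜ idᶜ zeroᶜ)
  input : ∀ x → pairᶜ idᶜ zeroᶜ · x ⇓ ⟨ x , 0 ⟩
  input x = pair-⇓ id-⇓ (conv 0 refl)
  d : ∀ x → c · x ⇓ fn e (x ∷ [])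
  d x = comp-⇓ (input x) (computes e (x ∷ []))

computableX : ∀ {p} → Computable p → Exp 1
computableX {p} (e , h) = mkExp f (compᶜ (decode e) leftᶜ) c
  where
  f : Vec ℕ 1 → ℕ
  f (x ∷ []) = p x
  c : ∀ ρ → compᶜ (decode e) leftᶜ · enc ρ ⇓ f ρ
  c (x ∷ []) = let s , eq = h x in comp-⇓ (fst-⇓ x 0) (⇓-run {s = s} eq)

nth-enc : ∀ {n} (v : Vec ℕ n) i → nth (enc v) (toℕ i) ≡ lookup v i
nth-enc (a ∷ v) zero    = fst-⟨⟩ a (enc v)
nth-enc (a ∷ v) (suc i) = trans (cong fst (trans (natrec-shift snd ⟨ a , enc v ⟩ (toℕ i))
  (cong (λ z → natrec z (λ _ → snd) (toℕ i)) (snd-⟨⟩ a (enc v))))) (nth-enc v i)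

tuple-enc : ∀ {n} (v : Vec ℕ n) → tuple n (enc v) ≡ v
tuple-enc []      = refl
tuple-enc {suc n} (a ∷ v) = cong₂ _∷_ (fst-⟨⟩ a (enc v))
  (trans (cong (tuple n) (snd-⟨⟩ a (enc v))) (tuple-enc v))

-- Enumerating the sets of the construction

module Listings (N k : ℕ) (final : St) where

  open Program N k final
  open Construction construction using (len; bit; st)
  open Notions N len bit st

  private
    code-of : ℕ → ℕ → ℕ
    code-of s x = snd (look (hist s) s x)

    tagOf : ℕ → ℕ → ℕ
    tagOf s x = fst (code-of s x)

    wOf : ℕ → ℕ → ℕ
    wOf s x = snd (code-of s x)

  codeX : ∀ {n} → Exp n → Exp n → Exp n
  codeX s x = stX (app histX (s ∷ [])) s x

  st-tag : ∀ {x s z} → x < s → decTag (tagOf s x) (wOf s x) ≡ z → st x s ≡ z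
  st-tag x<s eq = trans (stC-active x<s) eq

  tag-st : ∀ {x s z} → st x s ≡ z → ¬ z ≡ wait → x < s × decTag (tagOf s x) (wOf s x) ≡ z
  tag-st {x} {s} {z} eq nw = x<s , trans (sym (stC-active x<s)) eq
    where
    x<s : x < s
    x<s = ≰⇒> λ s≤x → nw (trans (sym eq) (stC-early x s (m≤n⇒m≤1+n s≤x)))

  tag-A : ∀ T w → decTag T w ≡ inA → T ≡ 3
  tag-A 3 w eq = refl

  tag-Y : ∀ T w → decTag T w ≡ inY → 4 ≤ T
  tag-Y (suc (suc (suc (suc T)))) w eq = s≤s (s≤s (s≤s (s≤s z≤n)))

  Y-tag : ∀ T w → 4 ≤ T → decTag T w ≡ inY
  Y-tag (suc (suc (suc (suc T)))) w _ = refl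
  Y-tag 1 w (s≤s ())
  Y-tag 2 w (s≤s (s≤s ()))
  Y-tag 3 w (s≤s (s≤s (s≤s ())))

  tag-rest : ∀ T w {r} → decTag T w ≡ rest r → T ≡ 1 × rd w ≡ r
  tag-rest 1 w refl = refl , refl
  tag-rest 2 w ()
  tag-rest 3 w ()
  tag-rest (suc (suc (suc (suc T)))) w ()

  tag-climb : ∀ T w {r ℓ t} → decTag T w ≡ climb r ℓ t → T ≡ 2 × rd w ≡ r × lv w ≡ ℓ × tm w ≡ t
  tag-climb 2 w refl = refl , refl , refl , refl
  tag-climb 3 w ()
  tag-climb (suc (suc (suc (suc T)))) w ()

  tag-wait : ∀ T w → ¬ decTag T w ≡ wait → 1 ≤ T
  tag-wait zero    w h = contradiction refl h
  tag-wait (suc T) w h = s≤s z≤n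

  wait-tag : ∀ T w → 1 ≤ T → ¬ decTag T w ≡ wait
  wait-tag 1 w _ ()
  wait-tag 2 w _ ()
  wait-tag 3 w _ ()
  wait-tag (suc (suc (suc (suc T)))) w _ ()

  -- variables: stage, x
  enterF : Form 2
  enterF = seal (withHolds (v1 <ᶠ v0 ∧ᶠ lit 1 ≤ᶠ fstE (codeX v0 v1))
    (λ ρ → ¬ st (fn v1 ρ) (fn v0 ρ) ≡ wait)
    (λ { (s ∷ x ∷ []) (x<s , h) eq → wait-tag (tagOf s x) (wOf s x) h (trans (sym (stC-active x<s)) eq) })
    (λ { (s ∷ x ∷ []) nw → let x<s = ≰⇒> λ s≤x → nw (stC-early x s (m≤n⇒m≤1+n s≤x)) in
         x<s , tag-wait (tagOf s x) (wOf s x) (λ eq → nw (st-tag x<s eq)) }))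

  inAF : Form 2
  inAF = seal (withHolds (v1 <ᶠ v0 ∧ᶠ fstE (codeX v0 v1) ≡ᶠ lit 3)
    (λ ρ → st (fn v1 ρ) (fn v0 ρ) ≡ inA)
    (λ { (s ∷ x ∷ []) (x<s , h) → st-tag x<s (cong (λ T → decTag T (wOf s x)) h) })
    (λ { (s ∷ x ∷ []) eq → let x<s , e = tag-st eq (λ ()) in x<s , tag-A (tagOf s x) (wOf s x) e }))

  inYF : Form 2
  inYF = seal (withHolds (v1 <ᶠ v0 ∧ᶠ lit 4 ≤ᶠ fstE (codeX v0 v1))
    (λ ρ → st (fn v1 ρ) (fn v0 ρ) ≡ inY)
    (λ { (s ∷ x ∷ []) (x<s , h) → st-tag x<s (Y-tag (tagOf s x) (wOf s x) h) })
    (λ { (s ∷ x ∷ []) eq → let x<s , e = tag-st eq (λ ()) in x<s , tag-Y (tagOf s x) (wOf s x) e }))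

  -- variables: stage, x, r
  restF : Form 3
  restF = seal (withHolds (v1 <ᶠ v0 ∧ᶠ fstE (codeX v0 v1) ≡ᶠ lit 1 ∧ᶠ fstE (sndE (codeX v0 v1)) ≡ᶠ v2)
    (λ ρ → st (fn v1 ρ) (fn v0 ρ) ≡ rest (fn v2 ρ))
    (λ { (s ∷ x ∷ r ∷ []) (x<s , h , h′) → st-tag x<s
         (trans (cong (λ T → decTag T (wOf s x)) h) (cong rest h′)) })
    (λ { (s ∷ x ∷ r ∷ []) eq → let x<s , e = tag-st eq (λ ()) in x<s , tag-rest (tagOf s x) (wOf s x) e }))

  -- variables: stage, x, r, n
  arriveF : Form 4
  arriveF = seal (withHolds (v1 <ᶠ v0 ∧ᶠ fstE z ≡ᶠ lit 2 ∧ᶠ fstE w ≡ᶠ v2 ∧ᶠ fstE (sndE w) ≡ᶠ sucE v3 ∧ᶠ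
      sndE (sndE w) ≡ᶠ v0)
    (λ ρ → st (fn v1 ρ) (fn v0 ρ) ≡ climb (fn v2 ρ) (suc (fn v3 ρ)) (fn v0 ρ))
    (λ { (s ∷ x ∷ r ∷ n ∷ []) (x<s , h , h₁ , h₂ , h₃) → st-tag x<s
         (trans (cong (λ T → decTag T (wOf s x)) h) (climb-≡ h₁ h₂ h₃)) })
    (λ { (s ∷ x ∷ r ∷ n ∷ []) eq → let x<s , e = tag-st eq (λ ()) in x<s , tag-climb (tagOf s x) (wOf s x) e }))
    where
    z w : Exp 4
    z = codeX v0 v1
    w = sndE z

  -- variables: stage, x
  deadF : Form 2
  deadF = seal (withHolds (v1 <ᶠ v0 ∧ᶠ ¬ᶠ enterF ∧ᶠ appF cancelledF (app histX (v0 ∷ []) ∷ v0 ∷ v1 ∷ []))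
    (λ ρ → fn v1 ρ < fn v0 ρ × st (fn v1 ρ) (fn v0 ρ) ≡ wait × Cancelled (fn v1 ρ) (fn v0 ρ))
    (λ { (s ∷ x ∷ []) (x<s , h , c) → x<s , waits s x h , LocalCuts.cancelled-local {N} (agree s) c })
    (λ { (s ∷ x ∷ []) (x<s , eq , c) → x<s , (λ nw → nw eq) , LocalCuts.cancelled-local {N} (Agree-sym (agree s)) c }))
    where
    waits : ∀ s x → ¬ ¬ st x s ≡ wait → st x s ≡ wait
    waits s x nn with st x s
    ... | wait = refl
    ... | rest r = contradiction (λ ()) nn
    ... | climb r ℓ t = contradiction (λ ()) nn
    ... | inA = contradiction (λ ()) nn
    ... | inY = contradiction (λ ()) nn

  -- For a fixed y on the true path through level n this decides whether x follows it: a single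
  -- number y carries all that is used of the path.
  SameNode : ℕ → ℕ → ℕ → Set
  SameNode n y x = n < len x × (∀ i → i < suc n → bit x i ≡ bit y i)

  -- variables: stage, x, n, y
  sameNodeF : Form 4
  sameNodeF = seal (withHolds
    (v1 <ᶠ v0 ∧ᶠ v3 <ᶠ v0 ∧ᶠ v2 <ᶠ lenX (app histX (v0 ∷ [])) v0 v1 ∧ᶠ
      all< (sucE v2) (bitX (app histX (v1 ∷ [])) v1 v2 v0 ≡ᶠ bitX (app histX (v1 ∷ [])) v1 v4 v0))
    (λ ρ → fn v1 ρ < fn v0 ρ × fn v3 ρ < fn v0 ρ × SameNode (fn v2 ρ) (fn v3 ρ) (fn v1 ρ))
    (λ { (s ∷ x ∷ n ∷ y ∷ []) (x<s , y<s , n< , h) → x<s , y<s ,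
         subst (n <_) (Agree.len-≡ (agree s) x<s) n< ,
         λ i i< → trans (sym (Agree.bit-≡ (agree s) i x<s)) (trans (h i i<) (Agree.bit-≡ (agree s) i y<s)) })
    (λ { (s ∷ x ∷ n ∷ y ∷ []) (x<s , y<s , n< , h) → x<s , y<s ,
         subst (n <_) (sym (Agree.len-≡ (agree s) x<s)) n< ,
         λ i i< → trans (Agree.bit-≡ (agree s) i x<s) (trans (h i i<) (sym (Agree.bit-≡ (agree s) i y<s))) }))

  -- Only the code e of the sequence B enters, while the gate and its splitting are quantified away;
  -- so D can be given before S.
  AskedFor : ℕ → ℕ → ℕ → ℕ → Set
  AskedFor e r x s = ∃[ m ] ∃[ r′ ] ∃[ t ] (r ≤ r′ × st x s ≡ climb r′ (suc m) t × m < len x × bit x m ≡ 1 ×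
    Uncut x m s × 2 ≤ fst m × Bix m ≡ e × Asks x m s)

  -- variables: stage, x, r, e
  askedF : Form 4
  askedF = seal (withHolds
    (v1 <ᶠ v0 ∧ᶠ fstE z ≡ᶠ lit 2 ∧ᶠ v2 ≤ᶠ fstE w ∧ᶠ
     ex< (lenX (app histX (v0 ∷ [])) v0 v1)
       (fstE (sndE (sndE (codeX v1 v2))) ≡ᶠ sucE v0 ∧ᶠ bitX (app histX (v1 ∷ [])) v1 v2 v0 ≡ᶠ lit 1 ∧ᶠ
        appF uncutF (app histX (v1 ∷ []) ∷ v1 ∷ v2 ∷ v0 ∷ []) ∧ᶠ lit 2 ≤ᶠ fstE v0 ∧ᶠ
        bixX v0 ≡ᶠ v4 ∧ᶠ appF asksF (app histX (v1 ∷ []) ∷ v1 ∷ v2 ∷ v0 ∷ [])))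
    (λ ρ → AskedFor (fn v3 ρ) (fn v2 ρ) (fn v1 ρ) (fn v0 ρ))
    (λ { (s ∷ x ∷ r ∷ e ∷ []) (x<s , h , h₁ , m , m< , h₂ , b , u , 2≤ , beq , asks) →
         m , rd (wOf s x) , tm (wOf s x) , h₁ ,
         st-tag x<s (trans (cong (λ T → decTag T (wOf s x)) h) (climb-≡ refl h₂ refl)) ,
         subst (m <_) (Agree.len-≡ (agree s) x<s) m< , trans (sym (Agree.bit-≡ (agree s) m x<s)) b ,
         LocalBlocking.uncut-local {N} {n = m} (agree s) u , 2≤ , beq , LocalBlocking.asks-local {N} {n = m} (agree s) x<s asks })
    (λ { (s ∷ x ∷ r ∷ e ∷ []) (m , r′ , t , r≤ , eq , m< , b , u , 2≤ , beq , asks) →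
         let x<s , e′ = tag-st eq (λ ()) ; h , h₁ , h₂ , _ = tag-climb (tagOf s x) (wOf s x) e′ in
         x<s , h , subst (r ≤_) (sym h₁) r≤ , m , subst (m <_) (sym (Agree.len-≡ (agree s) x<s)) m< , h₂ ,
         trans (Agree.bit-≡ (agree s) m x<s) b , LocalBlocking.uncut-local {N} {n = m} (Agree-sym (agree s)) u , 2≤ , beq ,
         LocalBlocking.asks-local {N} {n = m} (Agree-sym (agree s)) x<s asks }))
    where
    z w : Exp 4
    z = codeX v0 v1
    w = sndE z

-- variables: stage, x, s₁, table, n, y
startF : (N k : ℕ) (final : St) → Form 6
startF N k final = (v1 <ᶠ v2 ∧ᶠ lookX v3 v2 v1 ≡ᶠ lit 0) ∨ᶠ
    (v2 ≤ᶠ v1 ∧ᶠ (appF sameNodeF (v0 ∷ v1 ∷ v4 ∷ v5 ∷ []) ∨ᶠ appF deadF (v0 ∷ v1 ∷ [])))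
  where open Listings N k final

-- variables: stage, x, r, s₁, n, y
trackF : (N k : ℕ) (final : St) → Form 6
trackF N k final = v3 ≤ᶠ v1 ∧ᶠ appF sameNodeF (v0 ∷ v1 ∷ v4 ∷ v5 ∷ []) ∧ᶠ
    ex< v0 (appF restF (v0 ∷ v2 ∷ v3 ∷ []))
  where open Listings N k final

-- variables: stage, x, r, n, s₁
gateF : (N k : ℕ) (final : St) → Form 5
gateF N k final = v4 ≤ᶠ v1 ∧ᶠ appF arriveF (v0 ∷ v1 ∷ v2 ∷ v3 ∷ [])
  where open Listings N k final

trueF falseF : Form 2
trueF = lit 0 ≤ᶠ lit 0
falseF = lit 1 ≤ᶠ lit 0

inputX : ∀ {p} → Exp (2 + p)
inputX {p} = mkExp f rightᶜ c
  where
  f : Vec ℕ (2 + p) → ℕ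
  f (_ ∷ ρ) = enc ρ
  c : ∀ ρ → rightᶜ · enc ρ ⇓ f ρ
  c (t ∷ ρ) = snd-⇓ t (enc ρ)

CeAt : ∀ {p} → Form (2 + p) → Vec ℕ (2 + p) → Set
CeAt φ (t ∷ x ∷ ρ) = (W[ ce φ ρ ]at t) x

-- The parameters are moved from the index into the input. One fixed index then serves all of them,
-- and the index `ce φ ρ` never has to be computed from ρ.
ceRunX : ∀ {p} → Form (2 + p) → Exp (2 + p)
ceRunX φ = app runE (v0 ∷ lit (index (enumᶜ φ)) ∷ inputX ∷ [])

fn-ceRunX : ∀ {p} (φ : Form (2 + p)) t x ρ →
  fn (ceRunX φ) (t ∷ x ∷ ρ) ≡ maybeCode (run t (decode (ce φ ρ)) x)
fn-ceRunX φ t x ρ = trans (fn-runE t (index (enumᶜ φ)) (enc (x ∷ ρ)))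
  (cong maybeCode (trans (cong (λ c → run t c (enc (x ∷ ρ))) (decode-index (enumᶜ φ))) (sym (ce-run φ ρ t x))))

ceAtF : ∀ {p} → Form (2 + p) → Form (2 + p)
ceAtF φ = seal (withHolds (v1 <ᶠ v0 ∧ᶠ lit 0 <ᶠ ceRunX φ) (CeAt φ)
  (λ { (t ∷ x ∷ ρ) (p , q) → p , is-just-code (run t (decode (ce φ ρ)) x) (subst (0 <_) (fn-ceRunX φ t x ρ) q) })
  (λ { (t ∷ x ∷ ρ) (p , q) → p , subst (0 <_) (sym (fn-ceRunX φ t x ρ)) (code-is-just q) }))

-- Presentations of the complement of A and the equations of Ψ

module Presentation (t d : ℕ → ℕ) (y : ℕ) where

  build : ∀ m → ℕ → Vec ℕ m
  build 0             r = []
  build 1             r = y ∷ []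
  build (suc (suc m)) r = t r ∷ d r ∷ build m (suc r)

  build⁻ : ∀ (V : ℕ → Pred ℕ 0ℓ) m r {x} → differences (Vec.map V (build m r)) x →
    (∃[ i ] (V (t i) x × ¬ V (d i) x)) ⊎ V y x
  build⁻ V 1             r h        = inj₂ h
  build⁻ V (suc (suc m)) r (inj₁ h) = inj₁ (r , h)
  build⁻ V (suc (suc m)) r (inj₂ h) = build⁻ V m (suc r) h

  build⁺ : ∀ (V : ℕ → Pred ℕ 0ℓ) m r i {x} → suc i * 2 ≤ m → V (t (i + r)) x → ¬ V (d (i + r)) x →
    differences (Vec.map V (build m r)) x
  build⁺ V (suc (suc m)) r zero    le h nh = inj₁ (h , nh)
  build⁺ V (suc (suc m)) r (suc i) {x} le h nh = inj₂ (build⁺ V m (suc r) i (s≤s⁻¹ (s≤s⁻¹ le))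
    (subst (λ r → V (t r) x) (sym (+-suc i r)) h) (λ w → nh (subst (λ r → V (d r) x) (+-suc i r) w)))
  build⁺ V 1 r i (s≤s ())

  build-last⁺ : ∀ (V : ℕ → Pred ℕ 0ℓ) h r {x} → V y x → differences (Vec.map V (build (suc (h * 2)) r)) x
  build-last⁺ V zero    r w = w
  build-last⁺ V (suc h) r w = inj₂ (build-last⁺ V h (suc r) w)

  -- `outside` and `disjoint` keep A out of the presented set, `inside` covers the complement, and
  -- `late` gives tardiness on each difference. The trailing set for odd m meets A at no stage. For
  -- even m there is no place for it, so it must be empty.
  presented : ∀ a (p : ℕ → ℕ) m k → (m ≡ k * 2 × (∀ x → ¬ W y x)) ⊎ m ≡ suc (k * 2) →
    (∀ r x → W a x → W (t r) x → W (d r) x) → (∀ x → W a x → ¬ W y x) →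
    (∀ x → ¬ W a x → (∃[ r ] (r < k × W (t r) x × ¬ W (d r) x)) ⊎ W y x) →
    (∀ r x s → (W[ t r ]at s) x → ¬ (W[ d r ]at s) x → ¬ (W[ a ]at (p s)) x) →
    ∃[ e ] ((X[ m ] e ≐ ∁ (W a)) × (∀ x s → x ∈ X[ m , e ]at s → x ∉ W[ a ]at (p s)))
  presented a p m k size outside disjoint inside late = enc (build m 0) ,
      ((λ {x} h → sound′ x (on-build W h)) , (λ {x} na → off-build W (complete′ x (inside x na)))) ,
      λ x s h wa → [ (λ (r , w , nw) → late r x s w nw wa) , (λ w → disjoint x (p s , wa) (s , w)) ]′
        (build⁻ (W[_]at s) m 0 (on-build (W[_]at s) h))
    where
    on-build : ∀ (V : ℕ → Pred ℕ 0ℓ) {x} → differences (Vec.map V (tuple m (enc (build m 0)))) x →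
      differences (Vec.map V (build m 0)) x
    on-build V {x} = subst (λ v → differences (Vec.map V v) x) (tuple-enc (build m 0))
    off-build : ∀ (V : ℕ → Pred ℕ 0ℓ) {x} → differences (Vec.map V (build m 0)) x →
      differences (Vec.map V (tuple m (enc (build m 0)))) x
    off-build V {x} = subst (λ v → differences (Vec.map V v) x) (sym (tuple-enc (build m 0)))
    sound′ : ∀ x → differences (Vec.map W (build m 0)) x → ¬ W a x
    sound′ x h wa = [ (λ (r , w , nw) → nw (outside r x wa w)) , disjoint x wa ]′ (build⁻ W m 0 h)
    2k≤m : k * 2 ≤ m
    2k≤m = [ (λ (eq , _) → ≤-reflexive (sym eq)) , (λ { refl → n≤1+n (k * 2) }) ]′ size
    complete′ : ∀ x → (∃[ r ] (r < k × W (t r) x × ¬ W (d r) x)) ⊎ W y x →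
      differences (Vec.map W (build m 0)) x
    complete′ x (inj₁ (r , r<k , w , nw)) = build⁺ W m 0 r (≤-trans (*-monoˡ-≤ 2 r<k) 2k≤m)
      (subst (λ i → W (t i) x) (sym (+-identityʳ r)) w) (λ w′ → nw (subst (λ i → W (d i) x) (+-identityʳ r) w′))
    complete′ x (inj₂ w) = [ (λ (_ , ny) → contradiction w (ny x)) ,
      (λ eq → subst (λ m → differences (Vec.map W (build m 0)) x) (sym eq) (build-last⁺ W k 0 w)) ]′ size

-- Indexed from 0, `t r` and `b r` stand for T and B with subscript r + 1. Since S misses
-- `t (suc j)`, the last equation becomes an instance of the general one.
Ψ-intro : ∀ {j} (E S : Pred ℕ 0ℓ) (B T : Vec ℕ (suc j)) (t b : ℕ → Pred ℕ 0ℓ) →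
  (∀ i {x} → W (lookup T i) x → t (toℕ i) x) → (∀ i {x} → t (toℕ i) x → W (lookup T i) x) →
  (∀ i {x} → b (toℕ i) x → W (lookup B i) x) → (∀ i {x} → W (lookup B i) x → b (toℕ i) x) →
  (∀ r x → S x → t r x → E x ⊎ t (suc r) x → b r x) →
  (∀ r x → r < suc j → S x → t r x → b r x → E x ⊎ t (suc r) x) →
  (∀ x → S x → ¬ t (suc j) x) → Ψ E S B T
Ψ-intro {j} E S B T t b T⁻ T⁺ B⁻ B⁺ into outof end =
    (λ i → (λ {x} → to i x) , (λ {x} → from i x)) , (λ {x} → lastTo x) , (λ {x} → lastFrom x)
  where
  inj : ∀ (P : ℕ → Pred ℕ 0ℓ) (i : Fin j) {x} → P (toℕ (inject₁ i)) x → P (toℕ i) x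
  inj P i {x} = subst (λ r → P r x) (toℕ-inject₁ i)
  jni : ∀ (P : ℕ → Pred ℕ 0ℓ) (i : Fin j) {x} → P (toℕ i) x → P (toℕ (inject₁ i)) x
  jni P i {x} = subst (λ r → P r x) (sym (toℕ-inject₁ i))
  end⁻ : ∀ (P : ℕ → Pred ℕ 0ℓ) {x} → P (toℕ (fromℕ j)) x → P j x
  end⁻ P {x} = subst (λ r → P r x) (toℕ-fromℕ j)
  end⁺ : ∀ (P : ℕ → Pred ℕ 0ℓ) {x} → P j x → P (toℕ (fromℕ j)) x
  end⁺ P {x} = subst (λ r → P r x) (sym (toℕ-fromℕ j))
  to : ∀ i x → ((E ∪ W (lookup T (suc i))) ∩ (S ∩ W (lookup T (inject₁ i)))) x →
    (W (lookup B (inject₁ i)) ∩ (S ∩ W (lookup T (inject₁ i)))) x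
  to i x (h , Sx , w) = B⁻ (inject₁ i) (jni b i (into (toℕ i) x Sx (inj t i (T⁻ (inject₁ i) w))
    ([ inj₁ , inj₂ ∘ T⁻ (suc i) ]′ h))) , Sx , w
  from : ∀ i x → (W (lookup B (inject₁ i)) ∩ (S ∩ W (lookup T (inject₁ i)))) x →
    ((E ∪ W (lookup T (suc i))) ∩ (S ∩ W (lookup T (inject₁ i)))) x
  from i x (w′ , Sx , w) = [ inj₁ , inj₂ ∘ T⁺ (suc i) ]′
    (outof (toℕ i) x (m<n⇒m<1+n (toℕ<n i)) Sx (inj t i (T⁻ (inject₁ i) w)) (inj b i (B⁺ (inject₁ i) w′))) , Sx , w
  lastTo : ∀ x → (E ∩ (S ∩ last T)) x → (last B ∩ (S ∩ last T)) x
  lastTo x (h , Sx , w) =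
    B⁻ (fromℕ j) (end⁺ b (into j x Sx (end⁻ t (T⁻ (fromℕ j) w)) (inj₁ h))) , Sx , w
  lastFrom : ∀ x → (last B ∩ (S ∩ last T)) x → (E ∩ (S ∩ last T)) x
  lastFrom x (w′ , Sx , w) = [ id , (λ w″ → contradiction w″ (end x Sx)) ]′
    (outof j x ≤-refl Sx (end⁻ t (T⁻ (fromℕ j) w)) (end⁻ b (B⁺ (fromℕ j) w′))) , Sx , w

-- The set A for given N, number of rounds and final state

module Main (em : ExcludedMiddle 0ℓ) (N j : ℕ) (final : St)
  (few : (final ≡ inA × N < 2 * suc j) ⊎ (final ≡ inY × N < suc (2 * suc j))) where

  final-is : final ≡ inA ⊎ final ≡ inY
  final-is = [ inj₁ ∘ proj₁ , inj₂ ∘ proj₁ ]′ few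

  open Listings N (suc j) final
  open Requirements em {N} {suc j} {final} z<s final-is (Program.construction N (suc j) final)

  aI yI cI : ℕ
  aI = ce inAF []
  yI = ce inYF []
  cI = ce enterF []

  A⁻ : ∀ {x} → W aI x → A x
  A⁻ = ce⁻ inAF []

  A⁺ : ∀ {x} → A x → W aI x
  A⁺ (s , h) = ce⁺ inAF [] {s} h

  Y⁻ : ∀ {x} → W yI x → Y x
  Y⁻ = ce⁻ inYF []

  Y⁺ : ∀ {x} → Y x → W yI x
  Y⁺ (s , h) = ce⁺ inYF [] {s} h

  C⁻ : ∀ {x} → W cI x → C x
  C⁻ = ce⁻ enterF []

  C⁺ : ∀ {x} → C x → W cI x
  C⁺ (s , h) = ce⁺ enterF [] {s} h

  Y-avoids-A : W yI ⊆ ∁ (W aI)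
  Y-avoids-A {x} y a = A-Y-disjoint (A⁻ {x} a) (Y⁻ {x} y)

  no-Y : final ≡ inA → ∀ {x} → ¬ Y x
  no-Y isA {x} (s , eq) = go s eq
    where
    go : ∀ s → ¬ st x s ≡ inY
    go zero    e = case trans (sym (st-early x 0 z≤n)) e of λ ()
    go (suc s) e with decide (x < s)
    ... | no x≮s = case trans (sym (st-early x (suc s) (s≤s (≮⇒≥ x≮s)))) e of λ ()
    ... | yes x<s = by (st-step x s x<s) refl e
      where
      by : ∀ {z z′} → Step (suc j) final x s z z′ → st x s ≡ z → ¬ z′ ≡ inY
      by (top-final _ _) _ e′ = case trans (sym isA) e′ of λ ()
      by stay-Y e₀ _ = go s e₀
      by (stay-wait _) _ ()
      by (go-wait _ _) _ ()
      by (stay-rest _) _ ()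
      by (go-rest _ _) _ ()
      by (stay-climb _) _ ()
      by (go-climb _) _ ()
      by (top-A _) _ ()
      by (top-rest _ _) _ ()
      by stay-A _ ()

  -- P is what T₁ must contain below the threshold s₁: the complement of C for the property Q, the
  -- complement of A for tardiness. The stage y codes the true path through n.
  module Tracks (n s₁ y : ℕ) (fy : Follows (suc n) y) (P : ℕ → Set) where

    entryOf : ∀ {x} → Dec (P x) → ℕ
    entryOf (yes _) = 0
    entryOf (no _)  = 1

    -- T₁ may be changed arbitrarily below s₁, since any bounded set is computable.
    table : ℕ
    table = tab (λ x → entryOf (decide (P x))) s₁

    SF TF : Form 6
    SF = startF N (suc j) final
    TF = trackF N (suc j) final

    Sρ : Vec ℕ 4
    Sρ = s₁ ∷ table ∷ n ∷ y ∷ []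

    Tρ : ℕ → Vec ℕ 4
    Tρ r = suc r ∷ s₁ ∷ n ∷ y ∷ []

    tI : ℕ → ℕ
    tI zero    = ce SF Sρ
    tI (suc r) = ce TF (Tρ r)

    table⁻ : ∀ {x} → x < s₁ → look table s₁ x ≡ 0 → P x
    table⁻ {x} x<s₁ eq = go (decide (P x)) (trans (sym (look-tab (λ x → entryOf (decide (P x))) x<s₁)) eq)
      where
      go : (d : Dec (P x)) → entryOf d ≡ 0 → P x
      go (yes p) _ = p

    table⁺ : ∀ {x} → x < s₁ → P x → look table s₁ x ≡ 0
    table⁺ {x} x<s₁ p = trans (look-tab (λ x → entryOf (decide (P x))) x<s₁) (go (decide (P x)))
      where
      go : (d : Dec (P x)) → entryOf d ≡ 0
      go (yes _) = refl
      go (no np) = contradiction p np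

    same⁻ : ∀ x → SameNode n y x → Follows (suc n) x
    same⁻ x (n< , eqs) = n< , λ i i< → trans (eqs i i<) (proj₂ fy i i<)

    same⁺ : ∀ x → Follows (suc n) x → SameNode n y x
    same⁺ x (n< , eqs) = n< , λ i i< → trans (eqs i i<) (sym (proj₂ fy i i<))

    start⁻ : ∀ {x} → W (tI 0) x → (x < s₁ × P x) ⊎ (s₁ ≤ x × (Follows (suc n) x ⊎ Dead x))
    start⁻ {x} w = let s , h = ce⁻ SF Sρ w in go s h
      where
      go : ∀ s → Holds SF (s ∷ x ∷ Sρ) →
        (x < s₁ × P x) ⊎ (s₁ ≤ x × (Follows (suc n) x ⊎ Dead x))
      go s (inj₁ (lt , eq)) = inj₁ (lt , table⁻ lt eq)
      go s (inj₂ (le , inj₁ (_ , _ , same))) = inj₂ (le , inj₁ (same⁻ x same))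
      go s (inj₂ (le , inj₂ d)) = inj₂ (le , inj₂ (s , d))

    patched : ∀ {x} → x < s₁ → P x → W (tI 0) x
    patched lt p = ce⁺ SF Sρ {0} (inj₁ (lt , table⁺ lt p))

    dead⁺ : ∀ {x} → s₁ ≤ x → Dead x → W (tI 0) x
    dead⁺ le (s , d) = ce⁺ SF Sρ {s} (inj₂ (le , inj₂ d))

    follows⁺ : ∀ {x} → s₁ ≤ x → Follows (suc n) x → W (tI 0) x
    follows⁺ {x} le f = ce⁺ SF Sρ {suc (x ⊔ y)}
      (inj₂ (le , inj₁ (s≤s (m≤m⊔n x y) , s≤s (m≤n⊔m x y) , same⁺ x f)))

    T⁻ : ∀ r {x} → W (tI r) x → C x → (x < s₁ → ¬ P x) →
      s₁ ≤ x × Follows (suc n) x × Reached x (rest r)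
    T⁻ zero w c np = [ (λ (lt , p) → contradiction p (np lt))
      , (λ (le , h) → le , [ id , (λ d → contradiction c (dead-¬C d)) ]′ h , C-rest c) ]′ (start⁻ w)
    T⁻ (suc r) {x} w c np = let s , h = ce⁻ TF (Tρ r) w in go s h
      where
      go : ∀ s → Holds TF (s ∷ x ∷ Tρ r) →
        s₁ ≤ x × Follows (suc n) x × Reached x (rest (suc r))
      go s (le , (_ , _ , same) , u , _ , eq) = le , same⁻ x same , u , eq

    T⁺ : ∀ r {x} → s₁ ≤ x → Follows (suc n) x → Reached x (rest r) → W (tI r) x
    T⁺ zero    le f _ = follows⁺ le f
    T⁺ (suc r) {x} le f (u , eq) = ce⁺ TF (Tρ r) {suc (x ⊔ y ⊔ u)}
      ( le , ( s≤s (≤-trans (m≤m⊔n x y) (m≤m⊔n (x ⊔ y) u)) , s≤s (≤-trans (m≤n⊔m x y) (m≤m⊔n (x ⊔ y) u))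
             , same⁺ x f) , u , s≤s (m≤n⊔m (x ⊔ y) u) , eq)

    T-suc⁻ : ∀ r {x} → W (tI (suc r)) x → W (tI r) x
    T-suc⁻ r {x} w = let s , h = ce⁻ TF (Tρ r) w in go s h
      where
      go : ∀ s → Holds TF (s ∷ x ∷ Tρ r) → W (tI r) x
      go s (le , (_ , _ , same) , u , _ , eq) = T⁺ r le (same⁻ x same) (rest-≤ (n≤1+n r) (u , eq))

  gate : ∀ n → ∃[ s₁ ] (∀ x → s₁ ≤ x →
    (¬ Follows (suc n) x → (C x → E x) × (¬ C x → Dead x)) × (Follows (suc n) x → ∀ s → Uncut x n s))
  gate n = Eventually-× (off-path (suc n)) (on-path n)

  reference : ∀ n → ∃[ y ] Follows (suc n) y
  reference n = let y , _ , f = proj₁ (true-path (suc n)) 0 in y , f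

  -- The property Q

  e₀ : ℕ
  e₀ = ce falseF []

  empty-at : ∀ {s x} → ¬ (W[ e₀ ]at s) x
  empty-at {s} {x} w = let u , h = ce⁻ falseF [] {x} (s , w) in contradiction h λ ()

  -- `tuple` reads N components and ignores the rest of the code, so M can be hidden there to make
  -- the index large.
  empties : ∀ M → ∃[ i ] (M ≤ i × (∀ s x → ¬ (X[ N , i ]at s) x))
  empties M = pad N , M≤pad N , λ s x → none N
    where
    pad : ℕ → ℕ
    pad zero    = M
    pad (suc n) = ⟨ e₀ , pad n ⟩
    M≤pad : ∀ n → M ≤ pad n
    M≤pad zero    = ≤-refl
    M≤pad (suc n) = ≤-trans (M≤pad n) (right≤⟨⟩ e₀ (pad n))
    copies : ∀ n → Vec ℕ n
    copies zero    = []
    copies (suc n) = e₀ ∷ copies n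
    tuple-pad : ∀ n → tuple n (pad n) ≡ copies n
    tuple-pad zero    = refl
    tuple-pad (suc n) = cong₂ _∷_ (fst-⟨⟩ e₀ (pad n))
      (trans (cong (tuple n) (snd-⟨⟩ e₀ (pad n))) (tuple-pad n))
    empty-copies : ∀ n {s x} → ¬ Differences (copies n) s x
    empty-copies zero          ()
    empty-copies (suc zero)    {s} {x} w = empty-at {s} {x} w
    empty-copies (suc (suc n)) {s} {x} (inj₁ (w , _)) = empty-at {s} {x} w
    empty-copies (suc (suc n)) {s} {x} (inj₂ h) = empty-copies n {s} {x} h
    none : ∀ n {s x} → ¬ (X[ n , pad n ]at s) x
    none n {s} {x} h = empty-copies n {s} {x} (subst (λ v → Differences v s x) (tuple-pad n) h)

  bounded : ∀ xs → ∃[ M ] (∀ {x} → x List.∈ xs → x < M)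
  bounded []       = 0 , λ ()
  bounded (y ∷ xs) = let M , h = bounded xs in suc y ⊔ M , λ
    { (here refl) → m≤m⊔n (suc y) M ; (there p) → ≤-trans (h p) (m≤n⊔m (suc y) M) }

  major-subset : (E′ : Pred ℕ 0ℓ) → (∀ x → E x → E′ x) → (∀ x → E′ x → E x) → E′ ⊂ₘ W cI
  major-subset E′ e⁺ e⁻ = (λ {x} h → C⁺ (E⇒C (e⁻ x h))) ,
    (λ (xs , sub) → let M , bnd = bounded xs ; x , M≤x , c , ne = infinite empties M in
      <⇒≱ (bnd (sub (C⁺ c , λ h → ne (e⁻ x h)))) M≤x) ,
    λ e co → let s₀ , h = major e (λ x nc → co (λ w → nc (C⁻ w))) in
      upTo s₀ , λ {x} (nE , nW) → ∈-upTo⁺ (≰⇒> λ s₀≤x → nW (h x s₀≤x (λ h → nE (e⁺ x h))))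

  vecOf : (ℕ → ℕ) → Vec ℕ (suc j)
  vecOf f = tabulate (λ i → f (toℕ i))

  vec⁻ : ∀ f i {x} → W (lookup (vecOf f) i) x → W (f (toℕ i)) x
  vec⁻ f i {x} = subst (λ e → W e x) (lookup∘tabulate (λ i → f (toℕ i)) i)

  vec⁺ : ∀ f i {x} → W (f (toℕ i)) x → W (lookup (vecOf f) i) x
  vec⁺ f i {x} = subst (λ e → W e x) (sym (lookup∘tabulate (λ i → f (toℕ i)) i))

  vec-descending : ∀ f → (∀ r x → W (f (suc r)) x → W (f r) x) → Descending (vecOf f)
  vec-descending f h i {x} w = vec⁺ f (inject₁ i)
    (subst (λ r → W (f r) x) (sym (toℕ-inject₁ i)) (h (toℕ i) x (vec⁻ f (suc i) w)))

  dI : ℕ → ℕ → ℕ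
  dI e r = ce askedF (r ∷ e ∷ [])

  d⁻ : ∀ e r {x} → W (dI e r) x → ∃[ s ] AskedFor e r x s
  d⁻ e r = ce⁻ askedF (r ∷ e ∷ [])

  d⁺ : ∀ e r {x} s → AskedFor e r x s → W (dI e r) x
  d⁺ e r s h = ce⁺ askedF (r ∷ e ∷ []) {s} h

  -- E′ stands for the set about which Q speaks: A itself for even m, where Y is empty, and A ∪ Y
  -- for odd m.
  module Split (E′ : Pred ℕ 0ℓ) (e⁺ : ∀ x → E x → E′ x) (e⁻ : ∀ x → E′ x → E x)
    (B : Vec ℕ (suc j)) (n : ℕ) (2≤n : 2 ≤ fst n) (Bn : Bix n ≡ enc B)
    (cover : ∀ x → C x → W (Six n) x ⊎ W (Rix n) x) (S⇒C : ∀ x → W (Six n) x → C x)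
    (disjoint : ∀ x → W (Six n) x → ¬ W (Rix n) x)
    (φ : Φ {j} E′ (W (Six n)) B (vecOf (dI (enc B)))) where

    open QGate n 2≤n using (granted; completes) renaming (B to B′; D to D″)

    B⁻ : ∀ i {x} → B′ (toℕ i) x → W (lookup B i) x
    B⁻ i {x} = subst (λ e → W e x) (trans (cong (λ e → nth e (toℕ i)) Bn) (nth-enc B i))

    B⁺ : ∀ i {x} → W (lookup B i) x → B′ (toℕ i) x
    B⁺ i {x} = subst (λ e → W e x) (sym (trans (cong (λ e → nth e (toℕ i)) Bn) (nth-enc B i)))

    D⁻ : ∀ r {x} → D″ r x → W (dI (enc B) r) x
    D⁻ r (s , m , r′ , t , le , eq , m< , b , u , 2≤ , beq , asks) =
      d⁺ (enc B) r s (m , r′ , t , le , eq , m< , b , u , 2≤ , trans beq Bn , asks)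

    D⁺ : ∀ r {x} → W (dI (enc B) r) x → D″ r x
    D⁺ r w = let s , m , r′ , t , le , eq , m< , b , u , 2≤ , beq , asks = d⁻ (enc B) r w in
      s , m , r′ , t , le , eq , m< , b , u , 2≤ , trans beq (sym Bn) , asks

    φ₁ : ∀ i x → W (Six n) x → ¬ E x → D″ (toℕ i) x → B′ (toℕ i) x
    φ₁ i x Sx ne d = B⁺ i (proj₁ (proj₂ (φ i) {x} (vec⁺ (dI (enc B)) i (D⁻ (toℕ i) d) , Sx , λ h → ne (e⁻ x h))))

    φ₂ : ∀ i x → W (Six n) x → ¬ E x → B′ (toℕ i) x → D″ (toℕ i) x
    φ₂ i x Sx ne b = D⁺ (toℕ i) (vec⁻ (dI (enc B)) i (proj₁ (proj₁ (φ i) {x} (B⁻ i b , Sx , λ h → ne (e⁻ x h)))))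

    D⇒B : ∀ r → r < suc j → ∀ x → W (Six n) x → ¬ E x → D″ r x → B′ r x
    D⇒B r r<k x Sx ne d = subst (λ r → B′ r x) (toℕ-fromℕ< r<k)
      (φ₁ (fromℕ< r<k) x Sx ne (subst (λ r → D″ r x) (sym (toℕ-fromℕ< r<k)) d))

    B⇒D : ∀ r → r < suc j → ∀ x → W (Six n) x → ¬ E x → B′ r x → D″ r x
    B⇒D r r<k x Sx ne b = subst (λ r → D″ r x) (toℕ-fromℕ< r<k)
      (φ₂ (fromℕ< r<k) x Sx ne (subst (λ r → B′ r x) (sym (toℕ-fromℕ< r<k)) b))

    s₁ : ℕ
    s₁ = proj₁ (gate n)

    open Tracks n s₁ (proj₁ (reference n)) (proj₂ (reference n)) (λ x → ¬ C x) public

    T : Vec ℕ (suc j)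
    T = vecOf tI

    co⊆T : ∁ (W cI) ⊆ first T
    co⊆T {x} nc = go (decide (s₁ ≤ x)) (decide (Follows (suc n) x))
      where
      nc′ : ¬ C x
      nc′ c = nc (C⁺ c)
      go : Dec (s₁ ≤ x) → Dec (Follows (suc n) x) → W (tI 0) x
      go (no lt)  _       = patched (≰⇒> lt) nc′
      go (yes le) (yes f) = follows⁺ le f
      go (yes le) (no nf) = dead⁺ le (proj₂ (proj₁ (proj₂ (gate n) x le) nf) nc′)

    onTrack : ∀ r {x} → W (Six n) x → W (tI r) x →
      s₁ ≤ x × Follows (suc n) x × Reached x (rest r)
    onTrack r {x} Sx w = T⁻ r w (S⇒C x Sx) (λ _ nc → nc (S⇒C x Sx))

    into : ∀ r {x} → W (Six n) x → W (tI r) x → E x ⊎ W (tI (suc r)) x → B′ r x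
    into r {x} Sx w h = let le , f , re = onTrack r Sx w in
      granted cover disjoint D⇒B B⇒D f (proj₂ (proj₂ (gate n) x le) f) Sx
        (passed re ([ inj₁ , (λ w′ → inj₂ (proj₂ (proj₂ (onTrack (suc r) Sx w′)))) ]′ h))

    outof : ∀ r {x} → r < suc j → W (Six n) x → W (tI r) x → B′ r x → E x ⊎ W (tI (suc r)) x
    outof r {x} r<k Sx w b = let le , f , re = onTrack r Sx w in
      [ inj₁ , (λ re′ → inj₂ (T⁺ (suc r) le f re′)) ]′
        (completes cover disjoint D⇒B B⇒D f (proj₂ (proj₂ (gate n) x le) f) Sx r<k b)

    ψ : Ψ E′ (W (Six n)) B T
    ψ = Ψ-intro E′ (W (Six n)) B T (λ r → W (tI r)) B′ (vec⁻ tI) (vec⁺ tI) B⁻ B⁺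
      (λ r x Sx w h → into r Sx w ([ inj₁ ∘ e⁻ x , inj₂ ]′ h))
      (λ r x r<k Sx w b → [ inj₁ ∘ e⁺ x , inj₂ ]′ (outof r r<k Sx w b))
      (λ x Sx w → <-irrefl refl (rest-bound (proj₂ (proj₂ (onTrack (suc j) Sx w)))))

  trueI : ℕ
  trueI = ce trueF []

  all-true : ∀ x → W trueI x
  all-true x = ce⁺ trueF [] {0} z≤n

  asked-C : ∀ e r {x} → W (dI e r) x → W cI x
  asked-C e r w = let s , m , r′ , t , _ , eq , _ = d⁻ e r w in C⁺ (reached-C (s , eq) (λ ()))

  asked-suc : ∀ e r x → W (dI e (suc r)) x → W (dI e r) x
  asked-suc e r x w = let s , m , r′ , t , le , h = d⁻ e (suc r) w in
    d⁺ e r s (m , r′ , t , ≤-trans (n≤1+n r) le , h)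

  Tracked : Pred ℕ 0ℓ → Vec ℕ (suc j) → ℕ → Set
  Tracked E′ B s = ∃[ T ] (∁ (W cI) ⊆ first T × Descending {j} T ×
    (Φ {j} E′ (W s) B (vecOf (dI (enc B))) → Ψ {j} E′ (W s) B T))

  tracked-at : ∀ E′ → (∀ x → E x → E′ x) → (∀ x → E′ x → E x) →
    ∀ B n → 2 ≤ fst n → Bix n ≡ enc B → W (Six n) ∪ W (Rix n) ≐ W cI → W (Six n) ∩ W (Rix n) ≐ ∅ →
    Φ {j} E′ (W (Six n)) B (vecOf (dI (enc B))) → Tracked E′ B (Six n)
  tracked-at E′ e⁺ e⁻ B n 2≤ Bn cov dis φ =
    S.T , (λ {x} → S.co⊆T {x}) , vec-descending S.tI (λ r x → S.T-suc⁻ r {x}) , λ _ → S.ψ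
    where
    module S = Split E′ e⁺ e⁻ B n 2≤ Bn (λ x c → proj₂ cov (C⁺ c)) (λ x w → C⁻ (proj₁ cov (inj₁ w)))
      (λ x w w′ → proj₁ dis (w , w′)) φ

  -- T may depend on whether Φ holds. If Φ fails, the constant sequence of all numbers will do; if
  -- it holds, the gate that codes B and the splitting is true.
  tracked : ∀ E′ → (∀ x → E x → E′ x) → (∀ x → E′ x → E x) →
    ∀ B s b → W s ∪ W b ≐ W cI → W s ∩ W b ≐ ∅ →
    Dec (Φ {j} E′ (W s) B (vecOf (dI (enc B)))) → Tracked E′ B s
  tracked E′ e⁺ e⁻ B s b cov dis (no nφ) = vecOf (λ _ → trueI) , (λ {x} _ → all-true x) ,
    vec-descending (λ _ → trueI) (λ r x w → w) , λ φ → contradiction φ nφ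
  tracked E′ e⁺ e⁻ B s b cov dis (yes φ) = at-gate ⟨ 2 , ⟨ enc B , ⟨ s , b ⟩ ⟩ ⟩
      (fst-⟨⟩ 2 ⟨ enc B , ⟨ s , b ⟩ ⟩) (snd-⟨⟩ 2 ⟨ enc B , ⟨ s , b ⟩ ⟩)
    where
    go : ∀ n {s′ b′} → Six n ≡ s′ → Rix n ≡ b′ → 2 ≤ fst n → Bix n ≡ enc B → W s′ ∪ W b′ ≐ W cI →
      W s′ ∩ W b′ ≐ ∅ → Φ {j} E′ (W s′) B (vecOf (dI (enc B))) → Tracked E′ B s′
    go n refl refl = tracked-at E′ e⁺ e⁻ B n
    at-gate : ∀ n → fst n ≡ 2 → snd n ≡ ⟨ enc B , ⟨ s , b ⟩ ⟩ → Tracked E′ B s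
    at-gate n p q = go n (trans (cong fst ssn) (fst-⟨⟩ s b)) (trans (cong snd ssn) (snd-⟨⟩ s b))
        (≤-reflexive (sym p)) (trans (cong fst q) (fst-⟨⟩ (enc B) ⟨ s , b ⟩)) cov dis φ
      where
      ssn : snd (snd n) ≡ ⟨ s , b ⟩
      ssn = trans (cong snd q) (snd-⟨⟩ (enc B) ⟨ s , b ⟩)

  property-Q : (E′ : Pred ℕ 0ℓ) → (∀ x → E x → E′ x) → (∀ x → E′ x → E x) → Q-even j E′
  property-Q E′ e⁺ e⁻ = cI , major-subset E′ e⁺ e⁻ , λ B _ _ →
    vecOf (dI (enc B)) , (λ {x} → asked-C (enc B) 0 {x}) ,
    vec-descending (dI (enc B)) (asked-suc (enc B)) ,
    λ s (b , cov , dis) → tracked E′ e⁺ e⁻ B s b cov dis (decide (Φ {j} E′ (W s) B (vecOf (dI (enc B)))))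

  -- A is not N-tardy

  -- variables: time, stage
  promptF : Form 2
  promptF = all< (sucE v1) (appF inAF (sucE v2 ∷ v0 ∷ []) ⇒ᶠ appF atF (lit aI ∷ v1 ∷ v0 ∷ []))

  Eventually-⇒ : ∀ {P : Set} {R : ℕ → Set} → (P → Eventually R) → Eventually (λ s → P → R s)
  Eventually-⇒ {P} h with decide P
  ... | yes p = proj₁ (h p) , λ s le _ → proj₂ (h p) s le
  ... | no np = 0 , λ s _ p → contradiction p np

  prompt-total : ∀ ρ → ∃[ t ] Holds promptF (t ∷ ρ)
  prompt-total (s ∷ []) =
    let t , h = Eventually-∀< {λ x t → st x (suc s) ≡ inA → (W[ aI ]at t) x} (suc s)
                  (λ x _ → Eventually-⇒ (λ e → ce-eventually inAF [] {suc s} {x} e)) in t , h t ≤-refl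

  -- `caught` speaks of stages of the construction, tardiness of the standard enumeration of A. The
  -- function waits until the latter has listed everything that is in A at stage s + 1; taking the
  -- least such time makes it monotone.
  promptX : Exp 1
  promptX = minE promptF prompt-total

  prompt-holds : ∀ s x → st x (suc s) ≡ inA → (W[ aI ]at (fn promptX (s ∷ []))) x
  prompt-holds s x e = min-holds promptF prompt-total (s ∷ []) x (active e (λ ())) e

  prompt-least : ∀ s t → (∀ x → x < suc s → st x (suc s) ≡ inA → (W[ aI ]at t) x) →
    fn promptX (s ∷ []) ≤ t
  prompt-least s t = min-least promptF prompt-total (s ∷ []) t

  prompt-mono : Monotonic₁ _≤_ _≤_ (λ s → fn promptX (s ∷ []))
  prompt-mono {s} {s′} le = prompt-least s (fn promptX (s′ ∷ []))
    (λ x _ e → prompt-holds s′ x (A-stays e (suc s′) (s≤s le)))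

  not-tardy : ¬ Tardy N aI
  not-tardy tardy = late-at (tardy (λ s → fn promptX (s ∷ [])) (computable promptX) prompt-mono)
    where
    late-at : ∃[ i ] ((X[ N ] i ≐ ∁ (W aI)) ×
      (∀ x s → x ∈ X[ N , i ]at s → x ∉ W[ aI ]at (fn promptX (s ∷ [])))) → ⊥
    late-at (i , eq , late) =
      let x , s , d , e = caught i few ((λ {x} h a → proj₁ eq h (A⁺ a)) , (λ {x} na → proj₂ eq (λ w → na (A⁻ w))))
      in late x s d (prompt-holds s x e)

  -- A is m-tardy

  GF : Form 5
  GF = gateF N (suc j) final

  dG : ℕ → ℕ → ℕ → ℕ
  dG r n s₁ = ce GF (r ∷ n ∷ s₁ ∷ [])

  -- The gate must delay A beyond the time when the index dG r n s₁ has enumerated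
  -- x; as this time has to be known before the gate is, all gates are bounded at once.
  settleF : Form 2
  settleF = all< v1 (all< v2 (all< (lit (suc j)) (all< (sucE v4)
    (appF GF (v5 ∷ v3 ∷ v1 ∷ v2 ∷ v0 ∷ []) ⇒ᶠ appF (ceAtF GF) (v4 ∷ v3 ∷ v1 ∷ v2 ∷ v0 ∷ [])))))

  settle-total : ∀ ρ → ∃[ t ] Holds settleF (t ∷ ρ)
  settle-total (u ∷ []) = let t , h = all-settle in t , h t ≤-refl
    where
    all-settle : Eventually (λ t → Holds settleF (t ∷ u ∷ []))
    all-settle =
      Eventually-∀< {λ x t → ∀ n → n < u → ∀ r → r < suc j → ∀ s₁ → s₁ < suc u →
          Holds GF (u ∷ x ∷ r ∷ n ∷ s₁ ∷ []) → (W[ dG r n s₁ ]at t) x} u λ x _ →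
      Eventually-∀< {λ n t → ∀ r → r < suc j → ∀ s₁ → s₁ < suc u →
          Holds GF (u ∷ x ∷ r ∷ n ∷ s₁ ∷ []) → (W[ dG r n s₁ ]at t) x} u λ n _ →
      Eventually-∀< {λ r t → ∀ s₁ → s₁ < suc u →
          Holds GF (u ∷ x ∷ r ∷ n ∷ s₁ ∷ []) → (W[ dG r n s₁ ]at t) x} (suc j) λ r _ →
      Eventually-∀< {λ s₁ t → Holds GF (u ∷ x ∷ r ∷ n ∷ s₁ ∷ []) → (W[ dG r n s₁ ]at t) x} (suc u) λ s₁ _ →
      Eventually-⇒ (λ h → ce-eventually GF (r ∷ n ∷ s₁ ∷ []) {u} {x} h)

  settleX : Exp 1
  settleX = minE settleF settle-total

  settle-holds : ∀ u x n r s₁ → x < u → n < u → r < suc j → s₁ < suc u →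
    s₁ ≤ x × st x u ≡ climb r (suc n) u → (W[ dG r n s₁ ]at (fn settleX (u ∷ []))) x
  settle-holds u x n r s₁ x< n< r< s₁< h =
    min-holds settleF settle-total (u ∷ []) x x< n n< r r< s₁ s₁< h

  -- The delay at an arrival u is p applied to a time by which the index of Dᵣ is sure to have
  -- listed this arrival.
  module TardyCase (p : ℕ → ℕ) (p-mono : Monotonic₁ _≤_ _≤_ p) (q n : ℕ) (kind : fst n ≡ 1)
    (arg : snd n ≡ q) (q-computes : ∀ u → ∃[ s ] run s (decode q) u ≡ just (p (fn settleX (u ∷ [])))) where

    private
      total : ∀ u → ∃[ s ] Delayed (snd n) u s
      total u = let s , eq = q-computes u ; v = p (fn settleX (u ∷ [])) in
        s ⊔ suc v , v , m≤n⊔m s (suc v) ,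
        trans (cong (λ q → run (s ⊔ suc v) (decode q) u) arg) (run-mono (decode q) (m≤m⊔n s (suc v)) eq)

    open DelayGate n kind total

    s₁ : ℕ
    s₁ = proj₁ (gate n)

    open Tracks n s₁ (proj₁ (reference n)) (proj₂ (reference n)) (λ x → ¬ A x)

    d : ℕ → ℕ
    d r = dG r n s₁

    open Presentation tI d yI

    arrives⁻ : ∀ r {x} → W (d r) x → s₁ ≤ x × ∃[ u ] Arrives r x u
    arrives⁻ r {x} w = let u , le , h = ce⁻ GF (r ∷ n ∷ s₁ ∷ []) w in le , u , h

    arrives⁺ : ∀ r {x u} → s₁ ≤ x → Arrives r x u → W (d r) x
    arrives⁺ r {x} {u} le h = ce⁺ GF (r ∷ n ∷ s₁ ∷ []) {u} (le , h)

    onTrack : ∀ r {x} → A x → W (tI r) x → s₁ ≤ x × Follows (suc n) x × Reached x (rest r)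
    onTrack r a w = T⁻ r w (E⇒C (inj₁ a)) (λ _ na → na a)

    uncut : ∀ {x} → s₁ ≤ x → Follows (suc n) x → ∀ s → Uncut x n s
    uncut {x} le f = proj₂ (proj₂ (gate n) x le) f

    outside : ∀ r {x} → A x → W (tI r) x → W (d r) x
    outside r {x} a w = let le , f , re = onTrack r a w ; u , _ , arr , _ = delays f (uncut le f) a re in
      arrives⁺ r {x} {u} le arr

    -- Below s₁ the patched T₁ contains x, and `d` admits nothing there. Outside C, x follows the
    -- path or is dead, so T₁ contains it and it never arrives anywhere. In C but outside A and Y,
    -- the round in which x settles provides the difference.
    inside : ∀ {x} → ¬ A x → (∃[ r ] (r < suc j × W (tI r) x × ¬ W (d r) x)) ⊎ Y x
    inside {x} na = go (decide (s₁ ≤ x)) (decide (Y x)) (decide (C x)) (decide (Follows (suc n) x))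
      where
      early : ∀ {r} → x < s₁ → ¬ W (d r) x
      early {r} lt w = <⇒≱ lt (proj₁ (arrives⁻ r w))
      unmoved : ¬ C x → ∀ r → ¬ W (d r) x
      unmoved nc r w = let _ , u , arr = arrives⁻ r w in nc (reached-C (u , arr) (λ ()))
      go : Dec (s₁ ≤ x) → Dec (Y x) → Dec (C x) → Dec (Follows (suc n) x) →
        (∃[ r ] (r < suc j × W (tI r) x × ¬ W (d r) x)) ⊎ Y x
      go (no lt)  _        _        _       = inj₁ (0 , z<s , patched (≰⇒> lt) na , early {0} (≰⇒> lt))
      go (yes le) (yes y)  _        _       = inj₂ y
      go (yes le) (no ny)  (no nc)  (yes f) = inj₁ (0 , z<s , follows⁺ le f , unmoved nc 0)
      go (yes le) (no ny)  (no nc)  (no nf) =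
        inj₁ (0 , z<s , dead⁺ le (proj₂ (proj₁ (proj₂ (gate n) x le) nf) nc) , unmoved nc 0)
      go (yes le) (no ny)  (yes c)  (no nf) =
        contradiction (proj₁ (proj₁ (proj₂ (gate n) x le) nf) c) [ na , ny ]′
      go (yes le) (no ny)  (yes c)  (yes f) =
        let r , re , narr = stays-in f (uncut le f) [ na , ny ]′ c in
        inj₁ (r , rest-bound re , T⁺ r le f re , λ w → narr (proj₁ (proj₂ (arrives⁻ r w))) (proj₂ (proj₂ (arrives⁻ r w))))

    -- Let u be the arrival of x in round r. As x is not yet listed in `d r` at s, s is at most the
    -- time set for u; so p(s) is at most the delay, and x was still outside A when the delay was
    -- over.
    late : ∀ r x s → (W[ tI r ]at s) x → ¬ (W[ d r ]at s) x → ¬ (W[ aI ]at (p s)) x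
    late r x s w nd wa = let a = A⁻ (p s , wa)
                             le , f , re = onTrack r a (s , w)
                             u , s′ , arr , del , nA = delays f (uncut le f) a re
                         in clash le f re u s′ arr del nA
      where
      clash : s₁ ≤ x → Follows (suc n) x → Reached x (rest r) → ∀ u s′ → Arrives r x u →
        Delayed (snd n) u s′ → ¬ st x s′ ≡ inA → ⊥
      clash le f re u s′ arr (v , v<s′ , eq) nA = nA (A-stays (proj₂ (proj₂ enters)) s′ (<⇒≤ (≤-trans (proj₁ (proj₂ enters)) p≤s′)))
        where
        enters : ∃[ s₀ ] (s₀ < p s × st x s₀ ≡ inA)
        enters = ce-at inAF [] wa
        x<u : x < u
        x<u = active arr (λ ())
        v≡ : p (fn settleX (u ∷ [])) ≡ v
        v≡ = let s₀ , eq₀ = q-computes u in just-injective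
          (trans (sym (run-mono (decode q) (m≤m⊔n s₀ s′) eq₀))
                 (run-mono (decode q) (m≤n⊔m s₀ s′) (trans (cong (λ q → run s′ (decode q) u) (sym arg)) eq)))
        s≤ : s ≤ fn settleX (u ∷ [])
        -- All parameters lie within the range covered at u, because n < `len x` ≤ x < u and s₁ ≤ x
        -- < u.
        s≤ = ≮⇒≥ λ lt → nd (W-mono (d r) (<⇒≤ lt)
          (settle-holds u x n r s₁ x<u (<-trans (≤-trans (proj₁ f) (len≤ x)) x<u) (rest-bound re)
            (s≤s (≤-trans le (<⇒≤ x<u))) (le , arr)))
        p≤s′ : p s ≤ s′
        p≤s′ = ≤-trans (p-mono s≤) (≤-trans (≤-reflexive v≡) (<⇒≤ v<s′))

    module _ (m : ℕ) (size : (final ≡ inA × m ≡ suc j * 2) ⊎ (final ≡ inY × m ≡ suc (suc j * 2))) where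

      size′ : (m ≡ suc j * 2 × (∀ x → ¬ W yI x)) ⊎ m ≡ suc (suc j * 2)
      size′ = [ (λ (isA , eq) → inj₁ (eq , λ x y → no-Y isA {x} (Y⁻ {x} y))) , inj₂ ∘ proj₂ ]′ size

      inside′ : ∀ x → ¬ W aI x → (∃[ r ] (r < suc j × W (tI r) x × ¬ W (d r) x)) ⊎ W yI x
      inside′ x na = map₂ (Y⁺ {x}) (inside (λ a → na (A⁺ {x} a)))

      conclusion : ∃[ e ] ((X[ m ] e ≐ ∁ (W aI)) × (∀ x s → x ∈ X[ m , e ]at s → x ∉ W[ aI ]at (p s)))
      conclusion = presented aI p m (suc j) size′ (λ r x a → outside r (A⁻ {x} a))
        (λ x a y → A-Y-disjoint (A⁻ {x} a) (Y⁻ {x} y)) inside′ late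

  tardy : ∀ m → (final ≡ inA × m ≡ suc j * 2) ⊎ (final ≡ inY × m ≡ suc (suc j * 2)) → Tardy m aI
  tardy m size p comp p-mono = at-gate ⟨ 1 , q ⟩ (fst-⟨⟩ 1 q) (snd-⟨⟩ 1 q)
    where
    delayX : Exp 1
    delayX = app (computableX comp) (settleX ∷ [])
    q : ℕ
    q = proj₁ (computable delayX)
    at-gate : ∀ n → fst n ≡ 1 → snd n ≡ q →
      ∃[ e ] ((X[ m ] e ≐ ∁ (W aI)) × (∀ x s → x ∈ X[ m , e ]at s → x ∉ W[ aI ]at (p s)))
    at-gate n kind arg = TardyCase.conclusion p p-mono q n kind arg (proj₂ (computable delayX)) m size

-- The two parities

halves : ∀ m → 2 ≤ m → ∃[ j ] (m ≡ suc j * 2 ⊎ m ≡ suc (suc j * 2))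
halves 1 (s≤s ())
halves 2 _ = 0 , inj₁ refl
halves 3 _ = 0 , inj₂ refl
halves (suc (suc (suc (suc m)))) _ = let j , h = halves (suc (suc m)) (s≤s (s≤s z≤n)) in
  suc j , map-⊎ (cong (2 +_)) (cong (2 +_)) h

-- Here k = j + 1 and N = 2k - 1, so k rounds exhaust the changes of mind and the last round may
-- always end in A.
even-case : ExcludedMiddle 0ℓ → ∀ j → ∃[ a ] (ProperlyTardy (suc j * 2) a × Q (suc j * 2) (W a))
even-case em j = aI , (tardy (suc j * 2) (inj₁ (refl , refl)) , not-tardy) ,
    inj₁ (j , *-comm (suc j) 2 , property-Q (W aI)
      (λ x → [ (λ a → A⁺ {x} a) , (λ y → contradiction y (no-Y refl {x})) ]′) (λ x w → inj₁ (A⁻ {x} w)))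
  where
  few : suc (j * 2) < 2 * suc j
  few = ≤-reflexive (*-comm (suc j) 2)
  open Main em (suc (j * 2)) j inA (inj₁ (refl , few))

-- Here N = 2k: after k rounds without success X[ N ] i has no change left, and keeping the element
-- in Y refutes it.
odd-case : ExcludedMiddle 0ℓ → ∀ j →
  ∃[ a ] (ProperlyTardy (suc (suc j * 2)) a × Q (suc (suc j * 2)) (W a))
odd-case em j = aI , (tardy (suc (suc j * 2)) (inj₂ (refl , refl)) , not-tardy) ,
    inj₂ (j , size , yI , (λ {x} → Y-avoids-A {x}) ,
      property-Q (W aI ∪ W yI) (λ x → map-⊎ (A⁺ {x}) (Y⁺ {x})) (λ x → map-⊎ (A⁻ {x}) (Y⁻ {x})))
  where
  size : suc (suc j * 2) ≡ 2 * suc j + 1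
  size = trans (cong suc (*-comm (suc j) 2)) (+-comm 1 (2 * suc j))
  few : suc j * 2 < suc (2 * suc j)
  few = s≤s (≤-reflexive (*-comm (suc j) 2))
  open Main em (suc j * 2) j inY (inj₂ (refl , few))

theorem4p1 : ExcludedMiddle 0ℓ → ∀ (m : ℕ) → 2 ≤ m → ∃[ a ] (ProperlyTardy m a × Q m (W a))
theorem4p1 em m 2≤m = case halves m 2≤m of λ
  { (j , inj₁ refl) → even-case em j ; (j , inj₂ refl) → odd-case em j }
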